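{- There exists a positive constant $C$ such that for infinitely many positive integers $n$ one has $\omega(n+k) \le \Omega(n+k) \le C\log k$ for every integer $k \ge 2$.
   Context: $\omega(m)=\sum_{p\mid m}1$ is the number of distinct prime factors of $m$, and $\Omega(m)=\sum_{p^j\mid m,\ j\ge1}1$ is the number of prime factors of $m$ counted with multiplicity. -}

module Defs where

open import Data.Nat using (ℕ; suc; _^_)
open import Data.Nat.Divisibility using (_∣_; _∣?_)
open import Data.Nat.Primality using (Prime; prime?)
open import Data.List using (List; upTo; map; length; filter)
open import Data.Nat.ListAction using (sum)
open import Relation.Nullary.Decidable using (_×-dec_)

-- ω m = #{ p prime : p ∣ m }, for m ≥ 1 (every such p lies in [0, m]).
ω : ℕ → ℕ
ω m = length (filter (λ p → prime? p ×-dec (p ∣? m)) (upTo (suc m)))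

-- Ω m = #{ (p , j) : p prime, j ≥ 1, p ^ j ∣ m }, for m ≥ 1.
-- For such pairs p ≤ m and j ≤ m (since 2 ^ j > j), so we range over
-- p ∈ [0, m] and j ∈ [1, m].
Ω : ℕ → ℕ
Ω m = sum (map (λ p → length (filter (λ j → prime? p ×-dec ((p ^ suc j) ∣? m)) (upTo m)))
               (upTo (suc m)))

module Submission where

-- Brun–Hooley sieve with growing dimension.  Put J = 4 ^ j, W = 4 ^ J, y = 2 ^ J and M = (y !)², and look at
-- n = M (m + 1) with m < X = 2 ^ (512 W).  For the r-th block of primes, (2 ^ 4 ^ (J - r), 2 ^ 4 ^ (J - r + 1)],
-- demand p ∤ n + k for 1 ≤ k ≤ 2 ^ r.  The block has bounded Mertens mass (by Chebyshev), so its
-- dimension is O(2 ^ r); truncating Bonferroni at order 32 · 2 ^ r costs a level that is summable over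
-- r, since 2 ^ r grows slower than the logarithms 4 ^ (J - r) shrink.  A survivor n has n + k = g (c (m + 1) + e)
-- with g ∣ k, and for k < 2 ^ r the cofactor has no prime factor up to 2 ^ 4 ^ (J - r + 1) when r is admissible.
-- If the cofactor had more than O(log k) prime factors, some product d ≤ 2 ^ W of exactly t ≍ log k
-- of them would divide it.  The upper bound sieve counts such survivors by V X f(d) with f multiplicative,
-- and Rankin's trick bounds the sum over d by 2 ^ O(r) (2/3) ^ t, which is O(k⁻²).
-- Summing over k loses only a small fraction of the survivors, so one of them is good for every k.

-- Keeping every `n + k` free of primes up to one common bound would give a sieve of unbounded
-- dimension. The demand is therefore relaxed as `k` grows: for `k` near `2 ^ r` the unsieved primes
-- up to `2 ^ W` have Mertens product at least `64 ^ (- r)`, a power of `1 / k`, and Rankin's trick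
-- turns this into a bound that a saving `(2/3) ^ t` with `t` of order `log k` beats. The sizes are
-- forced. `y = 2 ^ J` exceeds twice every width `2 ^ r`, so a sieving prime divides at most one of
-- the numbers it is meant to avoid. `W = 4 ^ J` because block `r` costs about `2 ^ r * 4 ^ (J - r)`
-- in the exponent of the error, with sum of order `2 ^ J * 2 ^ J`, and because `M` is at most
-- `2 ^ (2 * J * 2 ^ J)`. The square in `M` leaves a full `y !` in the cofactor after division by
-- `g`. If `r` is too large for the sieve, `k` is so large that all primes up to `2 ^ W` together
-- still have Mertens product a power of `1 / k`; for `k` at least `n` the bound `log (2 k)` is
-- enough. No logarithm of a real number enters: lower bounds for products of `1 - 1 / p` replace
-- sums of `1 / p`.

module Chebyshev where

  -- Primes in an interval and Chebyshev's upper bound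

  open import Data.Nat
  open import Data.Nat.Properties
  open import Data.Nat.Divisibility
  open import Data.Nat.Primality
  open import Data.Nat.DivMod using (m/n*n≡m)
  open import Data.Nat.Combinatorics
  open import Data.Nat.ListAction using (product)
  open import Relation.Binary.PropositionalEquality
  open import Relation.Nullary using (¬_; yes; no; contradiction)
  open import Data.Sum using (_⊎_; inj₁; inj₂)
  open import Data.List using (List; []; _∷_; map; _++_; length)
  open import Data.List.Relation.Unary.All as All using (All; []; _∷_)
  open import Data.List.Relation.Unary.AllPairs as AllPairs using (AllPairs; []; _∷_)
  open import Data.List.Relation.Unary.Any using (here; there)
  open import Data.List.Membership.Propositional using (_∈_)

  -- The primes p with a < p ≤ a + n.
  primesAfter : ℕ → ℕ → List ℕ
  primesAfter a zero = []
  primesAfter a (suc n) with prime? (suc a)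
  ... | yes _ = suc a ∷ primesAfter (suc a) n
  ... | no _ = primesAfter (suc a) n

  after-prime : ∀ a n → All Prime (primesAfter a n)
  after-prime a zero = []
  after-prime a (suc n) with prime? (suc a)
  ... | yes pr = pr ∷ after-prime (suc a) n
  ... | no _ = after-prime (suc a) n

  after-> : ∀ a n → All (a <_) (primesAfter a n)
  after-> a zero = []
  after-> a (suc n) with prime? (suc a)
  ... | yes pr = n<1+n a ∷ All.map (<-trans (n<1+n a)) (after-> (suc a) n)
  ... | no _ = All.map (<-trans (n<1+n a)) (after-> (suc a) n)

  after-≤ : ∀ a n → All (_≤ a + n) (primesAfter a n)
  after-≤ a zero = []
  after-≤ a (suc n) with prime? (suc a)
  ... | yes pr = ≤-trans (m≤m+n (suc a) n) (≤-reflexive (sym (+-suc a n))) ∷ All.map (λ h → ≤-trans h (≤-reflexive (sym (+-suc a n)))) (after-≤ (suc a) n)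
  ... | no _ = All.map (λ h → ≤-trans h (≤-reflexive (sym (+-suc a n)))) (after-≤ (suc a) n)

  after-< : ∀ a n → AllPairs _<_ (primesAfter a n)
  after-< a zero = []
  after-< a (suc n) with prime? (suc a)
  ... | yes pr = after-> (suc a) n ∷ after-< (suc a) n
  ... | no _ = after-< (suc a) n

  after-∈ : ∀ a n {p} → Prime p → a < p → p ≤ a + n → p ∈ primesAfter a n
  after-∈ a zero pr l h = contradiction (≤-trans h (≤-reflexive (+-identityʳ a))) (<⇒≱ l)
  after-∈ a (suc n) {p} pr l h with suc a ≟ p
  after-∈ a (suc n) {p} pr l h | yes refl with prime? (suc a)
  ... | yes _ = here refl
  ... | no ¬pr = contradiction pr ¬pr
  after-∈ a (suc n) {p} pr l h | no ne with prime? (suc a) | after-∈ (suc a) n pr (≤∧≢⇒< l ne) (≤-trans h (≤-reflexive (+-suc a n)))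
  ... | yes _ | ih = there ih
  ... | no _ | ih = ih

  after-++ : ∀ a m n → primesAfter a (m + n) ≡ primesAfter a m ++ primesAfter (a + m) n
  after-++ a zero n = cong (λ w → primesAfter w n) (sym (+-identityʳ a))
  after-++ a (suc m) n with prime? (suc a) | trans (after-++ (suc a) m n) (cong (λ w → primesAfter (suc a) m ++ primesAfter w n) (sym (+-suc a m)))
  ... | yes _ | eq = cong (suc a ∷_) eq
  ... | no _ | eq = eq

  after-length : ∀ a n → length (primesAfter a n) ≤ n
  after-length a zero = z≤n
  after-length a (suc n) with prime? (suc a)
  ... | yes _ = s≤s (after-length (suc a) n)
  ... | no _ = m≤n⇒m≤1+n (after-length (suc a) n)

  -- Euclid's lemma peels off the smallest prime: a later prime that divides `m = q * p` cannot
  -- divide `p`, since it is larger, and so divides `q`.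
  product-∣ : ∀ {L} m → All Prime L → AllPairs _<_ L → All (_∣ m) L → product L ∣ m
  product-∣ m [] [] [] = 1∣ m
  product-∣ {p ∷ L} m (pr ∷ prs) (a ∷ as) (divides q eq ∷ ds) = subst (p * product L ∣_) (trans (*-comm p q) (sym eq)) (*-monoʳ-∣ p (product-∣ q prs as (go L prs a ds)))
    where
    go : ∀ L → All Prime L → All (p <_) L → All (_∣ m) L → All (_∣ q) L
    go [] [] [] [] = []
    go (r ∷ L) (pr′ ∷ prs) (l ∷ ls) (d ∷ ds) = h (euclidsLemma q p pr′ (subst (r ∣_) eq d)) ∷ go L prs ls ds
      where
      h : r ∣ q ⊎ r ∣ p → r ∣ q
      h (inj₁ x) = x
      h (inj₂ x) = contradiction (∣⇒≤ {{prime⇒nonZero pr}} x) (<⇒≱ l)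

  ∣! : ∀ {k n} → 0 < k → k ≤ n → k ∣ n !
  ∣! {suc k} _ h = ∣-trans (m∣m*n (k !)) (m≤n⇒m!∣n! h)

  prime∤! : ∀ {p} n → Prime p → n < p → ¬ p ∣ n !
  prime∤! zero pr _ h with ∣1⇒≡1 h
  ... | refl = ¬prime[1] pr
  prime∤! (suc n) pr l h with euclidsLemma (suc n) (n !) pr h
  ... | inj₁ x = <⇒≱ l (∣⇒≤ x)
  ... | inj₂ x = prime∤! n pr (<-trans (n<1+n n) l) x

  C≤2^ : ∀ n k → n C k ≤ 2 ^ n
  C≤2^ zero zero = ≤-refl
  C≤2^ zero (suc k) = ≤-trans (≤-reflexive (k>n⇒nCk≡0 {0} {suc k} (s≤s z≤n))) z≤n
  C≤2^ (suc n) zero = m^n>0 2 (suc n)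
  C≤2^ (suc n) (suc k) = begin
    suc n C suc k ≡⟨ sym (nCk+nC[k+1]≡[n+1]C[k+1] n k) ⟩
    n C k + n C suc k ≤⟨ +-mono-≤ (C≤2^ n k) (C≤2^ n (suc k)) ⟩
    2 ^ n + 2 ^ n ≡⟨ cong (2 ^ n +_) (sym (+-identityʳ (2 ^ n))) ⟩
    2 ^ suc n ∎
    where open ≤-Reasoning

  central : ∀ N → ((N + N) C N) * (N ! * N !) ≡ (N + N) !
  central N = trans (cong₂ _*_ (nCk≡n!/k![n-k]! {N + N} {N} (m≤m+n N N)) (cong (λ w → N ! * w !) (sym (m+n∸m≡n N N))))
      (m/n*n≡m {{N !* (N + N ∸ N) !≢0}} (k![n∸k]!∣n! {N + N} {N} (m≤m+n N N)))

  ^-cancel-≤ : ∀ {a b} → 2 ^ a ≤ 2 ^ b → a ≤ b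
  ^-cancel-≤ {a} {b} h with a ≤? b
  ... | yes l = l
  ... | no ¬l = contradiction h (<⇒≱ (^-monoʳ-< 2 (s≤s (s≤s z≤n)) (≰⇒> ¬l)))

  ^length≤product : ∀ N L → All (N <_) L → N ^ length L ≤ product L
  ^length≤product N [] [] = ≤-refl
  ^length≤product N (p ∷ L) (h ∷ hs) = *-mono-≤ (<⇒≤ h) (^length≤product N L hs)

  -- Every prime in `(N, 2N]` divides the central binomial coefficient, which is at most `2 ^ (2N)`;
  -- each of these primes exceeds `N = 2 ^ i`, so comparing exponents of 2 bounds their number.
  chebyshev : ∀ i → i * length (primesAfter (2 ^ i) (2 ^ i)) ≤ 2 * 2 ^ i
  chebyshev i = ^-cancel-≤ (begin
    2 ^ (i * length L) ≡⟨ sym (^-*-assoc 2 i (length L)) ⟩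
    N ^ length L ≤⟨ ^length≤product N L (after-> N N) ⟩
    product L ≤⟨ ∣⇒≤ {{C≢0}} (product-∣ ((N + N) C N) (after-prime N N) (after-< N N) (div (after-prime N N) (after-> N N) (after-≤ N N))) ⟩
    (N + N) C N ≤⟨ C≤2^ (N + N) N ⟩
    2 ^ (N + N) ≡⟨ cong (λ w → 2 ^ (N + w)) (sym (+-identityʳ N)) ⟩
    2 ^ (2 * N) ∎)
    where
    open ≤-Reasoning
    N = 2 ^ i
    L = primesAfter N N
    C≢0 : NonZero ((N + N) C N)
    C≢0 = ≢-nonZero (λ e → n≮0 (≤-trans (1≤n! (N + N)) (≤-reflexive (trans (sym (central N)) (cong (_* (N ! * N !)) e)))))
    div : ∀ {L} → All Prime L → All (N <_) L → All (_≤ N + N) L → All (_∣ (N + N) C N) L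
    div [] [] [] = []
    div {p ∷ L} (pr ∷ prs) (l ∷ ls) (h ∷ hs) = d ∷ div prs ls hs
      where
      d : p ∣ (N + N) C N
      d with euclidsLemma ((N + N) C N) (N ! * N !) pr (subst (p ∣_) (sym (central N)) (∣! (≤-trans (s≤s z≤n) l) h))
      ... | inj₁ x = x
      ... | inj₂ x with euclidsLemma (N !) (N !) pr x
      ...   | inj₁ y = contradiction y (prime∤! N pr l)
      ...   | inj₂ y = contradiction y (prime∤! N pr l)

  range : ℕ → ℕ → List ℕ
  range a b = primesAfter a (b ∸ a)

  range-++ : ∀ {a b c} → a ≤ b → b ≤ c → range a c ≡ range a b ++ range b c
  range-++ {a} {b} {c} h h′ = trans (cong (primesAfter a) e) (trans (after-++ a (b ∸ a) (c ∸ b)) (cong (λ w → primesAfter a (b ∸ a) ++ primesAfter w (c ∸ b)) (m+[n∸m]≡n h)))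
    where
    e : c ∸ a ≡ (b ∸ a) + (c ∸ b)
    e = trans (cong (_∸ a) (sym (m+[n∸m]≡n h′))) (trans (cong (λ w → w + (c ∸ b) ∸ a) (sym (m+[n∸m]≡n h))) (trans (cong (_∸ a) (+-assoc a (b ∸ a) (c ∸ b))) (m+n∸m≡n a _)))

  range-∈ : ∀ {a b p} → Prime p → a < p → p ≤ b → p ∈ range a b
  range-∈ {a} {b} pr l h = after-∈ a (b ∸ a) pr l (≤-trans h (m≤n+m∸n b a))

  range-≤ : ∀ {a b} → a ≤ b → All (_≤ b) (range a b)
  range-≤ {a} {b} l = All.map (λ h → ≤-trans h (≤-reflexive (m+[n∸m]≡n l))) (after-≤ a (b ∸ a))

  range-> : ∀ a b → All (a <_) (range a b)
  range-> a b = after-> a (b ∸ a)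

  range-< : ∀ a b → AllPairs _<_ (range a b)
  range-< a b = after-< a (b ∸ a)

  range-prime : ∀ a b → All Prime (range a b)
  range-prime a b = after-prime a (b ∸ a)

-- Counting prime factors with multiplicity

module PrimeFactors where

  open import Defs
  open import Data.Nat
  open import Data.Nat.Properties
  open import Data.Nat.Divisibility
  open import Data.Nat.Primality
  open import Data.Nat.Logarithm
  open import Data.Nat.ListAction using (product; sum)
  open import Data.Nat.ListAction.Properties using (product-++; sum-++)
  open import Data.Nat.Tactic.RingSolver using (solve-∀)
  open import Relation.Binary.PropositionalEquality
  open import Relation.Nullary using (¬_; Dec; yes; no; contradiction)
  open import Relation.Nullary.Decidable using (_×-dec_)
  open import Data.Product using (_×_; _,_; ∃)
  open import Data.Sum using (inj₁; inj₂)
  open import Data.List using (List; []; _∷_; map; _++_; length; filter; upTo; take; drop; _∷ʳ_)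
  open import Data.List.Properties using (length-++; upTo-∷ʳ; filter-++; map-++; length-take; length-drop; take++drop≡id)
  open import Data.List.Relation.Unary.All as All using (All; []; _∷_)
  import Data.List.Relation.Unary.All.Properties as Allₚ
  open ≤-Reasoning

  S : ℕ → (ℕ → ℕ) → ℕ
  S zero f = 0
  S (suc n) f = S n f + f n

  bit : {P : Set} → Dec P → ℕ
  bit (yes _) = 1
  bit (no _) = 0

  sum-upTo : ∀ f n → sum (map f (upTo n)) ≡ S n f
  sum-upTo f zero = refl
  sum-upTo f (suc n) = begin-equality
    sum (map f (upTo (suc n))) ≡⟨ cong (λ l → sum (map f l)) (sym (upTo-∷ʳ n)) ⟩
    sum (map f (upTo n ∷ʳ n)) ≡⟨ cong sum (map-++ f (upTo n) (n ∷ [])) ⟩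
    sum (map f (upTo n) ++ f n ∷ []) ≡⟨ sum-++ (map f (upTo n)) (f n ∷ []) ⟩
    sum (map f (upTo n)) + (f n + 0) ≡⟨ cong₂ _+_ (sum-upTo f n) (+-identityʳ (f n)) ⟩
    S n f + f n ∎

  length-filter-upTo : {P : ℕ → Set} (P? : ∀ n → Dec (P n)) → ∀ n → length (filter P? (upTo n)) ≡ S n (λ i → bit (P? i))
  length-filter-upTo P? zero = refl
  length-filter-upTo P? (suc n) = begin-equality
    length (filter P? (upTo (suc n))) ≡⟨ cong (λ l → length (filter P? l)) (sym (upTo-∷ʳ n)) ⟩
    length (filter P? (upTo n ∷ʳ n)) ≡⟨ cong length (filter-++ P? (upTo n) (n ∷ [])) ⟩
    length (filter P? (upTo n) ++ filter P? (n ∷ [])) ≡⟨ length-++ (filter P? (upTo n)) ⟩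
    length (filter P? (upTo n)) + length (filter P? (n ∷ [])) ≡⟨ cong₂ _+_ (length-filter-upTo P? n) (single n) ⟩
    S n (λ i → bit (P? i)) + bit (P? n) ∎
    where
    single : ∀ n → length (filter P? (n ∷ [])) ≡ bit (P? n)
    single n with P? n
    ... | yes _ = refl
    ... | no _ = refl

  S-mono : ∀ n {f g} → (∀ i → f i ≤ g i) → S n f ≤ S n g
  S-mono zero h = z≤n
  S-mono (suc n) h = +-mono-≤ (S-mono n h) (h n)

  S-head : ∀ n f → 0 < n → f 0 ≤ S n f
  S-head (suc zero) f _ = ≤-refl
  S-head (suc (suc n)) f _ = ≤-trans (S-head (suc n) f (s≤s z≤n)) (m≤m+n _ _)

  S-cong : ∀ n {f g} → (∀ i → f i ≡ g i) → S n f ≡ S n g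
  S-cong zero h = refl
  S-cong (suc n) h = cong₂ _+_ (S-cong n h) (h n)

  ω≡ : ∀ m → ω m ≡ S (suc m) (λ p → bit (prime? p ×-dec (p ∣? m)))
  ω≡ m = length-filter-upTo (λ p → prime? p ×-dec (p ∣? m)) (suc m)

  Ω≡ : ∀ m → Ω m ≡ S (suc m) (λ p → S m (λ j → bit (prime? p ×-dec ((p ^ suc j) ∣? m))))
  Ω≡ m = trans (sum-upTo _ (suc m)) (S-cong (suc m) (λ p → length-filter-upTo (λ j → prime? p ×-dec ((p ^ suc j) ∣? m)) m))

  bit-mono : {P Q : Set} (P? : Dec P) (Q? : Dec Q) → (P → Q) → bit P? ≤ bit Q?
  bit-mono (yes p) (yes q) h = ≤-refl
  bit-mono (yes p) (no ¬q) h = contradiction (h p) ¬q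
  bit-mono (no _) _ h = z≤n

  ω≤Ω : ∀ m → 0 < m → ω m ≤ Ω m
  ω≤Ω m m>0 = begin
    ω m ≡⟨ ω≡ m ⟩
    S (suc m) (λ p → bit (prime? p ×-dec (p ∣? m))) ≤⟨ S-mono (suc m) (λ p → ≤-trans
       (bit-mono (prime? p ×-dec (p ∣? m)) (prime? p ×-dec ((p ^ 1) ∣? m)) (λ (a , b) → a , subst (_∣ m) (sym (*-identityʳ p)) b))
       (S-head m (λ j → bit (prime? p ×-dec ((p ^ suc j) ∣? m))) m>0)) ⟩
    S (suc m) (λ p → S m (λ j → bit (prime? p ×-dec ((p ^ suc j) ∣? m)))) ≡⟨ sym (Ω≡ m) ⟩
    Ω m ∎

  occ : ℕ → List ℕ → ℕ
  occ p [] = 0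
  occ p (f ∷ fs) = bit (f ≟ p) + occ p fs

  prime-power-cancel : ∀ {p f} k P → Prime p → ¬ p ∣ f → p ^ k ∣ f * P → p ^ k ∣ P
  prime-power-cancel zero P pr nd h = 1∣ P
  prime-power-cancel {p} {f} (suc k) P pr nd h with euclidsLemma f P pr (∣-trans (m∣m*n (p ^ k)) h)
  ... | inj₁ x = contradiction x nd
  ... | inj₂ (divides P′ refl) = subst (p ^ suc k ∣_) (*-comm p P′) (*-monoʳ-∣ p (prime-power-cancel k P′ pr nd
        (*-cancelˡ-∣ p {{prime⇒nonZero pr}} (subst (p ^ suc k ∣_) (l f P′ p) h))))
    where
    l : ∀ f P p → f * (P * p) ≡ p * (f * P)
    l = solve-∀

  power∣⇒≤occ : ∀ {p} fs k → Prime p → All Prime fs → p ^ k ∣ product fs → k ≤ occ p fs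
  power∣⇒≤occ {p} [] zero pr [] h = z≤n
  power∣⇒≤occ {p} [] (suc k) pr [] h with m*n≡1⇒m≡1 p (p ^ k) (∣1⇒≡1 h)
  ... | refl = contradiction pr ¬prime[1]
  power∣⇒≤occ {p} (f ∷ fs) k pr (q ∷ qs) h with f ≟ p
  power∣⇒≤occ {p} (f ∷ fs) zero pr (q ∷ qs) h | yes refl = z≤n
  power∣⇒≤occ {p} (f ∷ fs) (suc k) pr (q ∷ qs) h | yes refl = s≤s (power∣⇒≤occ fs k pr qs (*-cancelˡ-∣ p {{prime⇒nonZero pr}} h))
  power∣⇒≤occ {p} (f ∷ fs) k pr (q ∷ qs) h | no f≢p = power∣⇒≤occ fs k pr qs (prime-power-cancel k (product fs) pr p∤f h)
    where
    p∤f : ¬ p ∣ f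
    p∤f d with prime⇒irreducible q d
    ... | inj₁ refl = ¬prime[1] pr
    ... | inj₂ e = f≢p (sym e)

  S-bit≤ : {P : ℕ → Set} (P? : ∀ n → Dec (P n)) → ∀ n → S n (λ i → bit (P? i)) ≤ n
  S-bit≤ P? zero = z≤n
  S-bit≤ P? (suc n) = ≤-trans (+-mono-≤ (S-bit≤ P? n) (b (P? n))) (≤-reflexive (+-comm n 1))
    where
    b : {Q : Set} (d : Dec Q) → bit d ≤ 1
    b (yes _) = ≤-refl
    b (no _) = z≤n

  S-bit-bounded : {P : ℕ → Set} (P? : ∀ n → Dec (P n)) (c : ℕ) → (∀ j → P j → j < c) → ∀ n → S n (λ i → bit (P? i)) ≤ c
  S-bit-bounded P? c h zero = z≤n
  S-bit-bounded P? c h (suc n) with P? n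
  ... | yes Pn = ≤-trans (≤-trans (≤-reflexive (+-comm _ 1)) (s≤s (S-bit≤ P? n))) (h n Pn)
  ... | no _ = ≤-trans (≤-reflexive (+-identityʳ _)) (S-bit-bounded P? c h n)

  S-+ : ∀ n f g → S n (λ i → f i + g i) ≡ S n f + S n g
  S-+ zero f g = refl
  S-+ (suc n) f g = trans (cong (_+ (f n + g n)) (S-+ n f g)) (l (S n f) (S n g) (f n) (g n))
    where
    l : ∀ a b c d → a + b + (c + d) ≡ a + c + (b + d)
    l = solve-∀

  S-zero : ∀ n {f} → (∀ i → i < n → f i ≡ 0) → S n f ≡ 0
  S-zero zero h = refl
  S-zero (suc n) h = cong₂ _+_ (S-zero n (λ i l → h i (m<n⇒m<1+n l))) (h n ≤-refl)

  S-single : ∀ n f → S n (λ p → bit (f ≟ p)) ≤ 1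
  S-single zero f = z≤n
  S-single (suc n) f with f ≟ n
  ... | yes refl = ≤-reflexive (cong (_+ 1) (S-zero n (λ i l → z i l)))
    where
    z : ∀ i → i < n → bit (n ≟ i) ≡ 0
    z i l with n ≟ i
    ... | yes refl = contradiction l (<-irrefl refl)
    ... | no _ = refl
  ... | no _ = ≤-trans (≤-reflexive (+-identityʳ _)) (S-single n f)

  S-occ : ∀ n fs → S n (λ p → occ p fs) ≤ length fs
  S-occ n [] = ≤-reflexive (S-zero n (λ _ _ → refl))
  S-occ n (f ∷ fs) = ≤-trans (≤-reflexive (S-+ n (λ p → bit (f ≟ p)) (λ p → occ p fs))) (+-mono-≤ (S-single n f) (S-occ n fs))

  -- For fixed `p` an exponent `suc j` is counted only if it is at most the number of times `p`
  -- occurs in `fs`, and these occurrence numbers add up to at most the length.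
  Ω≤length : ∀ {fs} → All Prime fs → Ω (product fs) ≤ length fs
  Ω≤length {fs} prs = begin
    Ω m ≡⟨ Ω≡ m ⟩
    S (suc m) (λ p → S m (λ j → bit (prime? p ×-dec ((p ^ suc j) ∣? m)))) ≤⟨ S-mono (suc m) (λ p → S-bit-bounded (λ j → prime? p ×-dec ((p ^ suc j) ∣? m)) (occ p fs) (λ j (pr , d) → power∣⇒≤occ fs (suc j) pr prs d) m) ⟩
    S (suc m) (λ p → occ p fs) ≤⟨ S-occ (suc m) fs ⟩
    length fs ∎
    where m = product fs

  2^length≤ : ∀ {fs} → All Prime fs → 2 ^ length fs ≤ product fs
  2^length≤ [] = ≤-refl
  2^length≤ (p ∷ ps) = *-mono-≤ (nonTrivial⇒n>1 _ {{prime⇒nonTrivial p}}) (2^length≤ ps)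

  length≤log : ∀ {fs m} → All Prime fs → product fs ≤ m → length fs ≤ ⌊log₂ m ⌋
  length≤log {fs} prs h = ≤-trans (≤-reflexive (sym (⌊log₂[2^n]⌋≡n (length fs)))) (⌊log₂⌋-mono-≤ (≤-trans (2^length≤ prs) h))

  n<2^log : ∀ k → k < 2 ^ suc ⌊log₂ k ⌋
  n<2^log k with 2 ^ suc ⌊log₂ k ⌋ ≤? k
  ... | no h = ≰⇒> h
  ... | yes h = contradiction (≤-trans (≤-reflexive (sym (⌊log₂[2^n]⌋≡n (suc ⌊log₂ k ⌋)))) (⌊log₂⌋-mono-≤ h)) (<⇒≱ (n<1+n _))

  -- Cut `s` consecutive blocks of length `t` from `fs`. If each had product above `D`, the whole
  -- product would exceed `D ^ s`; so the first block that stays within `D` can be returned.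
  small-divisor : ∀ {P : ℕ → Set} D t s fs → All P fs → 0 < product fs → s * t ≤ length fs → product fs < D ^ s →
    ∃ λ es → (length es ≡ t) × All P es × (product es ∣ product fs) × (product es ≤ D)
  small-divisor D t zero fs a pos len h = contradiction pos (<⇒≱ h)
  small-divisor {P} D t (suc s) fs a pos len h with product (take t fs) ≤? D
  ... | yes le = take t fs , trans (length-take t fs) (m≤n⇒m⊓n≡m (≤-trans (m≤m+n t (s * t)) len)) , Allₚ.take⁺ t a ,
       divides (product (drop t fs)) (trans eq (*-comm (product (take t fs)) _)) , le
    where
    eq : product fs ≡ product (take t fs) * product (drop t fs)
    eq = trans (cong product (sym (take++drop≡id t fs))) (product-++ (take t fs) (drop t fs))
  ... | no gt with small-divisor {P} D t s (drop t fs) (Allₚ.drop⁺ t a) dpos dlen dlt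
    where
    eq : product fs ≡ product (take t fs) * product (drop t fs)
    eq = trans (cong product (sym (take++drop≡id t fs))) (product-++ (take t fs) (drop t fs))
    dpos : 0 < product (drop t fs)
    dpos = n≢0⇒n>0 (λ e → <⇒≱ pos (≤-reflexive (trans eq (trans (cong (product (take t fs) *_) e) (*-zeroʳ (product (take t fs)))))))
    dlen : s * t ≤ length (drop t fs)
    dlen = ≤-trans (≤-trans (≤-reflexive (sym (m+n∸m≡n t (s * t)))) (∸-monoˡ-≤ t len)) (≤-reflexive (sym (length-drop t fs)))
    dlt : product (drop t fs) < D ^ s
    dlt = *-cancelˡ-< D _ _ (≤-<-trans (*-monoˡ-≤ (product (drop t fs)) (<⇒≤ (≰⇒> gt))) (subst (_< D ^ suc s) eq h))
  ... | es , l , al , d , le = es , l , al , ∣-trans d (subst (product (drop t fs) ∣_) (trans (sym (product-++ (take t fs) (drop t fs))) (cong product (take++drop≡id t fs))) (n∣m*n (product (take t fs)))) , le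

-- The sieve and its application

module Sieve where

  open import Data.Empty using (⊥; ⊥-elim)
  import Data.Integer as ℤ
  import Data.Integer.Properties as ℤₚ
  open import Data.List using (List; []; _∷_; map; _++_; length; filter)
  open import Data.List.Membership.Propositional using (_∈_)
  open import Data.List.Membership.Propositional.Properties using (∈-∃++; ∈-++⁺ˡ; ∈-++⁺ʳ; ∈-++⁻)
  open import Data.List.Properties using (filter-++; filter-all; length-++; length-filter; length-map; map-++)
  open import Data.List.Relation.Unary.All as All using (All; []; _∷_)
  import Data.List.Relation.Unary.All.Properties as Allₚ
  open import Data.List.Relation.Unary.AllPairs as AllPairs using (AllPairs; []; _∷_)
  import Data.List.Relation.Unary.AllPairs.Properties as APₚ
  open import Data.List.Relation.Unary.Any using (here; there)
  open import Data.Nat as ℕ using (ℕ; zero; suc; _!; _∸_)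
  open import Data.List.Membership.DecPropositional ℕ._≟_ using (_∈?_)
  open import Data.Nat.Coprimality using (Coprime; coprime?; coprime-/gcd; coprime-divisor; coprime-Bézout)
  open import Data.Nat.DivMod using (_%_; _/_; m≡m%n+[m/n]*n; m%n<n; m/n*n≡m)
  open import Data.Nat.Divisibility
  open import Data.Nat.GCD using (gcd; gcd[m,n]∣m; gcd[m,n]∣n; gcd[m,n]≡0⇒n≡0; module Bézout)
  open import Data.Nat.ListAction using (product)
  open import Data.Nat.ListAction.Properties using (product-++; ∈⇒∣product)
  open import Data.Nat.Logarithm
  open import Data.Nat.Primality
  open import Data.Nat.Primality.Factorisation using (PrimeFactorisation; factorise)
  import Data.Nat.Properties as ℕₚ
  open import Data.Nat.Tactic.RingSolver using (solve-∀)
  open import Data.Product using (_×_; _,_; proj₁; proj₂; ∃)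
  open import Data.Rational hiding (_/_; NonZero; truncate)
  import Data.Rational as ℚ
  open import Data.Rational.Properties
  open import Data.Rational.Solver using (module +-*-Solver)
  import Data.Rational.Unnormalised as ℚᵘ
  import Data.Rational.Unnormalised.Properties as ℚᵘₚ
  open import Data.Sum using (_⊎_; inj₁; inj₂; [_,_]′)
  open import Function using (_∘_)
  open import Relation.Binary.PropositionalEquality hiding ([_]; J)
  open import Relation.Nullary using (¬_; Dec; yes; no; contradiction)
  open +-*-Solver using (solve; _:+_; _:*_; _:-_; :-_; _:=_; con)
  open PrimeFactorisation using (factors; isFactorisation; factorsPrime)
  open ≤-Reasoning
  open Chebyshev
  open import Defs using (Ω)
  open PrimeFactors using (Ω≤length; length≤log; n<2^log; small-divisor)

  abstract
    ι : ℕ → ℚ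
    ι n = ℤ.+ n ℚ./ 1

    toℚᵘ-ι : ∀ n → toℚᵘ (ι n) ℚᵘ.≃ ℚᵘ.mkℚᵘ (ℤ.+ n) 0
    toℚᵘ-ι n = toℚᵘ-fromℚᵘ (ℚᵘ.mkℚᵘ (ℤ.+ n) 0)

    ι0 : ι 0 ≡ 0ℚ
    ι0 = refl

    ι1 : ι 1 ≡ 1ℚ
    ι1 = refl

    ι-+ : ∀ m n → ι (m ℕ.+ n) ≡ ι m + ι n
    ι-+ m n = toℚᵘ-injective (ℚᵘₚ.≃-trans (toℚᵘ-ι (m ℕ.+ n)) (ℚᵘₚ.≃-trans lem
        (ℚᵘₚ.≃-trans (ℚᵘₚ.+-cong (ℚᵘₚ.≃-sym (toℚᵘ-ι m)) (ℚᵘₚ.≃-sym (toℚᵘ-ι n))) (ℚᵘₚ.≃-sym (toℚᵘ-homo-+ (ι m) (ι n))))))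
      where
      lem : ℚᵘ.mkℚᵘ (ℤ.+ (m ℕ.+ n)) 0 ℚᵘ.≃ (ℚᵘ.mkℚᵘ (ℤ.+ m) 0 ℚᵘ.+ ℚᵘ.mkℚᵘ (ℤ.+ n) 0)
      lem = ℚᵘ.*≡* (cong (ℤ._* ℤ.+ 1) (sym (cong₂ ℤ._+_ (ℤₚ.*-identityʳ (ℤ.+ m)) (ℤₚ.*-identityʳ (ℤ.+ n)))))

    ι-* : ∀ m n → ι (m ℕ.* n) ≡ ι m * ι n
    ι-* m n = toℚᵘ-injective (ℚᵘₚ.≃-trans (toℚᵘ-ι (m ℕ.* n)) (ℚᵘₚ.≃-trans lem
        (ℚᵘₚ.≃-trans (ℚᵘₚ.*-cong (ℚᵘₚ.≃-sym (toℚᵘ-ι m)) (ℚᵘₚ.≃-sym (toℚᵘ-ι n))) (ℚᵘₚ.≃-sym (toℚᵘ-homo-* (ι m) (ι n))))))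
      where
      lem : ℚᵘ.mkℚᵘ (ℤ.+ (m ℕ.* n)) 0 ℚᵘ.≃ (ℚᵘ.mkℚᵘ (ℤ.+ m) 0 ℚᵘ.* ℚᵘ.mkℚᵘ (ℤ.+ n) 0)
      lem = ℚᵘ.*≡* (cong (ℤ._* ℤ.+ 1) (ℤₚ.pos-* m n))

    ι-mono : ∀ {m n} → m ℕ.≤ n → ι m ≤ ι n
    ι-mono {m} {n} m≤n = toℚᵘ-cancel-≤ (ℚᵘₚ.≤-respˡ-≃ (ℚᵘₚ.≃-sym (toℚᵘ-ι m)) (ℚᵘₚ.≤-respʳ-≃ (ℚᵘₚ.≃-sym (toℚᵘ-ι n))
        (ℚᵘ.*≤* (ℤₚ.*-monoʳ-≤-nonNeg (ℤ.+ 1) (ℤ.+≤+ m≤n)))))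

    -- The default `inv 0 = 0` keeps `inv-nonneg` and `inv≤1` free of side conditions.
    inv : ℕ → ℚ
    inv zero = 0ℚ
    inv (suc n) = ℤ.+ 1 ℚ./ suc n

    inv-nonneg : ∀ n → 0ℚ ≤ inv n
    inv-nonneg zero = ≤-refl
    inv-nonneg (suc n) = nonNegative⁻¹ _ {{normalize-nonNeg 1 (suc n)}}

    ι*inv-suc : ∀ n → ι (suc n) * inv (suc n) ≡ 1ℚ
    ι*inv-suc n = toℚᵘ-injective (ℚᵘₚ.≃-trans (toℚᵘ-homo-* (ι (suc n)) (inv (suc n)))
       (ℚᵘₚ.≃-trans (ℚᵘₚ.*-cong (toℚᵘ-ι (suc n)) (toℚᵘ-fromℚᵘ (ℚᵘ.mkℚᵘ (ℤ.+ 1) n)))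
         (ℚᵘ.*≡* (trans (ℤₚ.*-identityʳ _) (trans (ℤₚ.*-identityʳ _) (sym (trans (ℤₚ.*-identityˡ _) (cong (λ w → ℤ.+ suc w) (ℕₚ.+-identityʳ n)))))))))

  ι*inv : ∀ {n} → 0 ℕ.< n → ι n * inv n ≡ 1ℚ
  ι*inv {suc n} _ = ι*inv-suc n

  ι≥0 : ∀ n → 0ℚ ≤ ι n
  ι≥0 n = subst (_≤ ι n) ι0 (ι-mono ℕ.z≤n)

  0≤1 : 0ℚ ≤ 1ℚ
  0≤1 = nonNegative⁻¹ 1ℚ

  *-≥0 : ∀ {a b} → 0ℚ ≤ a → 0ℚ ≤ b → 0ℚ ≤ a * b
  *-≥0 {a} {b} p q = subst (_≤ a * b) (*-zeroʳ a) (*-monoˡ-≤-nonNeg a {{nonNegative p}} q)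

  +-≥0 : ∀ {a b} → 0ℚ ≤ a → 0ℚ ≤ b → 0ℚ ≤ a + b
  +-≥0 p q = +-mono-≤ p q

  *ˡ : ∀ {a b c} → 0ℚ ≤ c → a ≤ b → c * a ≤ c * b
  *ˡ {c = c} p q = *-monoˡ-≤-nonNeg c {{nonNegative p}} q

  *ʳ : ∀ {a b c} → 0ℚ ≤ c → a ≤ b → a * c ≤ b * c
  *ʳ {c = c} p q = *-monoʳ-≤-nonNeg c {{nonNegative p}} q

  *-mono : ∀ {a b c d} → 0ℚ ≤ a → 0ℚ ≤ d → a ≤ b → c ≤ d → a * c ≤ b * d
  *-mono p q r s = ≤-trans (*ˡ p s) (*ʳ q r)

  sub≥0 : ∀ {a b} → a ≤ b → 0ℚ ≤ b - a
  sub≥0 {a} {b} p = subst (_≤ b - a) (+-inverseʳ a) (+-monoˡ-≤ (- a) p)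

  from-sub≥0 : ∀ {a b} → 0ℚ ≤ b - a → a ≤ b
  from-sub≥0 {a} {b} p = subst₂ _≤_ (+-identityˡ a)
     (solve 2 (λ a b → b :- a :+ a := b) refl a b) (+-monoˡ-≤ a p)

  -mono : ∀ {a b c d} → a ≤ b → c ≤ d → a - d ≤ b - c
  -mono p q = +-mono-≤ p (neg-antimono-≤ q)


  inv≤1 : ∀ n → inv n ≤ 1ℚ
  inv≤1 zero = ≤-trans (≤-reflexive inv0) 0≤1 
    where abstract
      inv0 : inv 0 ≡ 0ℚ
      inv0 = refl
  inv≤1 (suc n) = begin
    inv (suc n) ≡⟨ sym (*-identityˡ _) ⟩
    1ℚ * inv (suc n) ≤⟨ *ʳ (inv-nonneg _) (subst (_≤ ι (suc n)) ι1 (ι-mono (ℕ.s≤s ℕ.z≤n))) ⟩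
    ι (suc n) * inv (suc n) ≡⟨ ι*inv-suc n ⟩
    1ℚ ∎

  cancelˡ : ∀ {a b} n → 0 ℕ.< n → ι n * a ≤ ι n * b → a ≤ b
  cancelˡ {a} {b} n n>0 p = begin
    a ≡⟨ eq a ⟩
    inv n * (ι n * a) ≤⟨ *ˡ (inv-nonneg n) p ⟩
    inv n * (ι n * b) ≡⟨ sym (eq b) ⟩
    b ∎
    where
    eq : ∀ a → a ≡ inv n * (ι n * a)
    eq a = trans (sym (*-identityˡ a)) (trans (cong (_* a) (sym (ι*inv n>0))) (solve 3 (λ i j a → (i :* j) :* a := j :* (i :* a)) refl (ι n) (inv n) a))

  -- Bonferroni inequalities and Rankin's bound

  poly : ℚ → ℚ → ℕ → List ℚ → ℚ
  poly s c zero xs = 1ℚ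
  poly s c (suc T) [] = c
  poly s c (suc T) (x ∷ xs) = poly s c (suc T) xs + (s * x) * poly s c T xs

  -- `alt T` is the sum of `(-1)^i e_i` over `i ≤ T`, and `esym T` is the elementary symmetric
  -- polynomial `e_T`. As instances of one recursion they share a single equidistribution proof,
  -- `equi-poly`.
  alt : ℕ → List ℚ → ℚ
  alt = poly (- 1ℚ) 1ℚ

  esym : ℕ → List ℚ → ℚ
  esym = poly 1ℚ 0ℚ

  ∏1- : List ℚ → ℚ
  ∏1- [] = 1ℚ
  ∏1- (x ∷ xs) = (1ℚ - x) * ∏1- xs

  Unit : ℚ → Set
  Unit x = (0ℚ ≤ x) × (x ≤ 1ℚ)

  esym≥0 : ∀ T {xs} → All (0ℚ ≤_) xs → 0ℚ ≤ esym T xs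
  esym≥0 zero _ = 0≤1
  esym≥0 (suc T) [] = ≤-refl
  esym≥0 (suc T) (p ∷ ps) = +-≥0 (esym≥0 (suc T) ps) (*-≥0 (*-≥0 0≤1 p) (esym≥0 T ps))

  1-≥0 : ∀ {x} → x ≤ 1ℚ → 0ℚ ≤ 1ℚ - x
  1-≥0 = sub≥0

  1-≤1 : ∀ {x} → 0ℚ ≤ x → 1ℚ - x ≤ 1ℚ
  1-≤1 {x} p = ≤-trans (-mono (≤-refl {1ℚ}) p) (≤-reflexive (+-identityʳ 1ℚ))

  ∏1-≥0 : ∀ {xs} → All (_≤ 1ℚ) xs → 0ℚ ≤ ∏1- xs
  ∏1-≥0 [] = 0≤1
  ∏1-≥0 (p ∷ ps) = *-≥0 (1-≥0 p) (∏1-≥0 ps)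

  ∏1-≤1 : ∀ {xs} → All Unit xs → ∏1- xs ≤ 1ℚ
  ∏1-≤1 [] = ≤-refl
  ∏1-≤1 {x ∷ xs} ((p , q) ∷ ps) = begin
    (1ℚ - x) * ∏1- xs ≤⟨ *-mono (1-≥0 q) 0≤1 (1-≤1 p) (∏1-≤1 ps) ⟩
    1ℚ * 1ℚ ≡⟨ *-identityˡ 1ℚ ⟩
    1ℚ ∎

  double : ℕ → ℕ
  double zero = zero
  double (suc n) = suc (suc (double n))

  -- Adding `x` subtracts `x` times the sum truncated one order earlier, so the bounds of either
  -- parity follow from those of the other. Values anywhere in `[0, 1]` are allowed, which covers
  -- both indicators of events and densities.
  bonferroni-even : ∀ T {xs} → All Unit xs →
    (∏1- xs ≤ alt (double T) xs) × (alt (double T) xs ≤ ∏1- xs + esym (double T) xs)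
  bonferroni-odd : ∀ T {xs} → All Unit xs →
    (∏1- xs - esym (suc (double T)) xs ≤ alt (suc (double T)) xs) × (alt (suc (double T)) xs ≤ ∏1- xs)
  bonferroni-even zero {xs} us = ∏1-≤1 us , (begin
    1ℚ ≡⟨ sym (+-identityˡ 1ℚ) ⟩
    0ℚ + 1ℚ ≤⟨ +-monoˡ-≤ 1ℚ (∏1-≥0 (All.map proj₂ us)) ⟩
    ∏1- xs + 1ℚ ∎)
  bonferroni-even (suc T) {[]} [] = ≤-refl , ≤-reflexive (sym (+-identityʳ 1ℚ))
  bonferroni-even (suc T) {x ∷ xs} ((p , q) ∷ us)
    with bonferroni-even (suc T) us | bonferroni-odd T us
  ... | l , h | l′ , h′ = (begin
      (1ℚ - x) * ∏1- xs ≡⟨ solve 2 (λ x v → (con 1ℚ :- x) :* v := v :- x :* v) refl x (∏1- xs) ⟩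
      ∏1- xs - x * ∏1- xs ≤⟨ -mono l (*ˡ p h′) ⟩
      a₂ - x * a₁ ≡⟨ eq ⟩
      a₂ + ((- 1ℚ) * x) * a₁ ∎) , (begin
      a₂ + ((- 1ℚ) * x) * a₁ ≡⟨ sym eq ⟩
      a₂ - x * a₁ ≤⟨ -mono h (*ˡ p l′) ⟩
      (∏1- xs + e₂) - x * (∏1- xs - e₁) ≡⟨ solve 4 (λ x v e f → (v :+ e) :- x :* (v :- f) := (con 1ℚ :- x) :* v :+ (e :+ (con 1ℚ :* x) :* f)) refl x (∏1- xs) e₂ e₁ ⟩
      (1ℚ - x) * ∏1- xs + (e₂ + (1ℚ * x) * e₁) ∎)
    where
    a₂ = alt (suc (suc (double T))) xs
    a₁ = alt (suc (double T)) xs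
    e₂ = esym (suc (suc (double T))) xs
    e₁ = esym (suc (double T)) xs
    eq : a₂ - x * a₁ ≡ a₂ + ((- 1ℚ) * x) * a₁
    eq = solve 3 (λ x a b → a :- x :* b := a :+ ((:- con 1ℚ) :* x) :* b) refl x a₂ a₁
  bonferroni-odd T {[]} [] = ≤-refl , ≤-refl
  bonferroni-odd T {x ∷ xs} ((p , q) ∷ us)
    with bonferroni-odd T us | bonferroni-even T us
  ... | l , h | l′ , h′ = (begin
      (1ℚ - x) * ∏1- xs - (e₂ + (1ℚ * x) * e₁) ≡⟨ solve 4 (λ x v e f → (con 1ℚ :- x) :* v :- (e :+ (con 1ℚ :* x) :* f) := (v :- e) :- x :* (v :+ f)) refl x (∏1- xs) e₂ e₁ ⟩
      (∏1- xs - e₂) - x * (∏1- xs + e₁) ≤⟨ -mono l (*ˡ p h′) ⟩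
      a₂ - x * a₁ ≡⟨ eq ⟩
      a₂ + ((- 1ℚ) * x) * a₁ ∎) , (begin
      a₂ + ((- 1ℚ) * x) * a₁ ≡⟨ sym eq ⟩
      a₂ - x * a₁ ≤⟨ -mono h (*ˡ p l′) ⟩
      ∏1- xs - x * ∏1- xs ≡⟨ solve 2 (λ x v → v :- x :* v := (con 1ℚ :- x) :* v) refl x (∏1- xs) ⟩
      (1ℚ - x) * ∏1- xs ∎)
    where
    a₂ = alt (suc (double T)) xs
    a₁ = alt (double T) xs
    e₂ = esym (suc (double T)) xs
    e₁ = esym (double T) xs
    eq : a₂ - x * a₁ ≡ a₂ + ((- 1ℚ) * x) * a₁
    eq = solve 3 (λ x a b → a :- x :* b := a :+ ((:- con 1ℚ) :* x) :* b) refl x a₂ a₁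

  2ℚ : ℚ
  2ℚ = 1ℚ + 1ℚ

  ∏1+2 : List ℚ → ℚ
  ∏1+2 [] = 1ℚ
  ∏1+2 (x ∷ xs) = (1ℚ + 2ℚ * x) * ∏1+2 xs

  ≤+ˡ : ∀ {a b} → 0ℚ ≤ b → a ≤ a + b
  ≤+ˡ {a} {b} p = begin
    a ≡⟨ sym (+-identityʳ a) ⟩
    a + 0ℚ ≤⟨ +-monoʳ-≤ a p ⟩
    a + b ∎

  2≥0 : 0ℚ ≤ 2ℚ
  2≥0 = nonNegative⁻¹ 2ℚ

  ∏1+2≥1 : ∀ {xs} → All (0ℚ ≤_) xs → 1ℚ ≤ ∏1+2 xs
  ∏1+2≥1 [] = ≤-refl
  ∏1+2≥1 {x ∷ xs} (p ∷ ps) = begin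
    1ℚ ≡⟨⟩
    1ℚ * 1ℚ ≤⟨ *-mono 0≤1 (≤-trans 0≤1 (∏1+2≥1 ps)) (≤+ˡ (*-≥0 2≥0 p)) (∏1+2≥1 ps) ⟩
    (1ℚ + 2ℚ * x) * ∏1+2 xs ∎

  ι2 : ι 2 ≡ 2ℚ
  ι2 = trans (ι-+ 1 1) (cong₂ _+_ ι1 ι1)

  -- `2 ^ T * e_T` is one of the nonnegative terms in the expansion of the product of the `1 + 2 x`.
  esym-rankin : ∀ T {xs} → All (0ℚ ≤_) xs → ι (2 ℕ.^ T) * esym T xs ≤ ∏1+2 xs
  esym-rankin zero {xs} ps = begin
    ι 1 * 1ℚ ≡⟨ trans (*-identityʳ _) ι1 ⟩
    1ℚ ≤⟨ ∏1+2≥1 ps ⟩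
    ∏1+2 xs ∎
  esym-rankin (suc T) {[]} [] = ≤-trans (≤-reflexive (*-zeroʳ (ι (2 ℕ.^ suc T)))) 0≤1
  esym-rankin (suc T) {x ∷ xs} (p ∷ ps) = begin
    ι (2 ℕ.^ suc T) * (e₂ + (1ℚ * x) * e₁) ≡⟨ *-distribˡ-+ (ι (2 ℕ.^ suc T)) e₂ _ ⟩
    ι (2 ℕ.^ suc T) * e₂ + ι (2 ℕ.^ suc T) * ((1ℚ * x) * e₁) ≡⟨ cong (λ w → ι (2 ℕ.^ suc T) * e₂ + w * ((1ℚ * x) * e₁)) (trans (ι-* 2 (2 ℕ.^ T)) (cong (_* ι (2 ℕ.^ T)) ι2)) ⟩
    ι (2 ℕ.^ suc T) * e₂ + 2ℚ * ι (2 ℕ.^ T) * ((1ℚ * x) * e₁) ≡⟨ cong (ι (2 ℕ.^ suc T) * e₂ +_) (solve 4 (λ t i x e → t :* i :* ((con 1ℚ :* x) :* e) := t :* x :* (i :* e)) refl 2ℚ (ι (2 ℕ.^ T)) x e₁) ⟩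
    ι (2 ℕ.^ suc T) * e₂ + 2ℚ * x * (ι (2 ℕ.^ T) * e₁) ≤⟨ +-mono-≤ (esym-rankin (suc T) ps) (*ˡ (*-≥0 2≥0 p) (esym-rankin T ps)) ⟩
    ∏1+2 xs + 2ℚ * x * ∏1+2 xs ≡⟨ solve 3 (λ t x w → w :+ t :* x :* w := (con 1ℚ :+ t :* x) :* w) refl 2ℚ x (∏1+2 xs) ⟩
    (1ℚ + 2ℚ * x) * ∏1+2 xs ∎
    where
    e₂ = esym (suc T) xs
    e₁ = esym T xs

  -- Finite sums and sums along residue classes

  Σ< : ℕ → (ℕ → ℚ) → ℚ
  Σ< zero f = 0ℚ
  Σ< (suc n) f = Σ< n f + f n

  χ : ∀ {P : Set} → Dec P → ℚ
  χ (yes _) = 1ℚ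
  χ (no _) = 0ℚ

  Σ-cong : ∀ n {f g} → (∀ m → f m ≡ g m) → Σ< n f ≡ Σ< n g
  Σ-cong zero h = refl
  Σ-cong (suc n) h = cong₂ _+_ (Σ-cong n h) (h n)

  Σ-mono : ∀ n {f g} → (∀ m → m ℕ.< n → f m ≤ g m) → Σ< n f ≤ Σ< n g
  Σ-mono zero h = ≤-refl
  Σ-mono (suc n) h = +-mono-≤ (Σ-mono n (λ m l → h m (ℕₚ.m<n⇒m<1+n l))) (h n ℕₚ.≤-refl)

  Σ-+ : ∀ n f g → Σ< n (λ m → f m + g m) ≡ Σ< n f + Σ< n g
  Σ-+ zero f g = sym (+-identityˡ 0ℚ)
  Σ-+ (suc n) f g = trans (cong (_+ (f n + g n)) (Σ-+ n f g))
    (solve 4 (λ a b c d → a :+ b :+ (c :+ d) := a :+ c :+ (b :+ d)) refl (Σ< n f) (Σ< n g) (f n) (g n))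

  Σ-*ˡ : ∀ n c f → Σ< n (λ m → c * f m) ≡ c * Σ< n f
  Σ-*ˡ zero c f = sym (*-zeroʳ c)
  Σ-*ˡ (suc n) c f = trans (cong (_+ c * f n) (Σ-*ˡ n c f)) (sym (*-distribˡ-+ c _ _))

  -- The two inequalities say that `b + p * Y′` is the first member of the class that is not below
  -- `Y`; this is the invariant of the induction on `Y`.
  ap-sum : {P : ℕ → Set} (P? : ∀ m → Dec (P m)) (b p : ℕ) → b ℕ.< p →
    (∀ c → P (b ℕ.+ p ℕ.* c)) → (∀ m → P m → ∃ λ c → m ≡ b ℕ.+ p ℕ.* c) → (H : ℕ → ℚ) →
    ∀ Y → ∃ λ Y′ → (Σ< Y (λ m → χ (P? m) * H m) ≡ Σ< Y′ (λ c → H (b ℕ.+ p ℕ.* c))) ×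
      (b ℕ.+ p ℕ.* Y′ ℕ.< Y ℕ.+ p) × (Y ℕ.≤ b ℕ.+ p ℕ.* Y′)
  ap-sum P? b p b<p h₁ h₂ H zero = 0 , refl , subst (ℕ._< p) (sym (trans (cong (b ℕ.+_) (ℕₚ.*-zeroʳ p)) (ℕₚ.+-identityʳ b))) b<p , ℕ.z≤n
  ap-sum {P} P? b p b<p h₁ h₂ H (suc Y) with ap-sum P? b p b<p h₁ h₂ H Y | P? Y
  ... | Y′ , eq , lo , hi | yes PY = suc Y′ , cong₂ _+_ eq (trans (*-identityˡ (H Y)) (cong H Y≡)) , lo′ , hi′
    where
    c = proj₁ (h₂ Y PY)
    Y≡c : Y ≡ b ℕ.+ p ℕ.* c
    Y≡c = proj₂ (h₂ Y PY)
    instance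
      nz : ℕ.NonZero p
      nz = ℕ.>-nonZero (ℕₚ.≤-<-trans ℕ.z≤n b<p)
    c≤ : c ℕ.≤ Y′
    c≤ = ℕₚ.*-cancelˡ-≤ p (ℕₚ.+-cancelˡ-≤ b _ _ (subst (ℕ._≤ b ℕ.+ p ℕ.* Y′) Y≡c hi))
    step : b ℕ.+ p ℕ.* c ℕ.+ p ≡ b ℕ.+ p ℕ.* suc c
    step = lem b p c where
      lem : ∀ b p c → b ℕ.+ p ℕ.* c ℕ.+ p ≡ b ℕ.+ p ℕ.* suc c
      lem = solve-∀
    ≤c : Y′ ℕ.≤ c
    ≤c = ℕₚ.≤-pred (ℕₚ.*-cancelˡ-< p _ _ (ℕₚ.+-cancelˡ-< b _ _ (subst (b ℕ.+ p ℕ.* Y′ ℕ.<_) (trans (cong (ℕ._+ p) Y≡c) step) lo)))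
    Y≡ : Y ≡ b ℕ.+ p ℕ.* Y′
    Y≡ = trans Y≡c (cong (λ c → b ℕ.+ p ℕ.* c) (ℕₚ.≤-antisym c≤ ≤c))
    e₂ : b ℕ.+ p ℕ.* suc Y′ ≡ Y ℕ.+ p
    e₂ = trans (lem b p Y′) (cong (ℕ._+ p) (sym Y≡)) where
      lem : ∀ b p c → b ℕ.+ p ℕ.* suc c ≡ b ℕ.+ p ℕ.* c ℕ.+ p
      lem = solve-∀
    lo′ : b ℕ.+ p ℕ.* suc Y′ ℕ.< suc Y ℕ.+ p
    lo′ = ℕ.s≤s (ℕₚ.≤-reflexive e₂)
    hi′ : suc Y ℕ.≤ b ℕ.+ p ℕ.* suc Y′
    hi′ = subst (suc Y ℕ.≤_) (sym e₂) (subst (ℕ._≤ Y ℕ.+ p) (ℕₚ.+-comm Y 1) (ℕₚ.+-monoʳ-≤ Y (ℕₚ.≤-<-trans ℕ.z≤n b<p)))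
  ... | Y′ , eq , lo , hi | no ¬PY = Y′ , trans (cong₂ _+_ eq (*-zeroˡ (H Y))) (+-identityʳ _) , ℕₚ.m<n⇒m<1+n lo ,
      ℕₚ.≤∧≢⇒< hi (λ Y≡ → ¬PY (subst P (sym Y≡) (h₁ Y′)))

  lin-solve : ∀ c e d → 0 ℕ.< d → Coprime d c → ∃ λ b → (b ℕ.< d) × (d ∣ c ℕ.* b ℕ.+ e)
  lin-solve c e d@(suc d-1) _ cop = b₀ % d , m%n<n b₀ d , ∣m+n∣m⇒∣n (subst (d ∣_) eq d∣) (∣n⇒∣m*n c (∣n⇒∣m*n (b₀ / d) ∣-refl))
    where
    sol : ∃ λ b → d ∣ c ℕ.* b ℕ.+ e
    sol with coprime-Bézout cop
    ... | Bézout.+- x y eq = y ℕ.* e , divides (x ℕ.* e) (trans (l c y e) (trans (cong (ℕ._* e) eq) (r x d e)))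
      where
      l : ∀ c y e → c ℕ.* (y ℕ.* e) ℕ.+ e ≡ (1 ℕ.+ y ℕ.* c) ℕ.* e
      l = solve-∀
      r : ∀ x d e → x ℕ.* d ℕ.* e ≡ x ℕ.* e ℕ.* d
      r = solve-∀
    -- In this case `y * c` is 1 modulo `d` instead of -1; the factor `d - 1` supplies the missing
    -- sign.
    ... | Bézout.-+ x y eq = y ℕ.* e ℕ.* d-1 , divides (e ℕ.+ x ℕ.* e ℕ.* d-1)
        (trans (l c y e d-1) (trans (cong (λ w → w ℕ.* e ℕ.* d-1 ℕ.+ e) (sym eq)) (r x d-1 e)))
      where
      l : ∀ c y e d → c ℕ.* (y ℕ.* e ℕ.* d) ℕ.+ e ≡ y ℕ.* c ℕ.* e ℕ.* d ℕ.+ e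
      l = solve-∀
      r : ∀ x d e → (1 ℕ.+ x ℕ.* (1 ℕ.+ d)) ℕ.* e ℕ.* d ℕ.+ e ≡ (e ℕ.+ x ℕ.* e ℕ.* d) ℕ.* (1 ℕ.+ d)
      r = solve-∀
    b₀ = proj₁ sol
    d∣ = proj₂ sol
    eq : c ℕ.* b₀ ℕ.+ e ≡ c ℕ.* (b₀ / d ℕ.* d) ℕ.+ (c ℕ.* (b₀ % d) ℕ.+ e)
    eq = trans (cong (λ w → c ℕ.* w ℕ.+ e) (m≡m%n+[m/n]*n b₀ d)) (l c (b₀ % d) (b₀ / d ℕ.* d) e)
      where
      l : ∀ c a b e → c ℕ.* (a ℕ.+ b) ℕ.+ e ≡ c ℕ.* b ℕ.+ (c ℕ.* a ℕ.+ e)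
      l = solve-∀

  lin-shift : ∀ c e d b t → d ∣ c ℕ.* b ℕ.+ e → d ∣ c ℕ.* (b ℕ.+ d ℕ.* t) ℕ.+ e
  lin-shift c e d b t h = subst (d ∣_) (l c b d t e) (∣m∣n⇒∣m+n h (∣n⇒∣m*n (c ℕ.* t) ∣-refl))
    where
    l : ∀ c b d t e → c ℕ.* b ℕ.+ e ℕ.+ c ℕ.* t ℕ.* d ≡ c ℕ.* (b ℕ.+ d ℕ.* t) ℕ.+ e
    l = solve-∀

  lin-diff : ∀ c e d m t → Coprime d c → d ∣ c ℕ.* m ℕ.+ e → d ∣ c ℕ.* (m ℕ.+ t) ℕ.+ e → d ∣ t
  lin-diff c e d m t cop h₁ h₂ = coprime-divisor cop (∣m+n∣m⇒∣n (subst (d ∣_) (l c m t e) h₂) h₁)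
    where
    l : ∀ c m t e → c ℕ.* (m ℕ.+ t) ℕ.+ e ≡ c ℕ.* m ℕ.+ e ℕ.+ c ℕ.* t
    l = solve-∀

  lin-unique : ∀ c e d b m → Coprime d c → b ℕ.< d → d ∣ c ℕ.* b ℕ.+ e → d ∣ c ℕ.* m ℕ.+ e → ∃ λ t → m ≡ b ℕ.+ d ℕ.* t
  lin-unique c e d b m cop b<d hb hm with b ℕₚ.≤? m
  ... | yes b≤m = let (divides t eq) = lin-diff c e d b (m ∸ b) cop hb (subst (λ w → d ∣ c ℕ.* w ℕ.+ e) (sym (ℕₚ.m+[n∸m]≡n b≤m)) hm)
                  in t , trans (sym (ℕₚ.m+[n∸m]≡n b≤m)) (cong (b ℕ.+_) (trans eq (ℕₚ.*-comm t d)))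
  ... | no b≰m = ⊥-elim (ℕₚ.<⇒≱ b<d (ℕₚ.≤-trans (∣⇒≤ {{ℕ.>-nonZero (ℕₚ.m<n⇒0<n∸m m<b)}} d∣) (ℕₚ.m∸n≤m b m)))
    where
    m<b = ℕₚ.≰⇒> b≰m
    d∣ : d ∣ b ∸ m
    d∣ = lin-diff c e d m (b ∸ m) cop hm (subst (λ w → d ∣ c ℕ.* w ℕ.+ e) (sym (ℕₚ.m+[n∸m]≡n (ℕₚ.<⇒≤ m<b))) hb)

  prime∤⇒coprime : ∀ {p n} → Prime p → ¬ p ∣ n → Coprime p n
  prime∤⇒coprime pr p∤n {d} (d∣p , d∣n) with prime⇒irreducible pr d∣p
  ... | inj₁ d≡1 = d≡1
  ... | inj₂ refl = ⊥-elim (p∤n d∣n)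

  -- Equidistribution in arithmetic progressions

  ≤∣∣ : ∀ a → a ≤ ∣ a ∣
  ≤∣∣ a with ∣p∣≡p∨∣p∣≡-p a
  ... | inj₁ eq = ≤-reflexive (sym eq)
  ... | inj₂ eq = ≤-trans (subst (_≤ 0ℚ) (neg-inv a) (neg-antimono-≤ (subst (0ℚ ≤_) eq (0≤∣p∣ a)))) (0≤∣p∣ a)
    where
    neg-inv : ∀ a → - (- a) ≡ a
    neg-inv a = solve 1 (λ a → :- (:- a) := a) refl a

  -≤∣∣ : ∀ a → - a ≤ ∣ a ∣
  -≤∣∣ a = subst (- a ≤_) (∣-p∣≡∣p∣ a) (≤∣∣ (- a))

  ∣∣≤ : ∀ {a c} → a ≤ c → - a ≤ c → ∣ a ∣ ≤ c
  ∣∣≤ {a} p q with ∣p∣≡p∨∣p∣≡-p a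
  ... | inj₁ eq = ≤-trans (≤-reflexive eq) p
  ... | inj₂ eq = ≤-trans (≤-reflexive eq) q

  -- `μ` is the mean of `F` and `ε` an error that depends neither on the length nor on the
  -- progression. Allowing every modulus prime to `L` lets a further divisibility condition be
  -- imposed by passing to a subprogression; `main≤` pays for rounding the length of that
  -- subprogression.
  record Equi (L : List ℕ) (F : ℕ → ℚ) (μ ε : ℚ) : Set where
    field
      main≤ : ∣ μ ∣ ≤ ε
      dist  : ∀ a q Y → All (λ p → ¬ p ∣ q) L → ∣ Σ< Y (λ m → F (a ℕ.+ q ℕ.* m)) - μ * ι Y ∣ ≤ ε
  open Equi public

  equi-cong : ∀ {L F G μ ν ε δ} → (∀ n → F n ≡ G n) → μ ≡ ν → ε ≤ δ → Equi L F μ ε → Equi L G ν δ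
  equi-cong {μ = μ} h refl le e = record
    { main≤ = ≤-trans (main≤ e) le
    ; dist = λ a q Y al → ≤-trans (≤-reflexive (cong (λ w → ∣ w - μ * ι Y ∣) (Σ-cong Y (λ m → sym (h _))))) (≤-trans (dist e a q Y al) le) }

  equi-weaken : ∀ {L F μ ε} p → Equi L F μ ε → Equi (p ∷ L) F μ ε
  equi-weaken p e = record { main≤ = main≤ e ; dist = λ { a q Y (_ ∷ al) → dist e a q Y al } }

  equi-++ : ∀ {L F μ ε} L′ → Equi L F μ ε → Equi (L′ ++ L) F μ ε
  equi-++ [] e = e
  equi-++ (p ∷ L′) e = equi-weaken p (equi-++ L′ e)

  equi-+ : ∀ {L F G μ ν ε δ} → Equi L F μ ε → Equi L G ν δ → Equi L (λ n → F n + G n) (μ + ν) (ε + δ)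
  equi-+ {F = F} {G} {μ} {ν} {ε} {δ} e f = record
    { main≤ = ≤-trans (∣p+q∣≤∣p∣+∣q∣ μ ν) (+-mono-≤ (main≤ e) (main≤ f))
    ; dist = λ a q Y al → let S = Σ< Y (λ m → F (a ℕ.+ q ℕ.* m)); S′ = Σ< Y (λ m → G (a ℕ.+ q ℕ.* m)) in begin
        ∣ Σ< Y (λ m → F (a ℕ.+ q ℕ.* m) + G (a ℕ.+ q ℕ.* m)) - (μ + ν) * ι Y ∣ ≡⟨ cong (λ w → ∣ w - (μ + ν) * ι Y ∣) (Σ-+ Y _ _) ⟩
        ∣ (S + S′) - (μ + ν) * ι Y ∣ ≡⟨ cong ∣_∣ (solve 5 (λ s t m n y → (s :+ t) :- (m :+ n) :* y := (s :- m :* y) :+ (t :- n :* y)) refl S S′ μ ν (ι Y)) ⟩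
        ∣ (S - μ * ι Y) + (S′ - ν * ι Y) ∣ ≤⟨ ∣p+q∣≤∣p∣+∣q∣ (S - μ * ι Y) (S′ - ν * ι Y) ⟩
        ∣ S - μ * ι Y ∣ + ∣ S′ - ν * ι Y ∣ ≤⟨ +-mono-≤ (dist e a q Y al) (dist f a q Y al) ⟩
        ε + δ ∎ }

  equi-scale : ∀ {L F μ ε} s → ∣ s ∣ ≤ 1ℚ → Equi L F μ ε → Equi L (λ n → s * F n) (s * μ) ε
  equi-scale {F = F} {μ} {ε} s s≤ e = record
    { main≤ = sc (main≤ e)
    ; dist = λ a q Y al → let S = Σ< Y (λ m → F (a ℕ.+ q ℕ.* m)) in begin
        ∣ Σ< Y (λ m → s * F (a ℕ.+ q ℕ.* m)) - (s * μ) * ι Y ∣ ≡⟨ cong (λ w → ∣ w - (s * μ) * ι Y ∣) (Σ-*ˡ Y s _) ⟩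
        ∣ s * S - (s * μ) * ι Y ∣ ≡⟨ cong ∣_∣ (solve 4 (λ s t m y → s :* t :- (s :* m) :* y := s :* (t :- m :* y)) refl s S μ (ι Y)) ⟩
        ∣ s * (S - μ * ι Y) ∣ ≤⟨ sc (dist e a q Y al) ⟩
        ε ∎ }
    where
    sc : ∀ {x} → ∣ x ∣ ≤ ε → ∣ s * x ∣ ≤ ε
    sc {x} h = begin
      ∣ s * x ∣ ≡⟨ ∣p*q∣≡∣p∣*∣q∣ s x ⟩
      ∣ s ∣ * ∣ x ∣ ≤⟨ *-mono (0≤∣p∣ s) (≤-trans (0≤∣p∣ x) h) s≤ h ⟩
      1ℚ * ε ≡⟨ *-identityˡ ε ⟩
      ε ∎

  Σ-const1 : ∀ Y → Σ< Y (λ _ → 1ℚ) ≡ ι Y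
  Σ-const1 zero = sym ι0
  Σ-const1 (suc Y) = trans (cong₂ _+_ (Σ-const1 Y) (sym ι1)) (trans (sym (ι-+ Y 1)) (cong ι (ℕₚ.+-comm Y 1)))

  equi-one : Equi [] (λ _ → 1ℚ) 1ℚ (ι 1)
  equi-one = record { main≤ = ≤-reflexive (sym ι1) ; dist = λ a q Y _ → begin
    ∣ Σ< Y (λ _ → 1ℚ) - 1ℚ * ι Y ∣ ≡⟨ cong (λ w → ∣ w - 1ℚ * ι Y ∣) (Σ-const1 Y) ⟩
    ∣ ι Y - 1ℚ * ι Y ∣ ≡⟨ cong ∣_∣ (solve 1 (λ y → y :- con 1ℚ :* y := con 0ℚ) refl (ι Y)) ⟩
    0ℚ ≤⟨ ι≥0 1 ⟩
    ι 1 ∎ }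

  frac-bound : ∀ {p Y Y′} → 0 ℕ.< p → p ℕ.* Y′ ℕ.≤ Y ℕ.+ p → Y ℕ.≤ p ℕ.* Y′ ℕ.+ p → ∣ ι Y′ - inv p * ι Y ∣ ≤ 1ℚ
  frac-bound {p} {Y} {Y′} p>0 h₁ h₂ = ∣∣≤
     (cancelˡ p p>0 (begin
       ι p * (ι Y′ - inv p * ι Y) ≡⟨ e₁ ⟩
       ι (p ℕ.* Y′) - ι Y ≤⟨ +-monoˡ-≤ (- ι Y) (ι-mono h₁) ⟩
       ι (Y ℕ.+ p) - ι Y ≡⟨ cong (_- ι Y) (ι-+ Y p) ⟩
       (ι Y + ι p) - ι Y ≡⟨ solve 2 (λ y p → (y :+ p) :- y := p :* con 1ℚ) refl (ι Y) (ι p) ⟩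
       ι p * 1ℚ ∎))
     (cancelˡ p p>0 (begin
       ι p * (- (ι Y′ - inv p * ι Y)) ≡⟨ sym (neg-distribʳ-* (ι p) _) ⟩
       - (ι p * (ι Y′ - inv p * ι Y)) ≡⟨ cong -_ e₁ ⟩
       - (ι (p ℕ.* Y′) - ι Y) ≡⟨ solve 2 (λ a b → :- (a :- b) := b :- a) refl (ι (p ℕ.* Y′)) (ι Y) ⟩
       ι Y - ι (p ℕ.* Y′) ≤⟨ +-monoˡ-≤ (- ι (p ℕ.* Y′)) (ι-mono h₂) ⟩
       ι (p ℕ.* Y′ ℕ.+ p) - ι (p ℕ.* Y′) ≡⟨ cong (_- ι (p ℕ.* Y′)) (ι-+ (p ℕ.* Y′) p) ⟩
       (ι (p ℕ.* Y′) + ι p) - ι (p ℕ.* Y′) ≡⟨ solve 2 (λ y p → (y :+ p) :- y := p :* con 1ℚ) refl (ι (p ℕ.* Y′)) (ι p) ⟩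
       ι p * 1ℚ ∎))
    where
    e₁ : ι p * (ι Y′ - inv p * ι Y) ≡ ι (p ℕ.* Y′) - ι Y
    e₁ = begin-equality
       ι p * (ι Y′ - inv p * ι Y) ≡⟨ solve 4 (λ p y i z → p :* (y :- i :* z) := p :* y :- (p :* i) :* z) refl (ι p) (ι Y′) (inv p) (ι Y) ⟩
       ι p * ι Y′ - (ι p * inv p) * ι Y ≡⟨ cong₂ (λ a b → a - b * ι Y) (sym (ι-* p Y′)) (ι*inv p>0) ⟩
       ι (p ℕ.* Y′) - 1ℚ * ι Y ≡⟨ cong (λ w → ι (p ℕ.* Y′) - w) (*-identityˡ (ι Y)) ⟩
       ι (p ℕ.* Y′) - ι Y ∎

  -- Counts the shifts `1 ≤ k ≤ K` with `p ∣ M * n + k`. As a sum of indicators it is handled term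
  -- by term in `equi-ev`; for `p > K` it is also the indicator that some such shift exists.
  ev : ℕ → ℕ → ℕ → ℕ → ℚ
  ev M zero p n = 0ℚ
  ev M (suc K) p n = ev M K p n + χ (p ∣? M ℕ.* n ℕ.+ suc K)

  prime>0 : ∀ {p} → Prime p → 0 ℕ.< p
  prime>0 {p} pr = ℕ.>-nonZero⁻¹ p {{prime⇒nonZero pr}}

  prime∤prime : ∀ {p q} → Prime p → Prime q → p ≢ q → ¬ p ∣ q
  prime∤prime pp pq p≢q p∣q with prime⇒irreducible pq p∣q
  ... | inj₁ refl = ¬prime[1] pp
  ... | inj₂ p≡q = p≢q p≡q

  -- The condition selects one residue class modulo `p`, so `F` is summed along modulus `q * p`,
  -- which the primes of `L` still do not divide. One `ε` is the error there, the other pays for the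
  -- number of terms differing from `Y / p` by at most 1.
  equi-event : ∀ {L F μ ε} M k p → Prime p → ¬ p ∣ M → All Prime L → All (p ≢_) L → Equi L F μ ε →
    Equi (p ∷ L) (λ n → χ (p ∣? M ℕ.* n ℕ.+ k) * F n) (inv p * μ) (2ℚ * ε)
  equi-event {L} {F} {μ} {ε} M k p pr p∤M prL p∉L e = record { main≤ = mb ; dist = ds }
    where
    ε≥0 : 0ℚ ≤ ε
    ε≥0 = ≤-trans (0≤∣p∣ μ) (main≤ e)
    ε≤2ε : ε ≤ 2ℚ * ε
    ε≤2ε = ≤-trans (≤+ˡ ε≥0) (≤-reflexive (solve 1 (λ e → e :+ e := con 2ℚ :* e) refl ε))
    mb : ∣ inv p * μ ∣ ≤ 2ℚ * ε
    mb = begin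
      ∣ inv p * μ ∣ ≡⟨ ∣p*q∣≡∣p∣*∣q∣ (inv p) μ ⟩
      ∣ inv p ∣ * ∣ μ ∣ ≤⟨ *-mono (0≤∣p∣ _) ε≥0 (≤-trans (≤-reflexive (0≤p⇒∣p∣≡p (inv-nonneg p))) (inv≤1 p)) (main≤ e) ⟩
      1ℚ * ε ≡⟨ *-identityˡ ε ⟩
      ε ≤⟨ ε≤2ε ⟩
      2ℚ * ε ∎
    ds : ∀ a q Y → All (λ p → ¬ p ∣ q) (p ∷ L) →
         ∣ Σ< Y (λ m → χ (p ∣? M ℕ.* (a ℕ.+ q ℕ.* m) ℕ.+ k) * F (a ℕ.+ q ℕ.* m)) - inv p * μ * ι Y ∣ ≤ 2ℚ * ε
    ds a q Y (p∤q ∷ al) = begin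
        ∣ Σ< Y (λ m → χ (P? m) * F (a ℕ.+ q ℕ.* m)) - inv p * μ * ι Y ∣ ≡⟨ cong (λ w → ∣ w - inv p * μ * ι Y ∣) (trans (proj₁ (proj₂ aps)) (Σ-cong Y′ (λ c → cong F (l a q b p c)))) ⟩
        ∣ S - inv p * μ * ι Y ∣ ≡⟨ cong ∣_∣ (solve 5 (λ s i m y z → s :- i :* m :* y := (s :- m :* z) :+ m :* (z :- i :* y)) refl S (inv p) μ (ι Y) (ι Y′)) ⟩
        ∣ (S - μ * ι Y′) + μ * (ι Y′ - inv p * ι Y) ∣ ≤⟨ ∣p+q∣≤∣p∣+∣q∣ (S - μ * ι Y′) (μ * (ι Y′ - inv p * ι Y)) ⟩
        ∣ S - μ * ι Y′ ∣ + ∣ μ * (ι Y′ - inv p * ι Y) ∣ ≤⟨ +-mono-≤ (dist e (a ℕ.+ q ℕ.* b) (q ℕ.* p) Y′ al′) t₂ ⟩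
        ε + ε ≡⟨ solve 1 (λ e → e :+ e := con 2ℚ :* e) refl ε ⟩
        2ℚ * ε ∎
      where
      c₀ = M ℕ.* q
      e₀ = M ℕ.* a ℕ.+ k
      re : ∀ m → M ℕ.* (a ℕ.+ q ℕ.* m) ℕ.+ k ≡ c₀ ℕ.* m ℕ.+ e₀
      re m = lem M a q m k where
        lem : ∀ M a q m k → M ℕ.* (a ℕ.+ q ℕ.* m) ℕ.+ k ≡ M ℕ.* q ℕ.* m ℕ.+ (M ℕ.* a ℕ.+ k)
        lem = solve-∀
      P? : ∀ m → Dec (p ∣ M ℕ.* (a ℕ.+ q ℕ.* m) ℕ.+ k)
      P? m = p ∣? M ℕ.* (a ℕ.+ q ℕ.* m) ℕ.+ k
      cop : Coprime p c₀
      cop = prime∤⇒coprime pr (λ p∣ → case₁ (euclidsLemma M q pr p∣))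
        where
        case₁ : (p ∣ M) ⊎ (p ∣ q) → ⊥
        case₁ (inj₁ x) = p∤M x
        case₁ (inj₂ x) = p∤q x
      sol = lin-solve c₀ e₀ p (prime>0 pr) cop
      b = proj₁ sol
      b<p = proj₁ (proj₂ sol)
      hb = proj₂ (proj₂ sol)
      aps = ap-sum P? b p b<p (λ c → subst (p ∣_) (sym (re (b ℕ.+ p ℕ.* c))) (lin-shift c₀ e₀ p b c hb))
              (λ m h → lin-unique c₀ e₀ p b m cop b<p hb (subst (p ∣_) (re m) h)) (λ m → F (a ℕ.+ q ℕ.* m)) Y
      Y′ = proj₁ aps
      S = Σ< Y′ (λ c → F (a ℕ.+ q ℕ.* b ℕ.+ q ℕ.* p ℕ.* c))
      l : ∀ a q b p c → a ℕ.+ q ℕ.* (b ℕ.+ p ℕ.* c) ≡ a ℕ.+ q ℕ.* b ℕ.+ q ℕ.* p ℕ.* c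
      l = solve-∀
      lo = proj₁ (proj₂ (proj₂ aps))
      hi = proj₂ (proj₂ (proj₂ aps))
      t₂ : ∣ μ * (ι Y′ - inv p * ι Y) ∣ ≤ ε
      t₂ = begin
        ∣ μ * (ι Y′ - inv p * ι Y) ∣ ≡⟨ ∣p*q∣≡∣p∣*∣q∣ μ _ ⟩
        ∣ μ ∣ * ∣ ι Y′ - inv p * ι Y ∣ ≤⟨ *-mono (0≤∣p∣ μ) 0≤1 (main≤ e) (frac-bound (prime>0 pr)
             (ℕₚ.<⇒≤ (ℕₚ.≤-<-trans (ℕₚ.m≤n+m _ b) lo))
             (ℕₚ.≤-trans hi (subst (ℕ._≤ p ℕ.* Y′ ℕ.+ p) (ℕₚ.+-comm (p ℕ.* Y′) b) (ℕₚ.+-monoʳ-≤ (p ℕ.* Y′) (ℕₚ.<⇒≤ b<p))))) ⟩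
        ε * 1ℚ ≡⟨ *-identityʳ ε ⟩
        ε ∎
      al′ : All (λ r → ¬ r ∣ q ℕ.* p) L
      al′ = go prL p∉L al
        where
        go : ∀ {L} → All Prime L → All (p ≢_) L → All (λ r → ¬ r ∣ q) L → All (λ r → ¬ r ∣ q ℕ.* p) L
        go [] [] [] = []
        go (pr′ ∷ a) (ne ∷ b) (nd ∷ c) = (λ r∣ → case₂ (euclidsLemma q p pr′ r∣)) ∷ go a b c
          where
          case₂ : _ → ⊥
          case₂ (inj₁ x) = nd x
          case₂ (inj₂ x) = prime∤prime pr′ pr (ne ∘ sym) x

  equi-zero : ∀ {L F μ ε} → Equi L F μ ε → Equi L (λ n → 0ℚ) 0ℚ 0ℚ
  equi-zero e = record { main≤ = ≤-refl ; dist = λ a q Y al → ≤-reflexive (trans (cong (λ w → ∣ w - 0ℚ * ι Y ∣) (z Y))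
         (cong ∣_∣ (solve 1 (λ y → con 0ℚ :- con 0ℚ :* y := con 0ℚ) refl (ι Y)))) }
    where
    z : ∀ Y → Σ< Y (λ _ → 0ℚ) ≡ 0ℚ
    z zero = refl
    z (suc Y) = trans (+-identityʳ _) (z Y)

  equi-ev : ∀ {L F μ ε} M K p → Prime p → ¬ p ∣ M → All Prime L → All (p ≢_) L → Equi L F μ ε →
    Equi (p ∷ L) (λ n → ev M K p n * F n) ((ι K * inv p) * μ) (ι (2 ℕ.* K) * ε)
  equi-ev {L} {F} {μ} {ε} M zero p pr p∤M prL p∉L e =
    equi-cong (λ n → sym (*-zeroˡ (F n))) (trans (sym (*-zeroˡ (inv p * μ))) (trans (cong (_* (inv p * μ)) (sym ι0)) (sym (*-assoc (ι 0) (inv p) μ))))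
      (≤-reflexive (trans (sym (*-zeroˡ ε)) (cong (_* ε) (sym ι0)))) (equi-zero (equi-weaken p e))
  equi-ev {L} {F} {μ} {ε} M (suc K) p pr p∤M prL p∉L e =
    equi-cong (λ n → sym (*-distribʳ-+ (F n) (ev M K p n) _)) eq₁ (≤-reflexive eq₂)
      (equi-+ (equi-ev M K p pr p∤M prL p∉L e) (equi-event M (suc K) p pr p∤M prL p∉L e))
    where
    eq₁ : ι K * inv p * μ + inv p * μ ≡ ι (suc K) * inv p * μ
    eq₁ = trans (solve 3 (λ k i m → k :* i :* m :+ i :* m := (con 1ℚ :+ k) :* i :* m) refl (ι K) (inv p) μ)
           (cong (λ w → w * inv p * μ) (trans (cong (_+ ι K) (sym ι1)) (sym (ι-+ 1 K))))
    eq₂ : ι (2 ℕ.* K) * ε + 2ℚ * ε ≡ ι (2 ℕ.* suc K) * ε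
    eq₂ = trans (sym (*-distribʳ-+ ε (ι (2 ℕ.* K)) 2ℚ)) (cong (_* ε) (trans (cong (ι (2 ℕ.* K) +_) (sym ι2)) (trans (sym (ι-+ (2 ℕ.* K) 2)) (cong ι (l K)))))
      where
      l : ∀ K → 2 ℕ.* K ℕ.+ 2 ≡ 2 ℕ.* suc K
      l = solve-∀

  pow-step : ∀ A c T → A ℕ.^ suc T ℕ.+ c ℕ.* A ℕ.^ T ℕ.≤ (A ℕ.+ c) ℕ.^ suc T
  pow-step A c T = ℕₚ.≤-trans (ℕₚ.≤-reflexive (sym (ℕₚ.*-distribʳ-+ (A ℕ.^ T) A c))) (ℕₚ.*-monoʳ-≤ (A ℕ.+ c) (ℕₚ.^-monoˡ-≤ T (ℕₚ.m≤m+n A c)))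

  drop₁ : ∀ {R : ℕ → ℕ → Set} L {L′} → AllPairs R (L ++ L′) → AllPairs R L′
  drop₁ [] a = a
  drop₁ (p ∷ L) (_ ∷ a) = drop₁ L a

  -- Each of the `K` events at a prime costs a factor 2, so a new prime adds `2 * K` times the error
  -- of order `T` to that of order `suc T`. The power of `1 + 2 * K * length L` is a closed form
  -- that dominates this recursion, by `pow-step`.
  equi-poly : ∀ {s c F μ N L₀} M K → ∣ s ∣ ≤ 1ℚ → ∣ c ∣ ≤ 1ℚ → Equi L₀ F μ (ι N) → ∀ T L →
    All Prime (L ++ L₀) → All (λ p → ¬ p ∣ M) L → AllPairs _≢_ (L ++ L₀) →
    Equi (L ++ L₀) (λ n → poly s c T (map (λ p → ev M K p n) L) * F n)
      (poly s c T (map (λ p → ι K * inv p) L) * μ) (ι ((1 ℕ.+ 2 ℕ.* K ℕ.* length L) ℕ.^ T ℕ.* N))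
  equi-poly {F = F} {μ} M K s≤ c≤ e zero L _ _ _ =
    equi-cong (λ n → sym (*-identityˡ (F n))) (sym (*-identityˡ μ)) (≤-reflexive (cong ι (sym (ℕₚ.*-identityˡ _)))) (equi-++ L e)
  equi-poly {s} {c} {F} {μ} {N} M K s≤ c≤ e (suc T) [] _ _ _ =
    equi-cong (λ n → refl) refl (ι-mono (ℕₚ.≤-trans (ℕₚ.≤-reflexive (sym (ℕₚ.*-identityˡ N))) (ℕₚ.*-monoˡ-≤ N (ℕₚ.m^n>0 (1 ℕ.+ 2 ℕ.* K ℕ.* 0) (suc T))))) (equi-scale c c≤ e)
  equi-poly {s} {c} {F} {μ} {N} {L₀} M K s≤ c≤ e (suc T) (p ∷ L) (pr ∷ prs) (nd ∷ nds) (u ∷ us) =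
    equi-cong (λ n → re (P₂ n) s (ev M K p n) (P₁ n) (F n)) (re Q₂ s (ι K * inv p) Q₁ μ) bnd
      (equi-+ (equi-weaken p (equi-poly M K s≤ c≤ e (suc T) L prs nds us))
        (equi-scale s s≤ (equi-ev M K p pr nd prs u (equi-poly M K s≤ c≤ e T L prs nds us))))
    where
    P₂ = λ n → poly s c (suc T) (map (λ p → ev M K p n) L)
    P₁ = λ n → poly s c T (map (λ p → ev M K p n) L)
    Q₂ = poly s c (suc T) (map (λ p → ι K * inv p) L)
    Q₁ = poly s c T (map (λ p → ι K * inv p) L)
    re : ∀ a s x b f → a * f + s * (x * (b * f)) ≡ (a + (s * x) * b) * f
    re = solve 5 (λ a s x b f → a :* f :+ s :* (x :* (b :* f)) := (a :+ (s :* x) :* b) :* f) refl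
    A = 1 ℕ.+ 2 ℕ.* K ℕ.* length L
    bnd : ι (A ℕ.^ suc T ℕ.* N) + ι (2 ℕ.* K) * ι (A ℕ.^ T ℕ.* N) ≤ ι ((1 ℕ.+ 2 ℕ.* K ℕ.* suc (length L)) ℕ.^ suc T ℕ.* N)
    bnd = begin
      ι (A ℕ.^ suc T ℕ.* N) + ι (2 ℕ.* K) * ι (A ℕ.^ T ℕ.* N) ≡⟨ cong (ι (A ℕ.^ suc T ℕ.* N) +_) (sym (ι-* (2 ℕ.* K) (A ℕ.^ T ℕ.* N))) ⟩
      ι (A ℕ.^ suc T ℕ.* N) + ι (2 ℕ.* K ℕ.* (A ℕ.^ T ℕ.* N)) ≡⟨ sym (ι-+ (A ℕ.^ suc T ℕ.* N) _) ⟩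
      ι (A ℕ.^ suc T ℕ.* N ℕ.+ 2 ℕ.* K ℕ.* (A ℕ.^ T ℕ.* N)) ≡⟨ cong ι (l₁ (A ℕ.^ suc T) N (2 ℕ.* K) (A ℕ.^ T)) ⟩
      ι ((A ℕ.^ suc T ℕ.+ 2 ℕ.* K ℕ.* A ℕ.^ T) ℕ.* N) ≤⟨ ι-mono (ℕₚ.*-monoˡ-≤ N (pow-step A (2 ℕ.* K) T)) ⟩
      ι ((A ℕ.+ 2 ℕ.* K) ℕ.^ suc T ℕ.* N) ≡⟨ cong (λ w → ι (w ℕ.^ suc T ℕ.* N)) (l₂ K (length L)) ⟩
      ι ((1 ℕ.+ 2 ℕ.* K ℕ.* suc (length L)) ℕ.^ suc T ℕ.* N) ∎
      where
      l₁ : ∀ a n k b → a ℕ.* n ℕ.+ k ℕ.* (b ℕ.* n) ≡ (a ℕ.+ k ℕ.* b) ℕ.* n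
      l₁ = solve-∀
      l₂ : ∀ K l → 1 ℕ.+ 2 ℕ.* K ℕ.* l ℕ.+ 2 ℕ.* K ≡ 1 ℕ.+ 2 ℕ.* K ℕ.* suc l
      l₂ = solve-∀

  -- The Brun-Hooley sieve over blocks of primes

  record Block : Set where
    constructor block
    field
      width half : ℕ
      primes : List ℕ
  open Block public

  allPrimes : List Block → List ℕ
  allPrimes [] = []
  allPrimes (B ∷ Bs) = primes B ++ allPrimes Bs

  -- Two weights matter: `ev` at a point, which gives the pointwise sieve inequalities, and the
  -- density `frac`, which gives their mean values.
  Weight : Set
  Weight = ℕ → ℕ → ℚ

  vals : Weight → Block → List ℚ
  vals f B = map (f (width B)) (primes B)

  -- The truncation order is stored halved, so it is even by construction and `altVal` is always an
  -- upper bound for the block's product.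
  altVal esymVal : Weight → Block → ℚ
  altVal f B = alt (double (half B)) (vals f B)
  esymVal f B = esym (double (half B)) (vals f B)

  -- Hooley's lower bound: if v ≤ A ≤ v + E and lower ≤ full ≤ upper, then A lower - E upper ≤ v full.
  upper lower full : Weight → List Block → ℚ
  upper f [] = 1ℚ
  upper f (B ∷ Bs) = altVal f B * upper f Bs
  lower f [] = 1ℚ
  lower f (B ∷ Bs) = altVal f B * lower f Bs - esymVal f B * upper f Bs
  full f [] = 1ℚ
  full f (B ∷ Bs) = ∏1- (vals f B) * full f Bs

  UnitOn : Weight → List Block → Set
  UnitOn f = All (λ B → All Unit (vals f B))

  module _ (f : Weight) where
    full≥0 : ∀ {Bs} → UnitOn f Bs → 0ℚ ≤ full f Bs
    full≥0 [] = 0≤1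
    full≥0 (u ∷ us) = *-≥0 (∏1-≥0 (All.map proj₂ u)) (full≥0 us)

    full≤upper : ∀ {Bs} → UnitOn f Bs → full f Bs ≤ upper f Bs
    full≤upper [] = ≤-refl
    full≤upper {B ∷ Bs} (u ∷ us) = *-mono (∏1-≥0 (All.map proj₂ u)) (≤-trans (full≥0 us) (full≤upper us)) (proj₁ (bonferroni-even (half B) u)) (full≤upper us)

    lower≤full : ∀ {Bs} → UnitOn f Bs → lower f Bs ≤ full f Bs
    lower≤full [] = ≤-refl
    lower≤full {B ∷ Bs} (u ∷ us) = begin
      altVal f B * lower f Bs - esymVal f B * upper f Bs ≤⟨ -mono (*ˡ A≥0 (lower≤full us)) (*ˡ E≥0 (full≤upper us)) ⟩
      altVal f B * full f Bs - esymVal f B * full f Bs ≤⟨ +-monoˡ-≤ _ (*ʳ (full≥0 us) (proj₂ bf)) ⟩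
      (∏1- (vals f B) + esymVal f B) * full f Bs - esymVal f B * full f Bs ≡⟨ solve 3 (λ v e w → (v :+ e) :* w :- e :* w := v :* w) refl (∏1- (vals f B)) (esymVal f B) (full f Bs) ⟩
      ∏1- (vals f B) * full f Bs ∎
      where
      bf = bonferroni-even (half B) u
      A≥0 : 0ℚ ≤ altVal f B
      A≥0 = ≤-trans (∏1-≥0 (All.map proj₂ u)) (proj₁ bf)
      E≥0 : 0ℚ ≤ esymVal f B
      E≥0 = esym≥0 (double (half B)) (All.map proj₁ u)

  frac : Weight
  frac K p = ι K * inv p

  -- The factor 2 is for the two products whose difference is `lower`; `upper` is given the same
  -- bound so that one recursion serves both.
  err : List Block → ℕ
  err [] = 1
  err (B ∷ Bs) = 2 ℕ.* ((1 ℕ.+ 2 ℕ.* width B ℕ.* length (primes B)) ℕ.^ double (half B) ℕ.* err Bs)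

  record Admissible (M : ℕ) (Bs : List Block) : Set where
    constructor adm
    field
      isPrime : All Prime (allPrimes Bs)
      coprimeM : All (λ p → ¬ p ∣ M) (allPrimes Bs)
      distinct : AllPairs _≢_ (allPrimes Bs)
  open Admissible public

  adm-tail : ∀ {M B Bs} → Admissible M (B ∷ Bs) → Admissible M Bs
  adm-tail {B = B} (adm a b c) = adm (Allₚ.++⁻ʳ (primes B) a) (Allₚ.++⁻ʳ (primes B) b) (drop₁ (primes B) c)

  ∣1∣ : ∣ 1ℚ ∣ ≤ 1ℚ
  ∣1∣ = ≤-refl
  ∣-1∣ : ∣ - 1ℚ ∣ ≤ 1ℚ
  ∣-1∣ = ≤-refl
  ∣0∣ : ∣ 0ℚ ∣ ≤ 1ℚ
  ∣0∣ = 0≤1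

  equi-upper : ∀ {M} Bs → Admissible M Bs → Equi (allPrimes Bs) (λ n → upper (λ K p → ev M K p n) Bs) (upper frac Bs) (ι (err Bs))
  equi-lower : ∀ {M} Bs → Admissible M Bs → Equi (allPrimes Bs) (λ n → lower (λ K p → ev M K p n) Bs) (lower frac Bs) (ι (err Bs))
  equi-upper [] ad = equi-one
  equi-upper {M} (B ∷ Bs) ad = equi-cong (λ n → refl) refl (ι-mono (ℕₚ.m≤n*m _ 2))
    (equi-poly M (width B) ∣-1∣ ∣1∣ (equi-upper Bs (adm-tail {B = B} ad)) (double (half B)) (primes B) (isPrime ad) (Allₚ.++⁻ˡ (primes B) (coprimeM ad)) (distinct ad))
  equi-lower [] ad = equi-one
  equi-lower {M} (B ∷ Bs) ad = equi-cong (λ n → re (P n) (Q n)) (re (altVal frac B * lower frac Bs) (esymVal frac B * upper frac Bs)) (≤-reflexive (trans (sym (ι-+ N N)) (cong ι (l N))))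
    (equi-+ (equi-poly M (width B) ∣-1∣ ∣1∣ (equi-lower Bs ad′) (double (half B)) (primes B) (isPrime ad) (Allₚ.++⁻ˡ (primes B) (coprimeM ad)) (distinct ad))
      (equi-scale (- 1ℚ) ∣-1∣ (equi-poly M (width B) ∣1∣ ∣0∣ (equi-upper Bs ad′) (double (half B)) (primes B) (isPrime ad) (Allₚ.++⁻ˡ (primes B) (coprimeM ad)) (distinct ad))))
    where
    ad′ = adm-tail {B = B} ad
    N = (1 ℕ.+ 2 ℕ.* width B ℕ.* length (primes B)) ℕ.^ double (half B) ℕ.* err Bs
    P Q : ℕ → ℚ
    P n = altVal (λ K p → ev M K p n) B * lower (λ K p → ev M K p n) Bs
    Q n = esymVal (λ K p → ev M K p n) B * upper (λ K p → ev M K p n) Bs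
    re : ∀ a b → a + (- 1ℚ) * b ≡ a - b
    re = solve 2 (λ a b → a :+ (:- con 1ℚ) :* b := a :- b) refl
    l : ∀ n → n ℕ.+ n ≡ 2 ℕ.* n
    l = solve-∀

  χ≥0 : ∀ {P : Set} (d : Dec P) → 0ℚ ≤ χ d
  χ≥0 (yes _) = 0≤1
  χ≥0 (no _) = ≤-refl

  ev≥0 : ∀ M K p n → 0ℚ ≤ ev M K p n
  ev≥0 M zero p n = ≤-refl
  ev≥0 M (suc K) p n = +-≥0 (ev≥0 M K p n) (χ≥0 (p ∣? _))

  ev-zero : ∀ M K p n → (∀ k → k ℕ.< K → ¬ p ∣ M ℕ.* n ℕ.+ suc k) → ev M K p n ≡ 0ℚ
  ev-zero M zero p n h = refl
  ev-zero M (suc K) p n h with p ∣? M ℕ.* n ℕ.+ suc K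
  ... | yes d = ⊥-elim (h K ℕₚ.≤-refl d)
  ... | no _ = trans (+-identityʳ _) (ev-zero M K p n (λ k l → h k (ℕₚ.m<n⇒m<1+n l)))

  -- Two of the shifts differ by less than `K < p`, so `p` cannot divide both of the shifted
  -- numbers.
  ev≤1 : ∀ M K p n → K ℕ.< p → ev M K p n ≤ 1ℚ
  ev≤1 M zero p n _ = 0≤1
  ev≤1 M (suc K) p n K<p with p ∣? M ℕ.* n ℕ.+ suc K
  ... | no _ = ≤-trans (≤-reflexive (+-identityʳ _)) (ev≤1 M K p n (ℕₚ.<-trans (ℕₚ.n<1+n K) K<p))
  ... | yes d = ≤-reflexive (trans (cong (_+ 1ℚ) (ev-zero M K p n bad)) (+-identityˡ 1ℚ))
    where
    bad : ∀ k → k ℕ.< K → ¬ p ∣ M ℕ.* n ℕ.+ suc k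
    bad k k<K d′ = ℕₚ.<⇒≱ (ℕₚ.≤-<-trans (ℕₚ.m∸n≤m K k) (ℕₚ.<-trans (ℕₚ.n<1+n K) K<p))
       (∣⇒≤ {{ℕ.>-nonZero (ℕₚ.m<n⇒0<n∸m k<K)}} (∣m+n∣m⇒∣n (subst (p ∣_) eq d) d′))
      where
      eq : M ℕ.* n ℕ.+ suc K ≡ M ℕ.* n ℕ.+ suc k ℕ.+ (K ℕ.∸ k)
      eq = trans (cong (λ w → M ℕ.* n ℕ.+ suc w) (sym (ℕₚ.m+[n∸m]≡n (ℕₚ.<⇒≤ k<K)))) (sym (ℕₚ.+-assoc (M ℕ.* n) (suc k) _))

  ev≥1 : ∀ M K p n k → k ℕ.< K → p ∣ M ℕ.* n ℕ.+ suc k → 1ℚ ≤ ev M K p n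
  ev≥1 M (suc K) p n k k<K d with ℕₚ.m<1+n⇒m<n∨m≡n k<K
  ... | inj₁ k<K′ = ≤-trans (ev≥1 M K p n k k<K′ d) (≤+ˡ (χ≥0 (p ∣? _)))
  ... | inj₂ refl with p ∣? M ℕ.* n ℕ.+ suc K
  ...   | yes _ = ≤-trans (≤+ˡ (ev≥0 M K p n)) (≤-reflexive (+-comm 1ℚ (ev M K p n)))
  ...   | no ¬d = ⊥-elim (¬d d)

  Big : List Block → Set
  Big = All (λ B → All (λ p → (2 ℕ.* width B ℕ.≤ p) × (0 ℕ.< p)) (primes B))

  2K≤p⇒K<p : ∀ K {p} → 2 ℕ.* K ℕ.≤ p → 0 ℕ.< p → K ℕ.< p
  2K≤p⇒K<p zero _ h = h
  2K≤p⇒K<p (suc K) h _ = ℕₚ.<-≤-trans (ℕₚ.m<m+n (suc K) (ℕ.s≤s ℕ.z≤n)) h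

  unit-ev : ∀ M n {Bs} → Big Bs → UnitOn (λ K p → ev M K p n) Bs
  unit-ev M n = All.map (λ {B} a → Allₚ.map⁺ (All.map (λ {p} (h , h′) → ev≥0 M (width B) p n , ev≤1 M (width B) p n (2K≤p⇒K<p (width B) h h′)) a))

  frac≥0 : ∀ K p → 0ℚ ≤ frac K p
  frac≥0 K p = *-≥0 (ι≥0 K) (inv-nonneg p)

  2frac≤1 : ∀ K p → 2 ℕ.* K ℕ.≤ p → 0 ℕ.< p → 2ℚ * frac K p ≤ 1ℚ
  2frac≤1 K p h h′ = begin
    2ℚ * (ι K * inv p) ≡⟨ sym (*-assoc 2ℚ (ι K) (inv p)) ⟩
    2ℚ * ι K * inv p ≡⟨ cong (_* inv p) (trans (cong (_* ι K) (sym ι2)) (sym (ι-* 2 K))) ⟩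
    ι (2 ℕ.* K) * inv p ≤⟨ *ʳ (inv-nonneg p) (ι-mono h) ⟩
    ι p * inv p ≡⟨ ι*inv h′ ⟩
    1ℚ ∎

  x≤2x : ∀ {x} → 0ℚ ≤ x → x ≤ 2ℚ * x
  x≤2x {x} p = ≤-trans (≤+ˡ p) (≤-reflexive (solve 1 (λ e → e :+ e := con 2ℚ :* e) refl x))

  unit-frac : ∀ {Bs} → Big Bs → UnitOn frac Bs
  unit-frac = All.map (λ {B} a → Allₚ.map⁺ (All.map (λ {p} (h , h′) → frac≥0 (width B) p , ≤-trans (x≤2x (frac≥0 (width B) p)) (2frac≤1 (width B) p h h′)) a))

  -- Keeping the truncation losses bounded

  halfPow : ℕ → ℚ
  halfPow n = inv (2 ℕ.^ n)

  halfPow≡2* : ∀ n → halfPow n ≡ 2ℚ * halfPow (suc n)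
  halfPow≡2* n = begin-equality
    halfPow n ≡⟨ sym (*-identityʳ _) ⟩
    halfPow n * 1ℚ ≡⟨ cong (halfPow n *_) (sym (ι*inv (ℕₚ.m^n>0 2 (suc n)))) ⟩
    halfPow n * (ι (2 ℕ.* 2 ℕ.^ n) * halfPow (suc n)) ≡⟨ cong (λ w → halfPow n * (w * halfPow (suc n))) (trans (ι-* 2 (2 ℕ.^ n)) (cong (_* ι (2 ℕ.^ n)) ι2)) ⟩
    halfPow n * (2ℚ * ι (2 ℕ.^ n) * halfPow (suc n)) ≡⟨ solve 4 (λ h t i g → h :* (t :* i :* g) := (i :* h) :* (t :* g)) refl (halfPow n) 2ℚ (ι (2 ℕ.^ n)) (halfPow (suc n)) ⟩
    (ι (2 ℕ.^ n) * halfPow n) * (2ℚ * halfPow (suc n)) ≡⟨ cong (_* (2ℚ * halfPow (suc n))) (ι*inv (ℕₚ.m^n>0 2 n)) ⟩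
    1ℚ * (2ℚ * halfPow (suc n)) ≡⟨ *-identityˡ _ ⟩
    2ℚ * halfPow (suc n) ∎

  -- A geometric budget: the loss allowed to a block, relative to its density, halves with each
  -- further block behind it. The accumulated loss then stays bounded however many blocks there are.
  data Tight : List Block → Set where
    []  : Tight []
    _∷_ : ∀ {B Bs} → esymVal frac B ≤ halfPow (3 ℕ.+ length Bs) * ∏1- (vals frac B) → Tight Bs → Tight (B ∷ Bs)

  4ℚ 8ℚ : ℚ
  4ℚ = 2ℚ + 2ℚ
  8ℚ = 4ℚ + 4ℚ

  halfPow≡8* : ∀ n → halfPow n ≡ 8ℚ * halfPow (3 ℕ.+ n)
  halfPow≡8* n = trans (halfPow≡2* n) (trans (cong (2ℚ *_) (trans (halfPow≡2* (suc n)) (cong (2ℚ *_) (halfPow≡2* (2 ℕ.+ n)))))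
    (solve 1 (λ h → con 2ℚ :* (con 2ℚ :* (con 2ℚ :* h)) := con 8ℚ :* h) refl (halfPow (3 ℕ.+ n))))

  halfPow≡4* : ∀ n → halfPow n ≡ 4ℚ * halfPow (2 ℕ.+ n)
  halfPow≡4* n = trans (halfPow≡2* n) (trans (cong (2ℚ *_) (halfPow≡2* (suc n)))
    (solve 1 (λ h → con 2ℚ :* (con 2ℚ :* h) := con 4ℚ :* h) refl (halfPow (2 ℕ.+ n))))

  -- The slack `halfPow (length Bs)` is what the induction consumes. With `h` the loss of the new
  -- block the slack shrinks from `8 h` to `4 h`, and `(1 + h) * (2 - 8 h) ≤ 2 - 4 h`.
  upper≤ : ∀ {Bs} → Big Bs → Tight Bs → upper frac Bs ≤ (2ℚ - halfPow (length Bs)) * full frac Bs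
  upper≤ [] [] = begin
    1ℚ ≡⟨⟩
    (2ℚ - 1ℚ) * 1ℚ ≡⟨ cong (λ w → (2ℚ - w) * 1ℚ) (sym halfPow0) ⟩
    (2ℚ - halfPow 0) * 1ℚ ∎
    where
    halfPow0 : halfPow 0 ≡ 1ℚ
    halfPow0 = trans (sym (*-identityˡ _)) (trans (cong (_* halfPow 0) (sym ι1)) (ι*inv (ℕ.s≤s ℕ.z≤n)))
  upper≤ {B ∷ Bs} (b ∷ bs) (t ∷ ts) = begin
    altVal frac B * upper frac Bs ≤⟨ *-mono (≤-trans v≥0 (proj₁ bf)) (≤-trans U≥0 ih) A≤ ih ⟩
    (1ℚ + h) * v * ((2ℚ - halfPow (length Bs)) * V) ≡⟨ cong (λ w → (1ℚ + h) * v * ((2ℚ - w) * V)) (halfPow≡8* (length Bs)) ⟩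
    (1ℚ + h) * v * ((2ℚ - 8ℚ * h) * V) ≡⟨ solve 3 (λ h v V → (con 1ℚ :+ h) :* v :* ((con 2ℚ :- con 8ℚ :* h) :* V) := (con 2ℚ :- con 4ℚ :* h) :* (v :* V) :- (con 2ℚ :* h :+ con 8ℚ :* (h :* h)) :* (v :* V)) refl h v V ⟩
    (2ℚ - 4ℚ * h) * (v * V) - (2ℚ * h + 8ℚ * (h * h)) * (v * V) ≤⟨ -mono (≤-refl {(2ℚ - 4ℚ * h) * (v * V)}) (*-≥0 (+-≥0 (*-≥0 2≥0 h≥0) (*-≥0 (nonNegative⁻¹ 8ℚ) (*-≥0 h≥0 h≥0))) (*-≥0 v≥0 V≥0)) ⟩
    (2ℚ - 4ℚ * h) * (v * V) - 0ℚ ≡⟨ +-identityʳ _ ⟩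
    (2ℚ - 4ℚ * h) * (v * V) ≡⟨ cong (λ w → (2ℚ - w) * (v * V)) (sym (halfPow≡4* (suc (length Bs)))) ⟩
    (2ℚ - halfPow (suc (length Bs))) * (v * V) ∎
    where
    v = ∏1- (vals frac B)
    V = full frac Bs
    h = halfPow (3 ℕ.+ length Bs)
    ih = upper≤ {Bs} bs ts
    u = All.head (unit-frac {B ∷ Bs} (b ∷ bs))
    us = unit-frac {Bs} bs
    h≥0 : 0ℚ ≤ h
    h≥0 = inv-nonneg (2 ℕ.^ (3 ℕ.+ length Bs))
    v≥0 : 0ℚ ≤ v
    v≥0 = ∏1-≥0 (All.map proj₂ u)
    V≥0 : 0ℚ ≤ V
    V≥0 = full≥0 frac us
    U≥0 : 0ℚ ≤ upper frac Bs
    U≥0 = ≤-trans V≥0 (full≤upper frac us)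
    bf = bonferroni-even (half B) u
    A≤ : altVal frac B ≤ (1ℚ + h) * v
    A≤ = ≤-trans (proj₂ bf) (≤-trans (+-monoʳ-≤ v t) (≤-reflexive (solve 2 (λ h v → v :+ h :* v := (con 1ℚ :+ h) :* v) refl h v)))

  -- Here the slack falls from `8 h` to `4 h` because the subtracted term, doubled, is at most
  -- `2 * h * 2` times the full density.
  lower≥ : ∀ {Bs} → Big Bs → Tight Bs → (1ℚ + halfPow (length Bs)) * full frac Bs ≤ 2ℚ * lower frac Bs
  lower≥ [] [] = begin
    (1ℚ + halfPow 0) * 1ℚ ≡⟨ cong (λ w → (1ℚ + w) * 1ℚ) halfPow0 ⟩
    (1ℚ + 1ℚ) * 1ℚ ∎
    where
    halfPow0 : halfPow 0 ≡ 1ℚ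
    halfPow0 = trans (sym (*-identityˡ _)) (trans (cong (_* halfPow 0) (sym ι1)) (ι*inv (ℕ.s≤s ℕ.z≤n)))
  lower≥ {B ∷ Bs} (b ∷ bs) (t ∷ ts) = begin
    (1ℚ + halfPow (suc (length Bs))) * (v * V) ≡⟨ cong (λ w → (1ℚ + w) * (v * V)) (halfPow≡4* (suc (length Bs))) ⟩
    (1ℚ + 4ℚ * h) * (v * V) ≡⟨ solve 3 (λ h v V → (con 1ℚ :+ con 4ℚ :* h) :* (v :* V) := v :* ((con 1ℚ :+ con 8ℚ :* h) :* V) :- con 2ℚ :* (h :* v :* (con 2ℚ :* V))) refl h v V ⟩
    v * ((1ℚ + 8ℚ * h) * V) - 2ℚ * (h * v * (2ℚ * V)) ≤⟨ -mono (*-mono v≥0 2L≥0 (proj₁ bf) ih′) (*ˡ 2≥0 (*-mono E≥0 (*-≥0 2≥0 V≥0) t U≤)) ⟩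
    altVal frac B * (2ℚ * lower frac Bs) - 2ℚ * (esymVal frac B * upper frac Bs) ≡⟨ solve 4 (λ a l e u → a :* (con 2ℚ :* l) :- con 2ℚ :* (e :* u) := con 2ℚ :* (a :* l :- e :* u)) refl (altVal frac B) (lower frac Bs) (esymVal frac B) (upper frac Bs) ⟩
    2ℚ * (altVal frac B * lower frac Bs - esymVal frac B * upper frac Bs) ∎
    where
    v = ∏1- (vals frac B)
    V = full frac Bs
    h = halfPow (3 ℕ.+ length Bs)
    u = All.head (unit-frac {B ∷ Bs} (b ∷ bs))
    us = unit-frac {Bs} bs
    h≥0 : 0ℚ ≤ h
    h≥0 = inv-nonneg (2 ℕ.^ (3 ℕ.+ length Bs))
    v≥0 : 0ℚ ≤ v
    v≥0 = ∏1-≥0 (All.map proj₂ u)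
    V≥0 : 0ℚ ≤ V
    V≥0 = full≥0 frac us
    ih′ : (1ℚ + 8ℚ * h) * V ≤ 2ℚ * lower frac Bs
    ih′ = subst (λ w → (1ℚ + w) * V ≤ 2ℚ * lower frac Bs) (halfPow≡8* (length Bs)) (lower≥ bs ts)
    2L≥0 : 0ℚ ≤ 2ℚ * lower frac Bs
    2L≥0 = ≤-trans (*-≥0 (+-≥0 0≤1 (*-≥0 (nonNegative⁻¹ 8ℚ) h≥0)) V≥0) ih′
    bf = bonferroni-even (half B) u
    E≥0 : 0ℚ ≤ esymVal frac B
    E≥0 = esym≥0 (double (half B)) (All.map proj₁ u)
    U≤ : upper frac Bs ≤ 2ℚ * V
    U≤ = ≤-trans (upper≤ bs ts) (*ʳ V≥0 (≤-trans (-mono (≤-refl {2ℚ}) (inv-nonneg (2 ℕ.^ length Bs))) (≤-reflexive (+-identityʳ 2ℚ))))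

  upper≤2full : ∀ {Bs} → Big Bs → Tight Bs → upper frac Bs ≤ 2ℚ * full frac Bs
  upper≤2full {Bs} bs ts = ≤-trans (upper≤ bs ts) (*ʳ (full≥0 frac (unit-frac bs)) (≤-trans (-mono (≤-refl {2ℚ}) (inv-nonneg (2 ℕ.^ length Bs))) (≤-reflexive (+-identityʳ 2ℚ))))

  full≤2lower : ∀ {Bs} → Big Bs → Tight Bs → full frac Bs ≤ 2ℚ * lower frac Bs
  full≤2lower {Bs} bs ts = ≤-trans (≤-reflexive (sym (*-identityˡ _))) (≤-trans (*ʳ (full≥0 frac (unit-frac bs)) (≤+ˡ {1ℚ} (inv-nonneg (2 ℕ.^ length Bs)))) (lower≥ bs ts))

  sift : ℕ → List Block → ℕ → ℚ
  sift M Bs n = full (λ K p → ev M K p n) Bs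

  sieve-upper : ∀ {M Bs} → Admissible M Bs → Big Bs → Tight Bs → ∀ a q Y → All (λ p → ¬ p ∣ q) (allPrimes Bs) →
    Σ< Y (λ m → sift M Bs (a ℕ.+ q ℕ.* m)) ≤ 2ℚ * full frac Bs * ι Y + ι (err Bs)
  sieve-upper {M} {Bs} ad bs ts a q Y nd = begin
    Σ< Y (λ m → sift M Bs (a ℕ.+ q ℕ.* m)) ≤⟨ Σ-mono Y (λ m _ → full≤upper _ (unit-ev M (a ℕ.+ q ℕ.* m) bs)) ⟩
    S ≡⟨ solve 2 (λ s t → s := (s :- t) :+ t) refl S (upper frac Bs * ι Y) ⟩
    (S - upper frac Bs * ι Y) + upper frac Bs * ι Y ≤⟨ +-mono-≤ (≤-trans (≤∣∣ _) (dist (equi-upper Bs ad) a q Y nd)) (*ʳ (ι≥0 Y) (upper≤2full bs ts)) ⟩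
    ι (err Bs) + 2ℚ * full frac Bs * ι Y ≡⟨ +-comm (ι (err Bs)) (2ℚ * full frac Bs * ι Y) ⟩
    2ℚ * full frac Bs * ι Y + ι (err Bs) ∎
    where S = Σ< Y (λ m → upper (λ K p → ev M K p (a ℕ.+ q ℕ.* m)) Bs)

  sieve-lower : ∀ {M Bs} → Admissible M Bs → Big Bs → Tight Bs → ∀ a q Y → All (λ p → ¬ p ∣ q) (allPrimes Bs) →
    full frac Bs * ι Y ≤ 2ℚ * (Σ< Y (λ m → sift M Bs (a ℕ.+ q ℕ.* m)) + ι (err Bs))
  sieve-lower {M} {Bs} ad bs ts a q Y nd = begin
    full frac Bs * ι Y ≤⟨ *ʳ (ι≥0 Y) (full≤2lower bs ts) ⟩
    2ℚ * lower frac Bs * ι Y ≡⟨ solve 3 (λ l y s → con 2ℚ :* l :* y := con 2ℚ :* (s :+ (:- (s :- l :* y)))) refl (lower frac Bs) (ι Y) S ⟩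
    2ℚ * (S + (- (S - lower frac Bs * ι Y))) ≤⟨ *ˡ 2≥0 (+-mono-≤ (Σ-mono Y (λ m _ → lower≤full _ (unit-ev M (a ℕ.+ q ℕ.* m) bs))) (≤-trans (-≤∣∣ _) (dist (equi-lower Bs ad) a q Y nd))) ⟩
    2ℚ * (Σ< Y (λ m → sift M Bs (a ℕ.+ q ℕ.* m)) + ι (err Bs)) ∎
    where S = Σ< Y (λ m → lower (λ K p → ev M K p (a ℕ.+ q ℕ.* m)) Bs)

  -- Deleting a prime from the sieve

  data Off (d p : ℕ) : Set where
    off : p ≢ d → Off d p

  abstract
    off? : ∀ d p → Dec (Off d p)
    off? d p with p ℕ.≟ d
    ... | yes e = no (λ { (off ne) → ne e })
    ... | no ne = yes (off ne)

  -- On a residue class modulo a product of primes the sieve can only use primes that do not divide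
  -- the modulus, hence these deletions.
  rm : ℕ → List ℕ → List ℕ
  rm d = filter (off? d)

  rmB : ℕ → Block → Block
  rmB d (block K T L) = block K T (rm d L)

  rmBs : ℕ → List Block → List Block
  rmBs d = map (rmB d)

  allPrimes-rm : ∀ d Bs → allPrimes (rmBs d Bs) ≡ rm d (allPrimes Bs)
  allPrimes-rm d [] = refl
  allPrimes-rm d (B ∷ Bs) = trans (cong (rm d (primes B) ++_) (allPrimes-rm d Bs)) (sym (filter-++ (off? d) (primes B) (allPrimes Bs)))

  adm-rm : ∀ {M} d {Bs} → Admissible M Bs → Admissible M (rmBs d Bs)
  adm-rm d {Bs} (adm a b c) = adm (subst (All _) eq (Allₚ.filter⁺ (off? d) a)) (subst (All _) eq (Allₚ.filter⁺ (off? d) b)) (subst (AllPairs _≢_) eq (APₚ.filter⁺ (off? d) c))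
    where eq = sym (allPrimes-rm d Bs)

  all-rm : ∀ {P : ℕ → Set} d Bs → All P (allPrimes Bs) → All P (allPrimes (rmBs d Bs))
  all-rm d Bs a = subst (All _) (sym (allPrimes-rm d Bs)) (Allₚ.filter⁺ (off? d) a)

  rm-≢ : ∀ d Bs → All (_≢ d) (allPrimes (rmBs d Bs))
  rm-≢ d Bs = subst (All (_≢ d)) (sym (allPrimes-rm d Bs)) (All.map (λ { (off ne) → ne }) (Allₚ.all-filter (off? d) (allPrimes Bs)))

  big-rm : ∀ d {Bs} → Big Bs → Big (rmBs d Bs)
  big-rm d [] = []
  big-rm d {B ∷ Bs} (b ∷ bs) = Allₚ.filter⁺ (off? d) {xs = primes B} b ∷ big-rm d {Bs} bs

  err-rm : ∀ d Bs → err (rmBs d Bs) ℕ.≤ err Bs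
  err-rm d [] = ℕₚ.≤-refl
  err-rm d (B ∷ Bs) = step (length (primes (rmB d B))) (length (primes B)) (err (rmBs d Bs)) (err Bs) (length-filter (off? d) (primes B)) (err-rm d Bs)
    where
    base : ℕ → ℕ
    base l = 1 ℕ.+ 2 ℕ.* width B ℕ.* l
    step : ∀ l l′ N N′ → l ℕ.≤ l′ → N ℕ.≤ N′ → 2 ℕ.* (base l ℕ.^ double (half B) ℕ.* N) ℕ.≤ 2 ℕ.* (base l′ ℕ.^ double (half B) ℕ.* N′)
    step l l′ N N′ h h′ = ℕₚ.*-monoʳ-≤ 2 {base l ℕ.^ double (half B) ℕ.* N} {base l′ ℕ.^ double (half B) ℕ.* N′}
       (ℕₚ.*-mono-≤ {base l ℕ.^ double (half B)} {base l′ ℕ.^ double (half B)} {N} {N′}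
         (ℕₚ.^-monoˡ-≤ (double (half B)) {base l} {base l′} (ℕ.s≤s (ℕₚ.*-monoʳ-≤ (2 ℕ.* width B) {l} {l′} h))) h′)

  module _ (g : ℕ → ℚ) where
    ∏1-rm≥ : ∀ d L → All (λ p → Unit (g p)) L → ∏1- (map g L) ≤ ∏1- (map g (rm d L))
    ∏1-rm≥ d [] [] = ≤-refl
    ∏1-rm≥ d (p ∷ L) ((h , h′) ∷ us) with off? d p
    ... | no _ = begin
      (1ℚ - g p) * ∏1- (map g L) ≤⟨ *-mono (1-≥0 h′) (∏1-≥0 (Allₚ.map⁺ (Allₚ.filter⁺ (off? d) (All.map proj₂ us)))) (1-≤1 h) (∏1-rm≥ d L us) ⟩
      1ℚ * ∏1- (map g (rm d L)) ≡⟨ *-identityˡ _ ⟩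
      ∏1- (map g (rm d L)) ∎
    ... | yes _ = *ˡ (1-≥0 h′) (∏1-rm≥ d L us)

    esym-rm≤ : ∀ T d L → All (λ p → 0ℚ ≤ g p) L → esym T (map g (rm d L)) ≤ esym T (map g L)
    esym-rm≤ zero d L us = ≤-refl
    esym-rm≤ (suc T) d [] us = ≤-refl
    esym-rm≤ (suc T) d (p ∷ L) (u ∷ us) with off? d p
    ... | no _ = ≤-trans (esym-rm≤ (suc T) d L us) (≤+ˡ (*-≥0 (*-≥0 0≤1 u) (esym≥0 T (Allₚ.map⁺ us))))
    ... | yes _ = +-mono-≤ (esym-rm≤ (suc T) d L us) (*ˡ (*-≥0 0≤1 u) (esym-rm≤ T d L us))

    ∏1-rm≤ : ∀ φ d L → AllPairs _≢_ L → All (λ p → g p ≤ 1ℚ) L → d ∈ L → All (λ p → 1ℚ ≤ φ * (1ℚ - g p)) L →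
      ∏1- (map g (rm d L)) ≤ φ * ∏1- (map g L)
    ∏1-rm≤ φ d (p ∷ L) (a ∷ as) (h ∷ hs) d∈ (q ∷ qs) with off? d p
    ... | no ¬p≢d = begin
      ∏1- (map g (rm d L)) ≡⟨ cong (λ w → ∏1- (map g w)) (filter-all (off? d) (All.map (λ ne → off (λ eq → ¬p≢d (off (λ e → ne (trans e (sym eq)))))) a)) ⟩
      ∏1- (map g L) ≡⟨ sym (*-identityˡ _) ⟩
      1ℚ * ∏1- (map g L) ≤⟨ *ʳ (∏1-≥0 (Allₚ.map⁺ hs)) q ⟩
      φ * (1ℚ - g p) * ∏1- (map g L) ≡⟨ *-assoc φ _ _ ⟩
      φ * ((1ℚ - g p) * ∏1- (map g L)) ∎
    ... | yes (off p≢d) = begin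
      (1ℚ - g p) * ∏1- (map g (rm d L)) ≤⟨ *ˡ (1-≥0 h) (∏1-rm≤ φ d L as hs (tl d∈) qs) ⟩
      (1ℚ - g p) * (φ * ∏1- (map g L)) ≡⟨ solve 3 (λ a b c → a :* (b :* c) := b :* (a :* c)) refl (1ℚ - g p) φ (∏1- (map g L)) ⟩
      φ * ((1ℚ - g p) * ∏1- (map g L)) ∎
      where
      tl : d ∈ p ∷ L → d ∈ L
      tl (here e) = ⊥-elim (p≢d (sym e))
      tl (there x) = x

  full-rm≥ : ∀ f d Bs → All (λ B → All (λ p → Unit (f (width B) p)) (primes B)) Bs → full f Bs ≤ full f (rmBs d Bs)
  full-rm≥ f d [] [] = ≤-refl
  full-rm≥ f d (B ∷ Bs) (u ∷ us) = *-mono (∏1-≥0 (Allₚ.map⁺ (All.map proj₂ u)))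
     (full≥0 f (Allₚ.map⁺ (All.map (λ {B} a → Allₚ.map⁺ (Allₚ.filter⁺ (off? d) a)) us)))
     (∏1-rm≥ (f (width B)) d (primes B) u) (full-rm≥ f d Bs us)

  tight-rm : ∀ d {Bs} → Big Bs → Tight Bs → Tight (rmBs d Bs)
  tight-rm d [] [] = []
  tight-rm d {B ∷ Bs} (b ∷ bs) (t ∷ ts) = (begin
      esym (double (half B)) (vals frac (rmB d B)) ≤⟨ esym-rm≤ (frac (width B)) (double (half B)) d (primes B) (All.map proj₁ un) ⟩
      esym (double (half B)) (vals frac B) ≤⟨ t ⟩
      halfPow (3 ℕ.+ length Bs) * ∏1- (vals frac B) ≤⟨ *ˡ (inv-nonneg (2 ℕ.^ (3 ℕ.+ length Bs))) (∏1-rm≥ (frac (width B)) d (primes B) un) ⟩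
      halfPow (3 ℕ.+ length Bs) * ∏1- (vals frac (rmB d B)) ≡⟨ cong (λ w → halfPow (3 ℕ.+ w) * ∏1- (vals frac (rmB d B))) (sym (length-map (rmB d) Bs)) ⟩
      halfPow (3 ℕ.+ length (rmBs d Bs)) * ∏1- (vals frac (rmB d B)) ∎) ∷ tight-rm d bs ts
    where
    un : All (λ p → Unit (frac (width B) p)) (primes B)
    un = Allₚ.map⁻ (All.head (unit-frac {B ∷ Bs} (b ∷ bs)))

  rm-none : ∀ d Bs → ¬ d ∈ allPrimes Bs → rmBs d Bs ≡ Bs
  rm-none d [] _ = refl
  rm-none d (B ∷ Bs) d∉ = cong₂ _∷_ (cong (block (width B) (half B)) (filter-all (off? d) (All.tabulate (λ {x} x∈ → off (λ e → d∉ (∈-++⁺ˡ (subst (_∈ primes B) e x∈)))))))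
     (rm-none d Bs (λ x → d∉ (∈-++⁺ʳ (primes B) x)))

  AllPairs-++ˡ : ∀ {R : ℕ → ℕ → Set} L {L′} → AllPairs R (L ++ L′) → AllPairs R L
  AllPairs-++ˡ [] _ = []
  AllPairs-++ˡ (p ∷ L) (a ∷ as) = Allₚ.++⁻ˡ L a ∷ AllPairs-++ˡ L as

  AllPairs-cross : ∀ {R : ℕ → ℕ → Set} {L L′} {d} → AllPairs R (L ++ L′) → d ∈ L → All (R d) L′
  AllPairs-cross {L = p ∷ L} (a ∷ as) (here refl) = Allₚ.++⁻ʳ L a
  AllPairs-cross {L = p ∷ L} (a ∷ as) (there h) = AllPairs-cross {L = L} as h

  2*[1-x]≥1 : ∀ {x} → 2ℚ * x ≤ 1ℚ → 1ℚ ≤ 2ℚ * (1ℚ - x)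
  2*[1-x]≥1 {x} h = begin
    2ℚ - 1ℚ ≤⟨ -mono (≤-refl {2ℚ}) h ⟩
    2ℚ - 2ℚ * x ≡⟨ solve 1 (λ x → con 2ℚ :- con 2ℚ :* x := con 2ℚ :* (con 1ℚ :- x)) refl x ⟩
    2ℚ * (1ℚ - x) ∎

  -- By distinctness `d` lies in exactly one block, once. Its factor there is at least one half,
  -- since `Big` puts twice the width at or below `d`.
  full-rm≤ : ∀ d Bs → Big Bs → AllPairs _≢_ (allPrimes Bs) → d ∈ allPrimes Bs → full frac (rmBs d Bs) ≤ 2ℚ * full frac Bs
  full-rm≤ d (B ∷ Bs) (b ∷ bs) ap d∈ with d ∈? primes B
  ... | yes d∈B = begin
    ∏1- (vals frac (rmB d B)) * full frac (rmBs d Bs) ≡⟨ cong (λ w → ∏1- (vals frac (rmB d B)) * full frac w) (rm-none d Bs (λ x → All.lookup (AllPairs-cross {L = primes B} ap d∈B) x refl)) ⟩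
    ∏1- (vals frac (rmB d B)) * full frac Bs ≤⟨ *ʳ (full≥0 frac (unit-frac bs)) (∏1-rm≤ (frac (width B)) 2ℚ d (primes B) (AllPairs-++ˡ (primes B) ap) (All.map proj₂ un) d∈B
        (All.map (λ {p} (h , h′) → 2*[1-x]≥1 {frac (width B) p} (2frac≤1 (width B) p h h′)) b)) ⟩
    2ℚ * ∏1- (vals frac B) * full frac Bs ≡⟨ *-assoc 2ℚ (∏1- (vals frac B)) (full frac Bs) ⟩
    2ℚ * (∏1- (vals frac B) * full frac Bs) ∎
    where
    un : All (λ p → Unit (frac (width B) p)) (primes B)
    un = Allₚ.map⁻ (All.head (unit-frac {B ∷ Bs} (b ∷ bs)))
  ... | no d∉B = begin
    ∏1- (vals frac (rmB d B)) * full frac (rmBs d Bs) ≡⟨ cong (λ w → ∏1- (map (frac (width B)) w) * full frac (rmBs d Bs)) (filter-all (off? d) (All.tabulate (λ {x} x∈ → off (λ e → d∉B (subst (_∈ primes B) e x∈))))) ⟩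
    ∏1- (vals frac B) * full frac (rmBs d Bs) ≤⟨ *ˡ (∏1-≥0 (All.map proj₂ (All.head (unit-frac {B ∷ Bs} (b ∷ bs))))) (full-rm≤ d Bs bs (drop₁ (primes B) ap) (tl (∈-++⁻ (primes B) d∈))) ⟩
    ∏1- (vals frac B) * (2ℚ * full frac Bs) ≡⟨ solve 2 (λ a c → a :* (con 2ℚ :* c) := con 2ℚ :* (a :* c)) refl (∏1- (vals frac B)) (full frac Bs) ⟩
    2ℚ * (∏1- (vals frac B) * full frac Bs) ∎
    where
    tl : (d ∈ primes B) ⊎ (d ∈ allPrimes Bs) → d ∈ allPrimes Bs
    tl (inj₁ x) = ⊥-elim (d∉B x)
    tl (inj₂ x) = x

  -- Sums over multisets of primes

  Multi : Set
  Multi = List ℕ → ℚ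

  -- Runs over the multisets of size t from L, each once: p is either dropped for good or used again.
  msum : Multi → ℕ → List ℕ → List ℕ → ℚ
  msum F zero L ds = F ds
  msum F (suc t) [] ds = 0ℚ
  msum F (suc t) (p ∷ L) ds = msum F (suc t) L ds + msum F t (p ∷ L) (p ∷ ds)

  msum-mono : ∀ {F G} {P : ℕ → Set} → (∀ ds → All P ds → F ds ≤ G ds) → ∀ t {L ds} → All P L → All P ds → msum F t L ds ≤ msum G t L ds
  msum-mono h zero a b = h _ b
  msum-mono h (suc t) [] b = ≤-refl
  msum-mono h (suc t) {p ∷ L} (x ∷ a) b = +-mono-≤ (msum-mono h (suc t) a b) (msum-mono h t (x ∷ a) (x ∷ b))

  msum≥0 : ∀ {F} → (∀ ds → 0ℚ ≤ F ds) → ∀ t L ds → 0ℚ ≤ msum F t L ds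
  msum≥0 h zero L ds = h ds
  msum≥0 h (suc t) [] ds = ≤-refl
  msum≥0 h (suc t) (p ∷ L) ds = +-≥0 (msum≥0 h (suc t) L ds) (msum≥0 h t (p ∷ L) (p ∷ ds))

  Σ-0 : ∀ n → Σ< n (λ _ → 0ℚ) ≡ 0ℚ
  Σ-0 zero = refl
  Σ-0 (suc n) = trans (+-identityʳ _) (Σ-0 n)

  msum-Σ : ∀ X (w : ℕ → ℚ) (F : ℕ → Multi) t L ds →
    Σ< X (λ m → w m * msum (F m) t L ds) ≡ msum (λ es → Σ< X (λ m → w m * F m es)) t L ds
  msum-Σ X w F zero L ds = refl
  msum-Σ X w F (suc t) [] ds = trans (Σ-cong X (λ m → *-zeroʳ (w m))) (Σ-0 X)
  msum-Σ X w F (suc t) (p ∷ L) ds = trans (Σ-cong X (λ m → *-distribˡ-+ (w m) _ _)) (trans (Σ-+ X _ _)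
    (cong₂ _+_ (msum-Σ X w F (suc t) L ds) (msum-Σ X w F t (p ∷ L) (p ∷ ds))))

  -- The complete homogeneous symmetric polynomial of degree `t` in the values of `f`, by the same
  -- recursion as `msum`.
  hsym : (ℕ → ℚ) → ℕ → List ℕ → ℚ
  hsym f zero L = 1ℚ
  hsym f (suc t) [] = 0ℚ
  hsym f (suc t) (p ∷ L) = hsym f (suc t) L + f p * hsym f t (p ∷ L)

  ∏f : (ℕ → ℚ) → List ℕ → ℚ
  ∏f f [] = 1ℚ
  ∏f f (p ∷ ds) = f p * ∏f f ds

  msum-mult : ∀ f c t L ds → msum (λ ds → c * ∏f f ds) t L ds ≡ c * ∏f f ds * hsym f t L
  msum-mult f c zero L ds = sym (*-identityʳ _)
  msum-mult f c (suc t) [] ds = sym (*-zeroʳ (c * ∏f f ds))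
  msum-mult f c (suc t) (p ∷ L) ds = trans (cong₂ _+_ (msum-mult f c (suc t) L ds) (msum-mult f c t (p ∷ L) (p ∷ ds)))
    (solve 5 (λ c d h g p → c :* d :* h :+ c :* (p :* d) :* g := c :* d :* (h :+ p :* g)) refl c (∏f f ds) (hsym f (suc t) L) (hsym f t (p ∷ L)) (f p))

  pow : ℚ → ℕ → ℚ
  pow x zero = 1ℚ
  pow x (suc n) = x * pow x n

  -- The generating function of `hsym` is the product of the `1 / (1 - q * f p)`, and one term is at
  -- most the whole. Without infinite series: the recursion makes the left side a convex
  -- combination, with weights `1 - q * f p` and `q * f p`, of two quantities at most 1.
  hsym-rankin : ∀ f q → 0ℚ ≤ q → ∀ t L → All (λ p → Unit (q * f p)) L → pow q t * hsym f t L * ∏1- (map (λ p → q * f p) L) ≤ 1ℚ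
  hsym-rankin f q q≥0 zero L us = ≤-trans (≤-reflexive (*-identityˡ (∏1- (map (λ p → q * f p) L)))) (∏1-≤1 (Allₚ.map⁺ us))
  hsym-rankin f q q≥0 (suc t) [] us = ≤-trans (≤-reflexive (trans (*-identityʳ _) (*-zeroʳ (pow q (suc t))))) 0≤1
  hsym-rankin f q q≥0 (suc t) (p ∷ L) ((u , u′) ∷ us) = begin
    q * Q * (h₁ + f p * h₂) * ((1ℚ - q * f p) * G) ≡⟨ solve 6 (λ q Q f h₁ h₂ G → q :* Q :* (h₁ :+ f :* h₂) :* ((con 1ℚ :- q :* f) :* G) := (con 1ℚ :- q :* f) :* (q :* Q :* h₁ :* G) :+ (q :* f) :* (Q :* h₂ :* ((con 1ℚ :- q :* f) :* G))) refl q Q (f p) h₁ h₂ G ⟩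
    (1ℚ - q * f p) * (q * Q * h₁ * G) + (q * f p) * (Q * h₂ * ((1ℚ - q * f p) * G)) ≤⟨ +-mono-≤ (*ˡ (1-≥0 u′) (hsym-rankin f q q≥0 (suc t) L us)) (*ˡ u (hsym-rankin f q q≥0 t (p ∷ L) ((u , u′) ∷ us))) ⟩
    (1ℚ - q * f p) * 1ℚ + (q * f p) * 1ℚ ≡⟨ solve 1 (λ x → (con 1ℚ :- x) :* con 1ℚ :+ x :* con 1ℚ := con 1ℚ) refl (q * f p) ⟩
    1ℚ ∎
    where
    Q = pow q t
    h₁ = hsym f (suc t) L
    h₂ = hsym f t (p ∷ L)
    G = ∏1- (map (λ p → q * f p) L)

  split-off : ∀ {p L t} es → length es ≡ suc t → All (_∈ p ∷ L) es →
    (∃ λ es′ → (length es′ ≡ t) × All (_∈ p ∷ L) es′ × (product es ≡ p ℕ.* product es′)) ⊎ All (_∈ L) es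
  split-off {p} {L} {t} es len a with p ∈? es
  ... | yes p∈ = inj₁ (xs ++ ys , len′ , Allₚ.++⁺ (Allₚ.++⁻ˡ xs a′) (All.tail (Allₚ.++⁻ʳ xs a′)) , prod′)
    where
    sp = ∈-∃++ p∈
    xs = proj₁ sp
    ys = proj₁ (proj₂ sp)
    eq : es ≡ xs ++ p ∷ ys
    eq = proj₂ (proj₂ sp)
    len′ : length (xs ++ ys) ≡ t
    len′ = ℕₚ.suc-injective (trans (trans (cong suc (length-++ xs)) (sym (trans (length-++ xs {p ∷ ys}) (ℕₚ.+-suc (length xs) (length ys))))) (trans (cong length (sym eq)) len))
    a′ : All (_∈ p ∷ L) (xs ++ p ∷ ys)
    a′ = subst (All _) eq a
    prod′ : product es ≡ p ℕ.* product (xs ++ ys)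
    prod′ = trans (cong product eq) (trans (product-++ xs (p ∷ ys))
       (trans (l (product xs) p (product ys)) (cong (p ℕ.*_) (sym (product-++ xs ys)))))
      where
      l : ∀ a p b → a ℕ.* (p ℕ.* b) ≡ p ℕ.* (a ℕ.* b)
      l = solve-∀
  ... | no p∉ = inj₂ (go es a p∉)
    where
    go : ∀ es → All (_∈ p ∷ L) es → ¬ p ∈ es → All (_∈ L) es
    go [] [] _ = []
    go (e ∷ es) (here refl ∷ a) ne = ⊥-elim (ne (here refl))
    go (e ∷ es) (there x ∷ a) ne = x ∷ go es a (λ y → ne (there y))

  ≤+ʳ : ∀ {a b} → 0ℚ ≤ a → b ≤ a + b
  ≤+ʳ {a} {b} h = ≤-trans (≤+ˡ h) (≤-reflexive (+-comm b a))

  -- Up to order `es` is one of the multisets that `msum` visits, and `τ` sees only the product; all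
  -- other terms are nonnegative.
  msum≥1 : ∀ (τ : ℕ → ℚ) → (∀ d → 0ℚ ≤ τ d) → ∀ t L es ds → length es ≡ t → All (_∈ L) es →
    1ℚ ≤ τ (product es ℕ.* product ds) → 1ℚ ≤ msum (λ ds → τ (product ds)) t L ds
  msum≥1 τ τ≥0 zero L [] ds _ _ h = subst (λ w → 1ℚ ≤ τ w) (ℕₚ.+-identityʳ _) h
  msum≥1 τ τ≥0 (suc t) [] (e ∷ es) ds _ (() ∷ _) h
  msum≥1 τ τ≥0 (suc t) (p ∷ L) es ds len a h = [ (λ (es′ , len′ , a′ , eq) →
      ≤-trans (msum≥1 τ τ≥0 t (p ∷ L) es′ (p ∷ ds) len′ a′ (subst (λ w → 1ℚ ≤ τ w) (trans (cong (ℕ._* product ds) eq) (l p (product es′) (product ds))) h))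
        (≤+ʳ (msum≥0 (λ ds → τ≥0 (product ds)) (suc t) L ds))) ,
    (λ a′ → ≤-trans (msum≥1 τ τ≥0 (suc t) L es ds len a′ h) (≤+ˡ (msum≥0 (λ ds → τ≥0 (product ds)) t (p ∷ L) (p ∷ ds)))) ]′ (split-off es len a)
    where
    l : ∀ p b d → p ℕ.* b ℕ.* d ≡ b ℕ.* (p ℕ.* d)
    l = solve-∀

  removeAll : List ℕ → List Block → List Block
  removeAll [] Bs = Bs
  removeAll (d ∷ ds) Bs = rmBs d (removeAll ds Bs)

  inv-* : ∀ {a b} → 0 ℕ.< a → 0 ℕ.< b → inv (a ℕ.* b) ≡ inv a * inv b
  inv-* {a} {b} a>0 b>0 = begin-equality
    inv (a ℕ.* b) ≡⟨ solve 1 (λ x → x := x :* (con 1ℚ :* con 1ℚ)) refl (inv (a ℕ.* b)) ⟩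
    inv (a ℕ.* b) * (1ℚ * 1ℚ) ≡⟨ cong (inv (a ℕ.* b) *_) (sym (cong₂ _*_ (ι*inv a>0) (ι*inv b>0))) ⟩
    inv (a ℕ.* b) * (ι a * inv a * (ι b * inv b)) ≡⟨ solve 5 (λ x i j k l → x :* (i :* j :* (k :* l)) := (i :* k :* x) :* (j :* l)) refl (inv (a ℕ.* b)) (ι a) (inv a) (ι b) (inv b) ⟩
    (ι a * ι b * inv (a ℕ.* b)) * (inv a * inv b) ≡⟨ cong (_* (inv a * inv b)) (trans (cong (_* inv (a ℕ.* b)) (sym (ι-* a b))) (ι*inv (ℕₚ.*-mono-< a>0 b>0))) ⟩
    1ℚ * (inv a * inv b) ≡⟨ *-identityˡ _ ⟩
    inv a * inv b ∎

  5ℚ : ℚ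
  5ℚ = 4ℚ + 1ℚ

  product>0 : ∀ {ds} → All Prime ds → 0 ℕ.< product ds
  product>0 [] = ℕ.s≤s ℕ.z≤n
  product>0 (p ∷ ps) = ℕₚ.*-mono-< (prime>0 p) (product>0 ps)

  -- Sifted numbers with a prescribed divisor

  module Sifted (M : ℕ) (Bs : List Block) (ad : Admissible M Bs) (bg : Big Bs) (tg : Tight Bs)
    (φ : ℕ → ℚ) (φ≥1 : ∀ p → 1ℚ ≤ φ p) (φ≥2 : All (λ p → 2ℚ ≤ φ p) (allPrimes Bs))
    (X D : ℕ) (D≤X : D ℕ.≤ X) (err≤ : ι (err Bs) * ι D ≤ full frac Bs * ι X) where

    V : ℚ
    V = full frac Bs

    V≥0 : 0ℚ ≤ V
    V≥0 = full≥0 frac (unit-frac bg)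

    -- What survives deleting the primes of `ds`: all hypotheses of the sieve, at the price of a
    -- factor `φ d` in the density for each `d`, while the sifted indicator can only grow.
    record Removed (ds : List ℕ) : Set where
      field
        adR : Admissible M (removeAll ds Bs)
        bgR : Big (removeAll ds Bs)
        tgR : Tight (removeAll ds Bs)
        φR  : All (λ p → 2ℚ ≤ φ p) (allPrimes (removeAll ds Bs))
        ndR : All (λ p → All (p ≢_) ds) (allPrimes (removeAll ds Bs))
        errR : err (removeAll ds Bs) ℕ.≤ err Bs
        VR  : full frac (removeAll ds Bs) ≤ ∏f φ ds * V
        evR : ∀ n → sift M Bs n ≤ sift M (removeAll ds Bs) n
    open Removed

    zipAll : ∀ {P Q R : ℕ → Set} {L} → (∀ {x} → P x → Q x → R x) → All P L → All Q L → All R L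
    zipAll f [] [] = []
    zipAll f (a ∷ as) (b ∷ bs) = f a b ∷ zipAll f as bs

    ∏φ≥1 : ∀ ds → 1ℚ ≤ ∏f φ ds
    ∏φ≥1 [] = ≤-refl
    ∏φ≥1 (d ∷ ds) = ≤-trans (≤-reflexive (sym (*-identityˡ 1ℚ))) (*-mono 0≤1 (≤-trans 0≤1 (∏φ≥1 ds)) (φ≥1 d) (∏φ≥1 ds))

    removed : ∀ ds → Removed ds
    removed [] = record { adR = ad ; bgR = bg ; tgR = tg ; φR = φ≥2 ; ndR = All.universal (λ _ → []) _ ; errR = ℕₚ.≤-refl
      ; VR = ≤-reflexive (sym (*-identityˡ V)) ; evR = λ n → ≤-refl }
    removed (d ∷ ds) = record
      { adR = adm-rm d {Cs} (adR r) ; bgR = big-rm d {Cs} (bgR r) ; tgR = tight-rm d {Cs} (bgR r) (tgR r) ; φR = all-rm d Cs (φR r)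
      ; ndR = zipAll (λ a b → a ∷ b) (rm-≢ d Cs) (all-rm d Cs (ndR r))
      ; errR = ℕₚ.≤-trans (err-rm d Cs) (errR r)
      ; VR = vr
      ; evR = λ n → ≤-trans (evR r n) (full-rm≥ (λ K p → ev M K p n) d Cs (All.map (λ a → Allₚ.map⁻ a) (unit-ev M n (bgR r)))) }
      where
      r = removed ds
      Cs = removeAll ds Bs
      W = full frac Cs
      W≥0 : 0ℚ ≤ W
      W≥0 = full≥0 frac (unit-frac (bgR r))
      step : full frac (rmBs d Cs) ≤ φ d * W
      step with d ∈? allPrimes Cs
      ... | yes d∈ = ≤-trans (full-rm≤ d Cs (bgR r) (distinct (adR r)) d∈) (*ʳ W≥0 (All.lookup (φR r) d∈))
      ... | no d∉ = ≤-trans (≤-reflexive (trans (cong (full frac) (rm-none d Cs d∉)) (sym (*-identityˡ W)))) (*ʳ W≥0 (φ≥1 d))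
      vr : full frac (rmBs d Cs) ≤ φ d * ∏f φ ds * V
      vr = begin
        full frac (rmBs d Cs) ≤⟨ step ⟩
        φ d * W ≤⟨ *ˡ (≤-trans 0≤1 (φ≥1 d)) (VR r) ⟩
        φ d * (∏f φ ds * V) ≡⟨ sym (*-assoc (φ d) (∏f φ ds) V) ⟩
        φ d * ∏f φ ds * V ∎

    f : ℕ → ℚ
    f p = φ p * inv p

    ∏f≡ : ∀ {ds} → All Prime ds → ∏f φ ds * inv (product ds) ≡ ∏f f ds
    ∏f≡ [] = trans (cong (_* inv 1) (sym ι1)) (ι*inv {1} (ℕ.s≤s ℕ.z≤n))
    ∏f≡ {d ∷ ds} (p ∷ ps) = begin-equality
      φ d * ∏f φ ds * inv (d ℕ.* product ds) ≡⟨ cong (φ d * ∏f φ ds *_) (inv-* (prime>0 p) (product>0 ps)) ⟩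
      φ d * ∏f φ ds * (inv d * inv (product ds)) ≡⟨ solve 4 (λ a b c d → a :* b :* (c :* d) := a :* c :* (b :* d)) refl (φ d) (∏f φ ds) (inv d) (inv (product ds)) ⟩
      φ d * inv d * (∏f φ ds * inv (product ds)) ≡⟨ cong (φ d * inv d *_) (∏f≡ ps) ⟩
      φ d * inv d * ∏f f ds ∎

    f≥0 : ∀ p → 0ℚ ≤ f p
    f≥0 p = *-≥0 (≤-trans 0≤1 (φ≥1 p)) (inv-nonneg p)

    ∏f≥0 : ∀ ds → 0ℚ ≤ ∏f f ds
    ∏f≥0 [] = 0≤1
    ∏f≥0 (d ∷ ds) = *-≥0 (f≥0 d) (∏f≥0 ds)

    prime∤product : ∀ {p ds} → Prime p → All Prime ds → All (p ≢_) ds → ¬ p ∣ product ds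
    prime∤product pr [] [] h = contradiction (∣1⇒≡1 h) (λ { refl → ¬prime[1] pr })
    prime∤product {p} {d ∷ ds} pr (q ∷ qs) (ne ∷ nes) h with euclidsLemma d (product ds) pr h
    ... | inj₁ x = prime∤prime pr q ne x
    ... | inj₂ x = prime∤product pr qs nes x

    module _ (c e : ℕ) (cop : Coprime c e) where

      -- If `product ds` shares a factor with `c`, coprimality of `c` and `e` leaves no terms.
      -- Otherwise one residue class is left, and `5 = 2 * 2 + 1`: the upper bound sieve loses 2,
      -- the class has at most `2 * X / d` members, and the error is at most one more main term.
      divisible-sum : ∀ ds → All Prime ds → product ds ℕ.≤ D →
        Σ< X (λ m → χ (product ds ∣? c ℕ.* suc m ℕ.+ e) * sift M Bs (suc m)) ≤ 5ℚ * V * ι X * ∏f f ds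
      divisible-sum ds prs d≤D with coprime? (product ds) c
      ... | no ¬cop = ≤-trans (≤-reflexive (trans (Σ-cong X z) (Σ-0 X))) (*-≥0 (*-≥0 (*-≥0 (nonNegative⁻¹ 5ℚ) V≥0) (ι≥0 X)) (∏f≥0 ds))
        where
        z : ∀ m → χ (product ds ∣? c ℕ.* suc m ℕ.+ e) * sift M Bs (suc m) ≡ 0ℚ
        z m with product ds ∣? c ℕ.* suc m ℕ.+ e
        ... | no _ = *-zeroˡ (sift M Bs (suc m))
        ... | yes h = ⊥-elim (¬cop (λ { (g∣d , g∣c) → cop (g∣c , ∣m+n∣m⇒∣n (∣-trans g∣d h) (∣-trans g∣c (m∣m*n (suc m)))) }))
      ... | yes dc = begin
        Σ< X (λ m → χ (P? m) * sift M Bs (suc m)) ≡⟨ proj₁ (proj₂ aps) ⟩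
        Σ< Y (λ t → sift M Bs (suc (b ℕ.+ d ℕ.* t))) ≤⟨ Σ-mono Y (λ m _ → evR r _) ⟩
        Σ< Y (λ t → sift M Cs (suc b ℕ.+ d ℕ.* t)) ≤⟨ sieve-upper (adR r) (bgR r) (tgR r) (suc b) d Y nd ⟩
        2ℚ * W * ι Y + ι (err Cs) ≤⟨ +-mono-≤ (*-mono (*-≥0 2≥0 W≥0) (*-≥0 (*-≥0 2≥0 (ι≥0 X)) (inv-nonneg d)) (*ˡ 2≥0 (VR r)) Y≤) errs ⟩
        2ℚ * (Φ * V) * (2ℚ * ι X * inv d) + Φ * (V * ι X * inv d) ≡⟨ solve 4 (λ F V X i → con 2ℚ :* (F :* V) :* (con 2ℚ :* X :* i) :+ F :* (V :* X :* i) := con 5ℚ :* V :* X :* (F :* i)) refl Φ V (ι X) (inv d) ⟩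
        5ℚ * V * ι X * (Φ * inv d) ≡⟨ cong (5ℚ * V * ι X *_) (∏f≡ prs) ⟩
        5ℚ * V * ι X * ∏f f ds ∎
        where
        d = product ds
        d>0 = product>0 prs
        r = removed ds
        Cs = removeAll ds Bs
        W = full frac Cs
        Φ = ∏f φ ds
        W≥0 : 0ℚ ≤ W
        W≥0 = full≥0 frac (unit-frac (bgR r))
        P? : ∀ m → Dec (d ∣ c ℕ.* suc m ℕ.+ e)
        P? m = d ∣? c ℕ.* suc m ℕ.+ e
        re : ∀ m → c ℕ.* suc m ℕ.+ e ≡ c ℕ.* m ℕ.+ (c ℕ.+ e)
        re m = l c m e where
          l : ∀ c m e → c ℕ.* suc m ℕ.+ e ≡ c ℕ.* m ℕ.+ (c ℕ.+ e)
          l = solve-∀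
        sol = lin-solve c (c ℕ.+ e) d d>0 dc
        b = proj₁ sol
        b<d = proj₁ (proj₂ sol)
        hb = proj₂ (proj₂ sol)
        aps = ap-sum P? b d b<d (λ t → subst (d ∣_) (sym (re (b ℕ.+ d ℕ.* t))) (lin-shift c (c ℕ.+ e) d b t hb))
                (λ m h → lin-unique c (c ℕ.+ e) d b m dc b<d hb (subst (d ∣_) (re m) h)) (λ m → sift M Bs (suc m)) X
        Y = proj₁ aps
        dY≤ : d ℕ.* Y ℕ.≤ 2 ℕ.* X
        -- The class may overshoot `X` by less than `d`, and `d ≤ D ≤ X`.
        dY≤ = ℕₚ.≤-trans (ℕₚ.m≤n+m (d ℕ.* Y) b) (ℕₚ.≤-trans (ℕₚ.<⇒≤ (proj₁ (proj₂ (proj₂ aps)))) (ℕₚ.≤-trans (ℕₚ.+-monoʳ-≤ X (ℕₚ.≤-trans d≤D D≤X)) (ℕₚ.≤-reflexive (cong (X ℕ.+_) (sym (ℕₚ.+-identityʳ X))))))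
        Y≤ : ι Y ≤ 2ℚ * ι X * inv d
        Y≤ = cancelˡ d d>0 (begin
          ι d * ι Y ≡⟨ sym (ι-* d Y) ⟩
          ι (d ℕ.* Y) ≤⟨ ι-mono dY≤ ⟩
          ι (2 ℕ.* X) ≡⟨ trans (ι-* 2 X) (cong (_* ι X) ι2) ⟩
          2ℚ * ι X ≡⟨ sym (*-identityʳ _) ⟩
          2ℚ * ι X * 1ℚ ≡⟨ cong (2ℚ * ι X *_) (sym (ι*inv d>0)) ⟩
          2ℚ * ι X * (ι d * inv d) ≡⟨ solve 3 (λ a b c → a :* (b :* c) := b :* (a :* c)) refl (2ℚ * ι X) (ι d) (inv d) ⟩
          ι d * (2ℚ * ι X * inv d) ∎)
        nd : All (λ p → ¬ p ∣ d) (allPrimes Cs)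
        nd = zipAll (λ pr ne → prime∤product pr prs ne) (isPrime (adR r)) (ndR r)
        errs : ι (err Cs) ≤ Φ * (V * ι X * inv d)
        errs = begin
          ι (err Cs) ≤⟨ ι-mono (errR r) ⟩
          ι (err Bs) ≤⟨ cancelˡ d d>0 (begin
              ι d * ι (err Bs) ≤⟨ *ʳ (ι≥0 (err Bs)) (ι-mono d≤D) ⟩
              ι D * ι (err Bs) ≡⟨ *-comm (ι D) (ι (err Bs)) ⟩
              ι (err Bs) * ι D ≤⟨ err≤ ⟩
              V * ι X ≡⟨ sym (*-identityʳ _) ⟩
              V * ι X * 1ℚ ≡⟨ cong (V * ι X *_) (sym (ι*inv d>0)) ⟩
              V * ι X * (ι d * inv d) ≡⟨ solve 3 (λ a b c → a :* (b :* c) := b :* (a :* c)) refl (V * ι X) (ι d) (inv d) ⟩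
              ι d * (V * ι X * inv d) ∎) ⟩
          V * ι X * inv d ≡⟨ sym (*-identityˡ _) ⟩
          1ℚ * (V * ι X * inv d) ≤⟨ *ʳ (*-≥0 (*-≥0 V≥0 (ι≥0 X)) (inv-nonneg d)) (∏φ≥1 ds) ⟩
          Φ * (V * ι X * inv d) ∎

      -- The cutoff at `D` erases the multisets whose product is too large for `divisible-sum`, so
      -- `msum` can run over all multisets of a given size.
      τ : ℕ → ℕ → ℚ
      τ m d = χ (d ℕₚ.≤? D) * χ (d ∣? c ℕ.* suc m ℕ.+ e)

      τ≥0 : ∀ m d → 0ℚ ≤ τ m d
      τ≥0 m d = *-≥0 (χ≥0 (d ℕₚ.≤? D)) (χ≥0 (d ∣? c ℕ.* suc m ℕ.+ e))

      rough-sum : ∀ t L → All Prime L →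
        Σ< X (λ m → sift M Bs (suc m) * msum (λ ds → τ m (product ds)) t L []) ≤ 5ℚ * V * ι X * hsym f t L
      rough-sum t L prL = begin
        Σ< X (λ m → sift M Bs (suc m) * msum (λ ds → τ m (product ds)) t L []) ≡⟨ msum-Σ X (λ m → sift M Bs (suc m)) (λ m ds → τ m (product ds)) t L [] ⟩
        msum (λ ds → Σ< X (λ m → sift M Bs (suc m) * τ m (product ds))) t L [] ≤⟨ msum-mono pt t prL [] ⟩
        msum (λ ds → 5ℚ * V * ι X * ∏f f ds) t L [] ≡⟨ msum-mult f (5ℚ * V * ι X) t L [] ⟩
        5ℚ * V * ι X * 1ℚ * hsym f t L ≡⟨ cong (_* hsym f t L) (*-identityʳ (5ℚ * V * ι X)) ⟩
        5ℚ * V * ι X * hsym f t L ∎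
        where
        pt : ∀ ds → All Prime ds → Σ< X (λ m → sift M Bs (suc m) * τ m (product ds)) ≤ 5ℚ * V * ι X * ∏f f ds
        pt ds prs with product ds ℕₚ.≤? D
        ... | yes d≤D = ≤-trans (≤-reflexive (Σ-cong X (λ m → trans (cong (sift M Bs (suc m) *_) (*-identityˡ (χ (product ds ∣? c ℕ.* suc m ℕ.+ e)))) (*-comm (sift M Bs (suc m)) (χ (product ds ∣? c ℕ.* suc m ℕ.+ e)))))) (divisible-sum ds prs d≤D)
        ... | no _ = ≤-trans (≤-reflexive (trans (Σ-cong X (λ m → trans (cong (sift M Bs (suc m) *_) (*-zeroˡ (χ (product ds ∣? c ℕ.* suc m ℕ.+ e)))) (*-zeroʳ (sift M Bs (suc m))))) (Σ-0 X)))
             (*-≥0 (*-≥0 (*-≥0 (nonNegative⁻¹ 5ℚ) V≥0) (ι≥0 X)) (∏f≥0 ds))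

  -- Lower bounds for Mertens products

  θ : List ℕ → ℚ
  θ L = ∏1- (map inv L)

  ∏1-++ : ∀ xs ys → ∏1- (xs ++ ys) ≡ ∏1- xs * ∏1- ys
  ∏1-++ [] ys = sym (*-identityˡ _)
  ∏1-++ (x ∷ xs) ys = trans (cong ((1ℚ - x) *_) (∏1-++ xs ys)) (sym (*-assoc (1ℚ - x) _ _))

  θ-++ : ∀ L L′ → θ (L ++ L′) ≡ θ L * θ L′
  θ-++ L L′ = trans (cong ∏1- (map-++ inv L L′)) (∏1-++ (map inv L) (map inv L′))

  inv-unit : ∀ L → All Unit (map inv L)
  inv-unit L = Allₚ.map⁺ (All.universal (λ p → inv-nonneg p , inv≤1 p) L)

  θ≥0 : ∀ L → 0ℚ ≤ θ L
  θ≥0 L = ∏1-≥0 (All.map proj₂ (inv-unit L))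

  inv-antimono : ∀ {a b} → 0 ℕ.< a → a ℕ.≤ b → inv b ≤ inv a
  inv-antimono {a} {b} a>0 h = cancelˡ a a>0 (begin
    ι a * inv b ≤⟨ *ʳ (inv-nonneg b) (ι-mono h) ⟩
    ι b * inv b ≡⟨ trans (ι*inv (ℕₚ.<-≤-trans a>0 h)) (sym (ι*inv a>0)) ⟩
    ι a * inv a ∎)

  ∏1-≥1-len : ∀ c xs → All Unit xs → All (_≤ c) xs → 1ℚ - ι (length xs) * c ≤ ∏1- xs
  ∏1-≥1-len c [] [] [] = ≤-reflexive (trans (cong (λ w → 1ℚ - w * c) ι0) (solve 1 (λ c → con 1ℚ :- con 0ℚ :* c := con 1ℚ) refl c))
  ∏1-≥1-len c (x ∷ xs) (u ∷ us) (h ∷ hs) = begin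
    1ℚ - ι (suc (length xs)) * c ≡⟨ cong (λ w → 1ℚ - w * c) (trans (ι-+ 1 (length xs)) (cong (_+ ι (length xs)) ι1)) ⟩
    1ℚ - (1ℚ + ι (length xs)) * c ≡⟨ solve 2 (λ l c → con 1ℚ :- (con 1ℚ :+ l) :* c := (con 1ℚ :- l :* c) :- c :* con 1ℚ) refl (ι (length xs)) c ⟩
    (1ℚ - ι (length xs) * c) - c * 1ℚ ≤⟨ -mono (∏1-≥1-len c xs us hs) (*-mono (proj₁ u) 0≤1 h (∏1-≤1 us)) ⟩
    ∏1- xs - x * ∏1- xs ≡⟨ solve 2 (λ x v → v :- x :* v := (con 1ℚ :- x) :* v) refl x (∏1- xs) ⟩
    (1ℚ - x) * ∏1- xs ∎

  -- Chebyshev gives θ ≥ 1 - 2/(2 + i); the fraction i/(2 + i) makes the product telescope.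
  dyadic : ∀ i → ι i ≤ ι (2 ℕ.+ i) * θ (primesAfter (2 ℕ.^ (2 ℕ.+ i)) (2 ℕ.^ (2 ℕ.+ i)))
  dyadic i = begin
    ι i ≡⟨ solve 1 (λ i → i := (con 2ℚ :+ i) :- con 2ℚ :* con 1ℚ) refl (ι i) ⟩
    (2ℚ + ι i) - 2ℚ * 1ℚ ≡⟨ cong₂ (λ a b → a - 2ℚ * b) (trans (cong (_+ ι i) (sym ι2)) (sym (ι-+ 2 i))) (sym (ι*inv N>0)) ⟩
    ι j - 2ℚ * (ι N * inv N) ≡⟨ cong (λ w → ι j - w) (trans (sym (*-assoc 2ℚ (ι N) (inv N))) (cong (_* inv N) (trans (cong (_* ι N) (sym ι2)) (sym (ι-* 2 N))))) ⟩
    ι j - ι (2 ℕ.* N) * inv N ≤⟨ -mono (≤-refl {ι j}) (*ʳ (inv-nonneg N) (ι-mono (chebyshev j))) ⟩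
    ι j - ι (j ℕ.* length L) * inv N ≡⟨ cong (λ w → ι j - w * inv N) (ι-* j (length L)) ⟩
    ι j - ι j * ι (length L) * inv N ≡⟨ solve 3 (λ j l n → j :- j :* l :* n := j :* (con 1ℚ :- l :* n)) refl (ι j) (ι (length L)) (inv N) ⟩
    ι j * (1ℚ - ι (length L) * inv N) ≡⟨ cong (λ w → ι j * (1ℚ - ι w * inv N)) (sym (length-map inv L)) ⟩
    ι j * (1ℚ - ι (length (map inv L)) * inv N) ≤⟨ *ˡ (ι≥0 j) (∏1-≥1-len (inv N) (map inv L) (inv-unit L) (Allₚ.map⁺ (All.map (λ h → inv-antimono N>0 (ℕₚ.<⇒≤ h)) (after-> N N)))) ⟩
    ι j * θ L ∎
    where
    j = 2 ℕ.+ i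
    N = 2 ℕ.^ j
    N>0 = ℕₚ.m^n>0 2 j
    L = primesAfter N N

  2^-mono : ∀ {a b} → a ℕ.≤ b → 2 ℕ.^ a ℕ.≤ 2 ℕ.^ b
  2^-mono = ℕₚ.^-monoʳ-≤ 2

  range-dyadic : ∀ j → range (2 ℕ.^ j) (2 ℕ.^ suc j) ≡ primesAfter (2 ℕ.^ j) (2 ℕ.^ j)
  range-dyadic j = cong (primesAfter (2 ℕ.^ j)) (trans (ℕₚ.m+n∸m≡n (2 ℕ.^ j) (2 ℕ.^ j ℕ.+ 0)) (ℕₚ.+-identityʳ _))

  telescope : ∀ a n → ι (suc a ℕ.* a) ≤ ι (suc (a ℕ.+ n) ℕ.* (a ℕ.+ n)) * θ (range (2 ℕ.^ (2 ℕ.+ a)) (2 ℕ.^ (2 ℕ.+ (a ℕ.+ n))))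
  telescope a zero = begin
    ι (suc a ℕ.* a) ≡⟨ sym (*-identityʳ _) ⟩
    ι (suc a ℕ.* a) * θ [] ≡⟨ cong₂ (λ w L → ι (suc w ℕ.* w) * θ L) (sym (ℕₚ.+-identityʳ a)) (sym (trans (cong (λ w → range (2 ℕ.^ (2 ℕ.+ a)) (2 ℕ.^ (2 ℕ.+ w))) (ℕₚ.+-identityʳ a)) (cong (primesAfter (2 ℕ.^ (2 ℕ.+ a))) (ℕₚ.n∸n≡0 (2 ℕ.^ (2 ℕ.+ a)))))) ⟩
    ι (suc (a ℕ.+ 0) ℕ.* (a ℕ.+ 0)) * θ (range (2 ℕ.^ (2 ℕ.+ a)) (2 ℕ.^ (2 ℕ.+ (a ℕ.+ 0)))) ∎
  telescope a (suc n) = begin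
    ι (suc a ℕ.* a) ≤⟨ telescope a n ⟩
    ι (suc b ℕ.* b) * θ R₁ ≡⟨ cong (_* θ R₁) (ι-* (suc b) b) ⟩
    ι (suc b) * ι b * θ R₁ ≤⟨ *ʳ (θ≥0 R₁) (*ˡ (ι≥0 (suc b)) (dyadic b)) ⟩
    ι (suc b) * (ι (2 ℕ.+ b) * θ R₂′) * θ R₁ ≡⟨ solve 4 (λ a b c d → a :* (b :* c) :* d := b :* a :* (d :* c)) refl (ι (suc b)) (ι (2 ℕ.+ b)) (θ R₂′) (θ R₁) ⟩
    ι (2 ℕ.+ b) * ι (suc b) * (θ R₁ * θ R₂′) ≡⟨ cong₂ _*_ (sym (ι-* (2 ℕ.+ b) (suc b))) (trans (cong (λ w → θ R₁ * θ w) (sym (range-dyadic (2 ℕ.+ b)))) (trans (sym (θ-++ R₁ R₂)) (cong θ (sym (range-++ (2^-mono (ℕ.s≤s (ℕ.s≤s (ℕₚ.m≤m+n a n)))) (2^-mono (ℕₚ.n≤1+n (2 ℕ.+ b)))))))) ⟩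
    ι ((2 ℕ.+ b) ℕ.* suc b) * θ (range (2 ℕ.^ (2 ℕ.+ a)) (2 ℕ.^ (3 ℕ.+ b))) ≡⟨ cong (λ w → ι (suc w ℕ.* w) * θ (range (2 ℕ.^ (2 ℕ.+ a)) (2 ℕ.^ (2 ℕ.+ w)))) (sym (ℕₚ.+-suc a n)) ⟩
    ι (suc (a ℕ.+ suc n) ℕ.* (a ℕ.+ suc n)) * θ (range (2 ℕ.^ (2 ℕ.+ a)) (2 ℕ.^ (2 ℕ.+ (a ℕ.+ suc n)))) ∎
    where
    b = a ℕ.+ n
    R₁ = range (2 ℕ.^ (2 ℕ.+ a)) (2 ℕ.^ (2 ℕ.+ b))
    R₂ = range (2 ℕ.^ (2 ℕ.+ b)) (2 ℕ.^ (3 ℕ.+ b))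
    R₂′ = primesAfter (2 ℕ.^ (2 ℕ.+ b)) (2 ℕ.^ (2 ℕ.+ b))

  mertens-quad : ∀ a → 2 ℕ.≤ a → 1ℚ ≤ ι 64 * θ (range (2 ℕ.^ (2 ℕ.+ a)) (2 ℕ.^ (4 ℕ.* (2 ℕ.+ a))))
  mertens-quad a h = cancelˡ Q Q>0 (begin
    ι Q * 1ℚ ≡⟨ *-identityʳ (ι Q) ⟩
    ι Q ≤⟨ ι-mono num ⟩
    ι (64 ℕ.* (suc a ℕ.* a)) ≡⟨ ι-* 64 (suc a ℕ.* a) ⟩
    ι 64 * ι (suc a ℕ.* a) ≤⟨ *ˡ (ι≥0 64) (telescope a n) ⟩
    ι 64 * (ι Q * θ R′) ≡⟨ solve 3 (λ a b c → a :* (b :* c) := b :* (a :* c)) refl (ι 64) (ι Q) (θ R′) ⟩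
    ι Q * (ι 64 * θ R′) ≡⟨ cong (λ w → ι Q * (ι 64 * θ (range (2 ℕ.^ (2 ℕ.+ a)) (2 ℕ.^ w)))) (l₁ a) ⟩
    ι Q * (ι 64 * θ (range (2 ℕ.^ (2 ℕ.+ a)) (2 ℕ.^ (4 ℕ.* (2 ℕ.+ a))))) ∎)
    where
    -- The solution of `2 + a + n = 4 * (2 + a)`. The quotient of the telescoped ends is then 35 at
    -- `a = 2` and tends to 16; 64 covers it and is a power of 2.
    n = 6 ℕ.+ 3 ℕ.* a
    Q = suc (a ℕ.+ n) ℕ.* (a ℕ.+ n)
    Q>0 : 0 ℕ.< Q
    Q>0 = ℕₚ.*-mono-< {0} {suc (a ℕ.+ n)} {0} {a ℕ.+ n} (ℕ.s≤s ℕ.z≤n) (ℕₚ.<-≤-trans (ℕ.s≤s ℕ.z≤n) (ℕₚ.m≤n+m n a))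
    R′ = range (2 ℕ.^ (2 ℕ.+ a)) (2 ℕ.^ (2 ℕ.+ (a ℕ.+ n)))
    l₁ : ∀ a → 2 ℕ.+ (a ℕ.+ (6 ℕ.+ 3 ℕ.* a)) ≡ 4 ℕ.* (2 ℕ.+ a)
    l₁ = solve-∀
    num : Q ℕ.≤ 64 ℕ.* (suc a ℕ.* a)
    num = subst (λ w → suc (w ℕ.+ (6 ℕ.+ 3 ℕ.* w)) ℕ.* (w ℕ.+ (6 ℕ.+ 3 ℕ.* w)) ℕ.≤ 64 ℕ.* (suc w ℕ.* w)) (ℕₚ.m+[n∸m]≡n h) (ge (a ℕ.∸ 2))
      where
      ge : ∀ c → suc ((2 ℕ.+ c) ℕ.+ (6 ℕ.+ 3 ℕ.* (2 ℕ.+ c))) ℕ.* ((2 ℕ.+ c) ℕ.+ (6 ℕ.+ 3 ℕ.* (2 ℕ.+ c))) ℕ.≤ 64 ℕ.* (suc (2 ℕ.+ c) ℕ.* (2 ℕ.+ c))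
      ge c = ℕₚ.m+n≤o⇒m≤o _ (ℕₚ.≤-reflexive (l₂ c))
        where
        l₂ : ∀ c → suc ((2 ℕ.+ c) ℕ.+ (6 ℕ.+ 3 ℕ.* (2 ℕ.+ c))) ℕ.* ((2 ℕ.+ c) ℕ.+ (6 ℕ.+ 3 ℕ.* (2 ℕ.+ c))) ℕ.+ (174 ℕ.+ 204 ℕ.* c ℕ.+ 48 ℕ.* (c ℕ.* c)) ≡ 64 ℕ.* (suc (2 ℕ.+ c) ℕ.* (2 ℕ.+ c))
        l₂ = solve-∀

  z : ℕ → ℕ
  z i = 2 ℕ.^ (4 ℕ.^ i)

  z-mono : ∀ {i j} → i ℕ.≤ j → z i ℕ.≤ z j
  z-mono h = 2^-mono (ℕₚ.^-monoʳ-≤ 4 h)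

  mertens-block : ∀ i → 1ℚ ≤ ι 64 * θ (range (z (suc i)) (z (2 ℕ.+ i)))
  mertens-block i = subst (λ w → 1ℚ ≤ ι 64 * θ (range (2 ℕ.^ w) (2 ℕ.^ (4 ℕ.* w)))) (ℕₚ.m+[n∸m]≡n {2} {4 ℕ.^ suc i} (ℕₚ.≤-trans (ℕ.s≤s (ℕ.s≤s ℕ.z≤n)) 4≤))
     (mertens-quad (4 ℕ.^ suc i ℕ.∸ 2) (ℕₚ.∸-monoˡ-≤ 2 4≤))
    where
    4≤ : 4 ℕ.≤ 4 ℕ.^ suc i
    4≤ = ℕₚ.*-monoʳ-≤ 4 (ℕₚ.m^n>0 4 i)

  mertens-range : ∀ a n → 1ℚ ≤ ι (64 ℕ.^ n) * θ (range (z (suc a)) (z (suc a ℕ.+ n)))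
  mertens-range a zero = ≤-reflexive (sym (trans (cong₂ _*_ ι1 (cong θ (trans (cong (λ w → range (z (suc a)) (z w)) (ℕₚ.+-identityʳ (suc a))) (cong (primesAfter (z (suc a))) (ℕₚ.n∸n≡0 (z (suc a))))))) (*-identityˡ 1ℚ)))
  mertens-range a (suc n) = begin
    1ℚ * 1ℚ ≤⟨ *-mono 0≤1 (*-≥0 (ι≥0 (64 ℕ.^ n)) (θ≥0 R₁)) (mertens-block (a ℕ.+ n)) (mertens-range a n) ⟩
    ι 64 * θ R₂ * (ι (64 ℕ.^ n) * θ R₁) ≡⟨ solve 4 (λ a b c d → a :* b :* (c :* d) := a :* c :* (d :* b)) refl (ι 64) (θ R₂) (ι (64 ℕ.^ n)) (θ R₁) ⟩
    ι 64 * ι (64 ℕ.^ n) * (θ R₁ * θ R₂) ≡⟨ cong₂ _*_ (sym (ι-* 64 (64 ℕ.^ n))) (trans (sym (θ-++ R₁ R₂)) (cong θ (sym (range-++ (z-mono (ℕ.s≤s (ℕₚ.m≤m+n a n))) (z-mono (ℕₚ.n≤1+n (suc (a ℕ.+ n)))))))) ⟩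
    ι (64 ℕ.^ suc n) * θ (range (z (suc a)) (z (2 ℕ.+ (a ℕ.+ n)))) ≡⟨ cong (λ w → ι (64 ℕ.^ suc n) * θ (range (z (suc a)) (z (suc w)))) (sym (ℕₚ.+-suc a n)) ⟩
    ι (64 ℕ.^ suc n) * θ (range (z (suc a)) (z (suc a ℕ.+ suc n))) ∎
    where
    R₁ = range (z (suc a)) (z (suc a ℕ.+ n))
    R₂ = range (z (suc (a ℕ.+ n))) (z (2 ℕ.+ (a ℕ.+ n)))

  θ-one : ∀ a → ι (suc a) ≤ ι (2 ℕ.+ a) * θ (primesAfter (suc a) 1)
  θ-one a with prime? (2 ℕ.+ a)
  ... | no _ = ≤-trans (ι-mono (ℕₚ.n≤1+n (suc a))) (≤-reflexive (sym (*-identityʳ _)))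
  ... | yes _ = ≤-reflexive (sym (begin-equality
      ι (2 ℕ.+ a) * ((1ℚ - inv (2 ℕ.+ a)) * 1ℚ) ≡⟨ solve 2 (λ i j → i :* ((con 1ℚ :- j) :* con 1ℚ) := i :- i :* j) refl (ι (2 ℕ.+ a)) (inv (2 ℕ.+ a)) ⟩
      ι (2 ℕ.+ a) - ι (2 ℕ.+ a) * inv (2 ℕ.+ a) ≡⟨ cong₂ _-_ (trans (ι-+ 1 (suc a)) (cong (_+ ι (suc a)) ι1)) (ι*inv (ℕ.s≤s ℕ.z≤n)) ⟩
      (1ℚ + ι (suc a)) - 1ℚ ≡⟨ solve 1 (λ x → (con 1ℚ :+ x) :- con 1ℚ := x) refl (ι (suc a)) ⟩
      ι (suc a) ∎))

  -- Treating every integer from 2 on as a prime, the product of the `1 - 1 / m` telescopes. This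
  -- suffices up to 16, where the dyadic bound starts.
  θ-trivial : ∀ n → 1ℚ ≤ ι (suc n) * θ (primesAfter 1 n)
  θ-trivial zero = ≤-reflexive (sym (trans (*-identityʳ (ι 1)) ι1))
  θ-trivial (suc n) = begin
    1ℚ ≤⟨ θ-trivial n ⟩
    ι (suc n) * θ P ≤⟨ *ʳ (θ≥0 P) (θ-one n) ⟩
    ι (2 ℕ.+ n) * θ Q * θ P ≡⟨ solve 3 (λ a b c → a :* b :* c := a :* (c :* b)) refl (ι (2 ℕ.+ n)) (θ Q) (θ P) ⟩
    ι (2 ℕ.+ n) * (θ P * θ Q) ≡⟨ cong (ι (2 ℕ.+ n) *_) (trans (sym (θ-++ P Q)) (cong θ (trans (sym (after-++ 1 n 1)) (cong (primesAfter 1) (ℕₚ.+-comm n 1))))) ⟩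
    ι (2 ℕ.+ n) * θ (primesAfter 1 (suc n)) ∎
    where
    P = primesAfter 1 n
    Q = primesAfter (suc n) 1

  mertens-all : ∀ n → 1ℚ ≤ ι (64 ℕ.^ suc n) * θ (range 1 (z (suc n)))
  mertens-all n = begin
    1ℚ * 1ℚ ≤⟨ *-mono 0≤1 (*-≥0 (ι≥0 (64 ℕ.^ n)) (θ≥0 R₂)) (≤-trans (θ-trivial 15) (*ʳ (θ≥0 R₁) (ι-mono (ℕₚ.m≤m+n 16 48)))) (mertens-range 0 n) ⟩
    ι 64 * θ R₁ * (ι (64 ℕ.^ n) * θ R₂) ≡⟨ solve 4 (λ a b c d → a :* b :* (c :* d) := a :* c :* (b :* d)) refl (ι 64) (θ R₁) (ι (64 ℕ.^ n)) (θ R₂) ⟩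
    ι 64 * ι (64 ℕ.^ n) * (θ R₁ * θ R₂) ≡⟨ cong₂ _*_ (sym (ι-* 64 (64 ℕ.^ n))) (trans (sym (θ-++ R₁ R₂)) (cong θ (sym (range-++ {1} {16} {z (suc n)} (ℕ.s≤s ℕ.z≤n) (z-mono (ℕ.s≤s (ℕ.z≤n {n}))))))) ⟩
    ι (64 ℕ.^ suc n) * θ (range 1 (z (suc n))) ∎
    where
    R₁ = range 1 16
    R₂ = range 16 (z (suc n))

  pow≥0 : ∀ {x} n → 0ℚ ≤ x → 0ℚ ≤ pow x n
  pow≥0 zero _ = 0≤1
  pow≥0 (suc n) h = *-≥0 h (pow≥0 n h)

  pow-* : ∀ a b n → pow (a * b) n ≡ pow a n * pow b n
  pow-* a b zero = sym (*-identityˡ 1ℚ)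
  pow-* a b (suc n) = trans (cong (a * b *_) (pow-* a b n)) (solve 4 (λ a b c d → a :* b :* (c :* d) := a :* c :* (b :* d)) refl a b (pow a n) (pow b n))

  pow-ι : ∀ a n → pow (ι a) n ≡ ι (a ℕ.^ n)
  pow-ι a zero = sym ι1
  pow-ι a (suc n) = trans (cong (ι a *_) (pow-ι a n)) (sym (ι-* a (a ℕ.^ n)))

  pow≥1 : ∀ {x} n → 1ℚ ≤ x → 1ℚ ≤ pow x n
  pow≥1 zero _ = ≤-refl
  pow≥1 (suc n) h = *-mono 0≤1 (≤-trans 0≤1 (pow≥1 n h)) h (pow≥1 n h)

  pow≤1 : ∀ {x} n → 0ℚ ≤ x → x ≤ 1ℚ → pow x n ≤ 1ℚ
  pow≤1 zero _ _ = ≤-refl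
  pow≤1 (suc n) h h′ = *-mono h 0≤1 h′ (pow≤1 n h h′)

  pow-bernoulli : ∀ n x → Unit x → pow (1ℚ - x) n * (1ℚ + ι n * x) ≤ 1ℚ
  pow-bernoulli zero x u = ≤-reflexive (trans (cong (λ w → 1ℚ * (1ℚ + w * x)) ι0) (solve 1 (λ x → con 1ℚ :* (con 1ℚ :+ con 0ℚ :* x) := con 1ℚ) refl x))
  pow-bernoulli (suc n) x u = begin
    (1ℚ - x) * P * (1ℚ + ι (suc n) * x) ≡⟨ cong (λ w → (1ℚ - x) * P * (1ℚ + w * x)) (trans (ι-+ 1 n) (cong (_+ ι n) ι1)) ⟩
    (1ℚ - x) * P * (1ℚ + (1ℚ + ι n) * x) ≡⟨ solve 3 (λ x P n → (con 1ℚ :- x) :* P :* (con 1ℚ :+ (con 1ℚ :+ n) :* x) := P :* (con 1ℚ :+ n :* x) :- P :* ((con 1ℚ :+ n) :* (x :* x))) refl x P (ι n) ⟩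
    P * (1ℚ + ι n * x) - P * ((1ℚ + ι n) * (x * x)) ≤⟨ -mono (pow-bernoulli n x u) (*-≥0 (pow≥0 n (1-≥0 (proj₂ u))) (*-≥0 (+-≥0 0≤1 (ι≥0 n)) (*-≥0 (proj₁ u) (proj₁ u)))) ⟩
    1ℚ - 0ℚ ≡⟨⟩
    1ℚ ∎
    where P = pow (1ℚ - x) n

  inv-unit₁ : ∀ p → Unit (inv p)
  inv-unit₁ p = inv-nonneg p , inv≤1 p

  2frac≡ : ∀ K p → ι (2 ℕ.* K) * inv p ≡ 2ℚ * frac K p
  2frac≡ K p = trans (cong (_* inv p) (trans (ι-* 2 K) (cong (_* ι K) ι2))) (*-assoc 2ℚ (ι K) (inv p))

  -- Transfers Mertens to dimension `K`: by Bernoulli the power is at most `1 / (1 + 2 y)` with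
  -- `y = K / p`, and `(1 + 2 y) * (1 - y) = 1 + y * (1 - 2 y)` is at least 1 because `2 y ≤ 1`.
  pow≤1-frac : ∀ K p → 2 ℕ.* K ℕ.≤ p → 0 ℕ.< p → pow (1ℚ - inv p) (2 ℕ.* K) ≤ 1ℚ - frac K p
  pow≤1-frac K p h h′ = begin
    a ≡⟨ sym (*-identityʳ a) ⟩
    a * 1ℚ ≤⟨ *ˡ a≥0 (≤-trans (≤+ˡ (*-≥0 y≥0 (1-≥0 2y≤1))) (≤-reflexive (solve 1 (λ y → con 1ℚ :+ y :* (con 1ℚ :- con 2ℚ :* y) := (con 1ℚ :+ con 2ℚ :* y) :* (con 1ℚ :- y)) refl y))) ⟩
    a * ((1ℚ + 2ℚ * y) * (1ℚ - y)) ≡⟨ sym (*-assoc a (1ℚ + 2ℚ * y) (1ℚ - y)) ⟩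
    a * (1ℚ + 2ℚ * y) * (1ℚ - y) ≡⟨ cong (λ w → a * (1ℚ + w) * (1ℚ - y)) (sym (2frac≡ K p)) ⟩
    a * (1ℚ + ι (2 ℕ.* K) * inv p) * (1ℚ - y) ≤⟨ *ʳ (1-≥0 (≤-trans (x≤2x y≥0) 2y≤1)) (pow-bernoulli (2 ℕ.* K) (inv p) (inv-unit₁ p)) ⟩
    1ℚ * (1ℚ - y) ≡⟨ *-identityˡ (1ℚ - y) ⟩
    1ℚ - y ∎
    where
    a = pow (1ℚ - inv p) (2 ℕ.* K)
    y = frac K p
    y≥0 = frac≥0 K p
    2y≤1 = 2frac≤1 K p h h′
    a≥0 : 0ℚ ≤ a
    a≥0 = pow≥0 (2 ℕ.* K) (1-≥0 (inv≤1 p))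

  powθ≤∏ : ∀ n (g : ℕ → ℚ) L → All (λ p → pow (1ℚ - inv p) n ≤ 1ℚ - g p) L → pow (θ L) n ≤ ∏1- (map g L)
  powθ≤∏ n g [] [] = pow≤1 n 0≤1 ≤-refl
  powθ≤∏ n g (p ∷ L) (h ∷ hs) = begin
    pow ((1ℚ - inv p) * θ L) n ≡⟨ pow-* (1ℚ - inv p) (θ L) n ⟩
    pow (1ℚ - inv p) n * pow (θ L) n ≤⟨ *-mono pp (≤-trans (pow≥0 n (θ≥0 L)) (powθ≤∏ n g L hs)) h (powθ≤∏ n g L hs) ⟩
    (1ℚ - g p) * ∏1- (map g L) ∎
    where
    pp : 0ℚ ≤ pow (1ℚ - inv p) n
    pp = pow≥0 n (1-≥0 (inv≤1 p))

  powθ*∏1+2 : ∀ K L → pow (θ L) (2 ℕ.* K) * ∏1+2 (map (frac K) L) ≤ 1ℚ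
  powθ*∏1+2 K [] = ≤-trans (≤-reflexive (*-identityʳ (pow 1ℚ (2 ℕ.* K)))) (pow≤1 (2 ℕ.* K) 0≤1 ≤-refl)
  powθ*∏1+2 K (p ∷ L) = begin
    pow ((1ℚ - inv p) * θ L) n * ((1ℚ + 2ℚ * frac K p) * W) ≡⟨ cong₂ (λ a b → a * ((1ℚ + b) * W)) (pow-* (1ℚ - inv p) (θ L) n) (sym (2frac≡ K p)) ⟩
    pow (1ℚ - inv p) n * pow (θ L) n * ((1ℚ + ι n * inv p) * W) ≡⟨ solve 4 (λ a b c d → a :* b :* (c :* d) := a :* c :* (b :* d)) refl (pow (1ℚ - inv p) n) (pow (θ L) n) (1ℚ + ι n * inv p) W ⟩
    pow (1ℚ - inv p) n * (1ℚ + ι n * inv p) * (pow (θ L) n * W) ≤⟨ *-mono (*-≥0 (pow≥0 n (1-≥0 (inv≤1 p))) (+-≥0 0≤1 (*-≥0 (ι≥0 n) (inv-nonneg p)))) 0≤1 (pow-bernoulli n (inv p) (inv-unit₁ p)) (powθ*∏1+2 K L) ⟩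
    1ℚ * 1ℚ ≡⟨⟩
    1ℚ ∎
    where
    n = 2 ℕ.* K
    W = ∏1+2 (map (frac K) L)

  powθ≥ : ∀ b n L → 1ℚ ≤ ι b * θ L → 1ℚ ≤ ι (b ℕ.^ n) * pow (θ L) n
  powθ≥ b n L h = ≤-trans (pow≥1 n h) (≤-reflexive (trans (pow-* (ι b) (θ L) n) (cong (_* pow (θ L) n) (pow-ι b n))))

  module _ {L : List ℕ} {K : ℕ} (h : 1ℚ ≤ ι 64 * θ L) (big : All (λ p → (2 ℕ.* K ℕ.≤ p) × (0 ℕ.< p)) L) where
    private
      B = 64 ℕ.^ (2 ℕ.* K)
      v = ∏1- (map (frac K) L)
      w = ∏1+2 (map (frac K) L)
      Θ = pow (θ L) (2 ℕ.* K)
      w≥0 : 0ℚ ≤ w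
      w≥0 = ≤-trans 0≤1 (∏1+2≥1 (Allₚ.map⁺ (All.universal (λ p → frac≥0 K p) L)))

    density≥ : 1ℚ ≤ ι B * v
    density≥ = ≤-trans (powθ≥ 64 (2 ℕ.* K) L h) (*ˡ (ι≥0 B) (powθ≤∏ (2 ℕ.* K) (frac K) L (All.map (λ {p} (a , b) → pow≤1-frac K p a b) big)))

    ∏1+2≤ : w ≤ ι B
    ∏1+2≤ = begin
      w ≡⟨ sym (*-identityˡ w) ⟩
      1ℚ * w ≤⟨ *ʳ w≥0 (powθ≥ 64 (2 ℕ.* K) L h) ⟩
      ι B * Θ * w ≡⟨ *-assoc (ι B) Θ w ⟩
      ι B * (Θ * w) ≤⟨ *ˡ (ι≥0 B) (powθ*∏1+2 K L) ⟩
      ι B * 1ℚ ≡⟨ *-identityʳ (ι B) ⟩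
      ι B ∎

    -- Rankin gives `2 ^ T * e_T ≤ 64 ^ (2 K) = 2 ^ (12 K)`, and the density `v` is at least
    -- `2 ^ (- 12 K)`; hence the threshold `24 K` for the truncation order.
    tight-block : ∀ c T → 24 ℕ.* K ℕ.+ c ℕ.≤ T → esym T (map (frac K) L) ≤ halfPow c * v
    tight-block c T le = cancelˡ (2 ℕ.^ (24 ℕ.* K ℕ.+ c)) (ℕₚ.m^n>0 2 (24 ℕ.* K ℕ.+ c)) (begin
      ι (2 ℕ.^ (24 ℕ.* K ℕ.+ c)) * E ≤⟨ *ʳ E≥0 (ι-mono (ℕₚ.^-monoʳ-≤ 2 le)) ⟩
      ι (2 ℕ.^ T) * E ≤⟨ esym-rankin T nn ⟩
      w ≤⟨ ∏1+2≤ ⟩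
      ι B ≡⟨ sym (*-identityʳ (ι B)) ⟩
      ι B * 1ℚ ≤⟨ *ˡ (ι≥0 B) density≥ ⟩
      ι B * (ι B * v) ≡⟨ sym (*-assoc (ι B) (ι B) v) ⟩
      ι B * ι B * v ≡⟨ cong (_* v) (trans (sym (ι-* B B)) (cong ι BB)) ⟩
      ι (2 ℕ.^ (24 ℕ.* K)) * v ≡⟨ cong (_* v) (trans (sym (*-identityʳ (ι (2 ℕ.^ (24 ℕ.* K))))) (cong (ι (2 ℕ.^ (24 ℕ.* K)) *_) (sym (ι*inv (ℕₚ.m^n>0 2 c))))) ⟩
      ι (2 ℕ.^ (24 ℕ.* K)) * (ι (2 ℕ.^ c) * halfPow c) * v ≡⟨ solve 4 (λ a b c d → a :* (b :* c) :* d := (a :* b) :* (c :* d)) refl (ι (2 ℕ.^ (24 ℕ.* K))) (ι (2 ℕ.^ c)) (halfPow c) v ⟩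
      ι (2 ℕ.^ (24 ℕ.* K)) * ι (2 ℕ.^ c) * (halfPow c * v) ≡⟨ cong (_* (halfPow c * v)) (trans (sym (ι-* (2 ℕ.^ (24 ℕ.* K)) (2 ℕ.^ c))) (cong ι (sym (ℕₚ.^-distribˡ-+-* 2 (24 ℕ.* K) c)))) ⟩
      ι (2 ℕ.^ (24 ℕ.* K ℕ.+ c)) * (halfPow c * v) ∎)
      where
      nn : All (0ℚ ≤_) (map (frac K) L)
      nn = Allₚ.map⁺ (All.universal (λ p → frac≥0 K p) L)
      E = esym T (map (frac K) L)
      E≥0 : 0ℚ ≤ E
      E≥0 = esym≥0 T nn
      BB : B ℕ.* B ≡ 2 ℕ.^ (24 ℕ.* K)
      BB = trans (cong₂ ℕ._*_ (ℕₚ.^-*-assoc 2 6 (2 ℕ.* K)) (ℕₚ.^-*-assoc 2 6 (2 ℕ.* K))) (trans (sym (ℕₚ.^-distribˡ-+-* 2 (6 ℕ.* (2 ℕ.* K)) (6 ℕ.* (2 ℕ.* K)))) (cong (2 ℕ.^_) (l K)))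
        where
        l : ∀ K → 6 ℕ.* (2 ℕ.* K) ℕ.+ 6 ℕ.* (2 ℕ.* K) ≡ 24 ℕ.* K
        l = solve-∀

  double≡ : ∀ n → double n ≡ 2 ℕ.* n
  double≡ zero = refl
  double≡ (suc n) = trans (cong (λ w → suc (suc w)) (double≡ n)) (l n)
    where
    l : ∀ n → suc (suc (2 ℕ.* n)) ≡ 2 ℕ.* suc n
    l = solve-∀

  n<2^n : ∀ n → n ℕ.< 2 ℕ.^ n
  n<2^n zero = ℕ.s≤s ℕ.z≤n
  n<2^n (suc n) = ℕₚ.≤-trans (ℕₚ.+-mono-≤ (ℕₚ.m^n>0 2 n) (n<2^n n)) (ℕₚ.≤-reflexive (cong (2 ℕ.^ n ℕ.+_) (sym (ℕₚ.+-identityʳ _))))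

  -- The family of blocks: density and error

  module Family (j₀ : ℕ) where

    J : ℕ
    J = 4 ℕ.^ suc j₀

    j : ℕ
    j = suc j₀

    j<J : j ℕ.< J
    j<J = ℕₚ.<-≤-trans (n<2^n j) (ℕₚ.^-monoˡ-≤ j {2} {4} (ℕ.s≤s (ℕ.s≤s ℕ.z≤n)))

    y : ℕ
    y = z j

    R₀ : ℕ
    R₀ = J ∸ j

    -- Block r forbids p ∣ n + k for 1 ≤ k ≤ 2 ^ r, and Bonferroni stops at order 32 * 2 ^ r.
    blk : ℕ → Block
    blk r = block (2 ℕ.^ r) (16 ℕ.* 2 ℕ.^ r) (range (z (J ∸ r)) (z (suc (J ∸ r))))

    -- The widest block, with the smallest primes, comes first. The primes thus ascend along the
    -- list, and the block with the highest truncation order gets the smallest budget in `Tight`.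
    fam : ℕ → List Block
    fam zero = []
    fam (suc R) = blk (suc R) ∷ fam R

    fam-length : ∀ R → length (fam R) ≡ R
    fam-length zero = refl
    fam-length (suc R) = cong suc (fam-length R)

    j≤ : ∀ {r} → r ℕ.≤ R₀ → j ℕ.≤ J ∸ r
    j≤ {r} h = ℕₚ.≤-trans (ℕₚ.≤-reflexive (sym (ℕₚ.m∸[m∸n]≡n (ℕₚ.<⇒≤ j<J)))) (ℕₚ.∸-monoʳ-≤ J h)

    R₀<J : R₀ ℕ.< J
    R₀<J = ℕₚ.∸-monoʳ-< {J} (ℕ.s≤s ℕ.z≤n) (ℕₚ.<⇒≤ j<J)

    y≤z : ∀ {r} → r ℕ.≤ R₀ → y ℕ.≤ z (J ∸ r)
    y≤z h = z-mono (j≤ h)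

    suc-∸ : ∀ {R} → suc R ℕ.≤ R₀ → suc (J ∸ suc R) ≡ J ∸ R
    suc-∸ {R} h = sym (ℕₚ.+-∸-assoc 1 {J} {suc R} (ℕₚ.≤-trans h (ℕₚ.<⇒≤ R₀<J)))

    above : ∀ R → R ℕ.≤ R₀ → All (z (J ∸ R) ℕ.<_) (allPrimes (fam R))
    above zero _ = []
    above (suc R) h = Allₚ.++⁺ (range-> (z (J ∸ suc R)) (z (suc (J ∸ suc R))))
       (All.map (ℕₚ.≤-<-trans (z-mono (ℕₚ.∸-monoʳ-≤ J (ℕₚ.n≤1+n R)))) (above R (ℕₚ.≤-trans (ℕₚ.n≤1+n R) h)))

    blk-≤ : ∀ R → suc R ℕ.≤ R₀ → All (ℕ._≤ z (J ∸ R)) (primes (blk (suc R)))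
    blk-≤ R h = subst (λ w → All (ℕ._≤ z w) (primes (blk (suc R)))) (suc-∸ h) (range-≤ (z-mono (ℕₚ.n≤1+n (J ∸ suc R))))

    ascending : ∀ R → R ℕ.≤ R₀ → AllPairs ℕ._<_ (allPrimes (fam R))
    ascending zero _ = []
    ascending (suc R) h = APₚ.++⁺ (range-< (z (J ∸ suc R)) (z (suc (J ∸ suc R)))) (ascending R h′)
       (All.map (λ p≤ → All.map (ℕₚ.≤-<-trans p≤) (above R h′)) (blk-≤ R h))
      where h′ = ℕₚ.≤-trans (ℕₚ.n≤1+n R) h

    allPrime : ∀ R → All Prime (allPrimes (fam R))
    allPrime zero = []
    allPrime (suc R) = Allₚ.++⁺ (range-prime (z (J ∸ suc R)) (z (suc (J ∸ suc R)))) (allPrime R)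

    M : ℕ
    M = y ! ℕ.* y !

    p∤M : ∀ {p} → Prime p → y ℕ.< p → ¬ p ∣ M
    p∤M pr l d with euclidsLemma (y !) (y !) pr d
    ... | inj₁ x = prime∤! y pr l x
    ... | inj₂ x = prime∤! y pr l x

    fam-adm : ∀ R → R ℕ.≤ R₀ → Admissible M (fam R)
    fam-adm R h = adm (allPrime R) (go (allPrime R) (above R h)) (AllPairs.map ℕₚ.<⇒≢ (ascending R h))
      where
      go : ∀ {L} → All Prime L → All (z (J ∸ R) ℕ.<_) L → All (λ p → ¬ p ∣ M) L
      go [] [] = []
      go (pr ∷ prs) (l ∷ ls) = p∤M pr (ℕₚ.≤-<-trans (y≤z h) l) ∷ go prs ls

    2K≤y : ∀ {r} → r ℕ.≤ R₀ → 2 ℕ.* 2 ℕ.^ r ℕ.≤ y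
    2K≤y {r} h = 2^-mono {suc r} {J} (ℕₚ.≤-trans (ℕ.s≤s h) R₀<J)

    blk-big : ∀ {r} → r ℕ.≤ R₀ → All (λ p → (2 ℕ.* 2 ℕ.^ r ℕ.≤ p) × (0 ℕ.< p)) (primes (blk r))
    blk-big {r} h = All.map (λ l → ℕₚ.≤-trans (2K≤y h) (ℕₚ.≤-trans (y≤z h) (ℕₚ.<⇒≤ l)) , ℕₚ.≤-<-trans ℕ.z≤n l) (range-> (z (J ∸ r)) (z (suc (J ∸ r))))

    fam-big : ∀ R → R ℕ.≤ R₀ → Big (fam R)
    fam-big zero _ = []
    fam-big (suc R) h = blk-big h ∷ fam-big R (ℕₚ.≤-trans (ℕₚ.n≤1+n R) h)

    blk-mertens : ∀ {r} → r ℕ.≤ R₀ → 1ℚ ≤ ι 64 * θ (primes (blk r))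
    blk-mertens {r} h = subst (λ w → 1ℚ ≤ ι 64 * θ (range (z w) (z (suc w)))) (ℕₚ.m+[n∸m]≡n {1} (ℕₚ.≤-trans (ℕ.s≤s ℕ.z≤n) (j≤ h))) (mertens-block (J ∸ r ∸ 1))

    fam-tight : ∀ R → R ℕ.≤ R₀ → Tight (fam R)
    fam-tight zero _ = []
    fam-tight (suc R) h = subst (λ w → esymVal frac (blk (suc R)) ≤ halfPow (3 ℕ.+ w) * ∏1- (vals frac (blk (suc R)))) (sym (fam-length R))
        (tight-block {primes (blk (suc R))} {2 ℕ.^ suc R} (blk-mertens h) (blk-big h) (3 ℕ.+ R) (double (16 ℕ.* 2 ℕ.^ suc R)) le)
      ∷ fam-tight R (ℕₚ.≤-trans (ℕₚ.n≤1+n R) h)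
      where
      -- The order `32 * 2 ^ r` splits as 24, which `tight-block` needs, plus 8, which exceeds the
      -- budget index `3 + R`.
      le : 24 ℕ.* 2 ℕ.^ suc R ℕ.+ (3 ℕ.+ R) ℕ.≤ double (16 ℕ.* 2 ℕ.^ suc R)
      le = ℕₚ.≤-trans (ℕₚ.+-monoʳ-≤ (24 ℕ.* 2 ℕ.^ suc R) s) (ℕₚ.≤-reflexive (trans (l (2 ℕ.^ suc R)) (sym (double≡ (16 ℕ.* 2 ℕ.^ suc R)))))
        where
        l : ∀ a → 24 ℕ.* a ℕ.+ 8 ℕ.* a ≡ 2 ℕ.* (16 ℕ.* a)
        l = solve-∀
        s : 3 ℕ.+ R ℕ.≤ 8 ℕ.* 2 ℕ.^ suc R
        s = ℕₚ.≤-trans (ℕₚ.+-mono-≤ {3} {7 ℕ.* 2 ℕ.^ suc R} {R} {2 ℕ.^ suc R} (ℕₚ.≤-trans (ℕₚ.m≤m+n 3 4) (ℕₚ.*-monoʳ-≤ 7 (ℕₚ.m^n>0 2 (suc R)))) (ℕₚ.<⇒≤ (ℕₚ.<-trans (ℕₚ.n<1+n R) (n<2^n (suc R)))))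
             (ℕₚ.≤-reflexive (l₂ (2 ℕ.^ suc R)))
          where
          l₂ : ∀ a → 7 ℕ.* a ℕ.+ a ≡ 8 ℕ.* a
          l₂ = solve-∀

    -- Block `r` has density at least `2 ^ (- 12 * 2 ^ r)`, and these exponents form a geometric
    -- series dominated by twice its last term.
    fam-density : ∀ R → R ℕ.≤ R₀ → 1ℚ ≤ ι (2 ℕ.^ (24 ℕ.* 2 ℕ.^ R)) * full frac (fam R)
    fam-density zero _ = ≤-trans (≤-trans (≤-reflexive (sym ι1)) (ι-mono (ℕₚ.m^n>0 2 (24 ℕ.* 1)))) (≤-reflexive (sym (*-identityʳ _)))
    fam-density (suc R) h = begin
      1ℚ * 1ℚ ≤⟨ *-mono 0≤1 (≤-trans 0≤1 ih) (density≥ {primes (blk (suc R))} {2 ℕ.^ suc R} (blk-mertens h) (blk-big h)) ih ⟩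
      ι B * v * (ι A * V) ≡⟨ solve 4 (λ a b c d → a :* b :* (c :* d) := a :* c :* (b :* d)) refl (ι B) v (ι A) V ⟩
      ι B * ι A * (v * V) ≡⟨ cong (_* (v * V)) (trans (sym (ι-* B A)) (cong ι eq)) ⟩
      ι (2 ℕ.^ (24 ℕ.* 2 ℕ.^ suc R)) * (v * V) ∎
      where
      ih = fam-density R (ℕₚ.≤-trans (ℕₚ.n≤1+n R) h)
      B = 64 ℕ.^ (2 ℕ.* 2 ℕ.^ suc R)
      A = 2 ℕ.^ (24 ℕ.* 2 ℕ.^ R)
      v = ∏1- (vals frac (blk (suc R)))
      V = full frac (fam R)
      eq : B ℕ.* A ≡ 2 ℕ.^ (24 ℕ.* 2 ℕ.^ suc R)
      eq = trans (cong (ℕ._* A) (ℕₚ.^-*-assoc 2 6 (2 ℕ.* 2 ℕ.^ suc R))) (trans (sym (ℕₚ.^-distribˡ-+-* 2 (6 ℕ.* (2 ℕ.* 2 ℕ.^ suc R)) (24 ℕ.* 2 ℕ.^ R))) (cong (2 ℕ.^_) (l (2 ℕ.^ R))))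
        where
        l : ∀ a → 6 ℕ.* (2 ℕ.* (2 ℕ.* a)) ℕ.+ 24 ℕ.* a ≡ 24 ℕ.* (2 ℕ.* a)
        l = solve-∀

    blk-base : ∀ {r} → r ℕ.≤ R₀ → 1 ℕ.+ 2 ℕ.* 2 ℕ.^ r ℕ.* length (primes (blk r)) ℕ.≤ 2 ℕ.^ (2 ℕ.* 4 ℕ.^ suc (J ∸ r))
    blk-base {r} h = ℕₚ.≤-trans (ℕₚ.+-mono-≤ z′>0 (ℕₚ.*-monoʳ-≤ (2 ℕ.* 2 ℕ.^ r) (ℕₚ.≤-refl {l}))) (ℕₚ.≤-trans (ℕₚ.+-monoʳ-≤ z′ (ℕₚ.*-monoˡ-≤ l (ℕₚ.≤-trans (2K≤y h) (ℕₚ.≤-trans (y≤z h) (z-mono (ℕₚ.n≤1+n (J ∸ r)))))))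
        (ℕₚ.≤-trans (ℕₚ.≤-reflexive (sym (ℕₚ.*-suc z′ l))) (ℕₚ.≤-trans (ℕₚ.*-monoʳ-≤ z′ l<) (ℕₚ.≤-reflexive (trans (sym (ℕₚ.^-distribˡ-+-* 2 e e)) (cong (λ w → 2 ℕ.^ (e ℕ.+ w)) (sym (ℕₚ.+-identityʳ e))))))))
      where
      e = 4 ℕ.^ suc (J ∸ r)
      z′ = z (suc (J ∸ r))
      l = length (primes (blk r))
      z′>0 : 1 ℕ.≤ z′
      z′>0 = ℕₚ.m^n>0 2 e
      l< : suc l ℕ.≤ z′
      l< = ℕₚ.≤-trans (ℕ.s≤s (after-length (z (J ∸ r)) (z′ ∸ z (J ∸ r)))) (ℕₚ.∸-monoʳ-< {z′} {z (J ∸ r)} {0} (ℕₚ.m^n>0 2 (4 ℕ.^ (J ∸ r))) (z-mono (ℕₚ.n≤1+n (J ∸ r))))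

    4^≡ : ∀ n → 4 ℕ.^ n ≡ 2 ℕ.^ n ℕ.* 2 ℕ.^ n
    4^≡ n = trans (ℕₚ.^-*-assoc 2 2 n) (trans (cong (2 ℕ.^_) (cong (n ℕ.+_) (ℕₚ.+-identityʳ n))) (ℕₚ.^-distribˡ-+-* 2 n n))

    c : ℕ
    c = 257 ℕ.* 2 ℕ.^ J

    -- Block `r` contributes the exponent `2 * 4 ^ (J - r + 1) * 32 * 2 ^ r = 256 * 2 ^ J * 2 ^ (J -
    -- r)`; the factor 2 in `err` raises 256 to 257. The power on the left is the unspent remainder
    -- of the geometric series, which makes the induction exact.
    fam-err : ∀ R → R ℕ.≤ R₀ → err (fam R) ℕ.* 2 ℕ.^ (c ℕ.* 2 ℕ.^ (J ∸ R)) ℕ.≤ 2 ℕ.^ (c ℕ.* 2 ℕ.^ J)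
    fam-err zero _ = ℕₚ.≤-reflexive (ℕₚ.*-identityˡ _)
    fam-err (suc R) h = ℕₚ.≤-trans (ℕₚ.*-monoˡ-≤ F (ℕₚ.*-monoʳ-≤ 2 (ℕₚ.*-monoˡ-≤ (err (fam R)) bb)))
        (ℕₚ.≤-trans (ℕₚ.≤-reflexive (l₁ G (err (fam R)) F)) (ℕₚ.≤-trans (ℕₚ.*-monoʳ-≤ (err (fam R)) gg) (fam-err R (ℕₚ.≤-trans (ℕₚ.n≤1+n R) h))))
      where
      r = suc R
      e = 4 ℕ.^ suc (J ∸ r)
      T = double (16 ℕ.* 2 ℕ.^ r)
      F = 2 ℕ.^ (c ℕ.* 2 ℕ.^ (J ∸ r))
      G = 2 ℕ.^ (2 ℕ.* e ℕ.* T)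
      bb : (1 ℕ.+ 2 ℕ.* 2 ℕ.^ r ℕ.* length (primes (blk r))) ℕ.^ T ℕ.≤ G
      bb = ℕₚ.≤-trans (ℕₚ.^-monoˡ-≤ T (blk-base h)) (ℕₚ.≤-reflexive (ℕₚ.^-*-assoc 2 (2 ℕ.* e) T))
      l₁ : ∀ g e f → 2 ℕ.* (g ℕ.* e) ℕ.* f ≡ e ℕ.* (2 ℕ.* g ℕ.* f)
      l₁ = solve-∀
      J≡ : 2 ℕ.^ r ℕ.* 2 ℕ.^ (J ∸ r) ≡ 2 ℕ.^ J
      J≡ = trans (sym (ℕₚ.^-distribˡ-+-* 2 r (J ∸ r))) (cong (2 ℕ.^_) (ℕₚ.m+[n∸m]≡n (ℕₚ.≤-trans h (ℕₚ.<⇒≤ R₀<J))))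
      expo : 1 ℕ.+ 2 ℕ.* e ℕ.* T ℕ.≤ c ℕ.* 2 ℕ.^ (J ∸ r)
      expo = ℕₚ.≤-trans (ℕₚ.+-mono-≤ (ℕₚ.*-mono-≤ (ℕₚ.m^n>0 2 J) (ℕₚ.m^n>0 2 (J ∸ r))) (ℕₚ.≤-reflexive eqT)) (ℕₚ.≤-reflexive (l₃ (2 ℕ.^ J) (2 ℕ.^ (J ∸ r))))
        where
        l₂ : ∀ a b → 2 ℕ.* (4 ℕ.* (a ℕ.* a)) ℕ.* (2 ℕ.* (16 ℕ.* b)) ≡ 256 ℕ.* (b ℕ.* a) ℕ.* a
        l₂ = solve-∀
        eqT : 2 ℕ.* e ℕ.* T ≡ 256 ℕ.* 2 ℕ.^ J ℕ.* 2 ℕ.^ (J ∸ r)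
        eqT = trans (cong₂ (λ a b → 2 ℕ.* (4 ℕ.* a) ℕ.* b) (4^≡ (J ∸ r)) (double≡ (16 ℕ.* 2 ℕ.^ r))) (trans (l₂ (2 ℕ.^ (J ∸ r)) (2 ℕ.^ r)) (cong (λ w → 256 ℕ.* w ℕ.* 2 ℕ.^ (J ∸ r)) J≡))
        l₃ : ∀ a b → a ℕ.* b ℕ.+ 256 ℕ.* a ℕ.* b ≡ 257 ℕ.* a ℕ.* b
        l₃ = solve-∀
      gg : 2 ℕ.* G ℕ.* F ℕ.≤ 2 ℕ.^ (c ℕ.* 2 ℕ.^ (J ∸ R))
      gg = ℕₚ.≤-trans (ℕₚ.*-monoˡ-≤ F (ℕₚ.^-monoʳ-≤ 2 expo)) (ℕₚ.≤-reflexive (trans (sym (ℕₚ.^-distribˡ-+-* 2 (c ℕ.* 2 ℕ.^ (J ∸ r)) (c ℕ.* 2 ℕ.^ (J ∸ r)))) (cong (2 ℕ.^_) (trans (l₄ c (2 ℕ.^ (J ∸ r))) (cong (λ w → c ℕ.* 2 ℕ.^ w) (suc-∸ h))))))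
        where
        l₄ : ∀ c a → c ℕ.* a ℕ.+ c ℕ.* a ≡ c ℕ.* (2 ℕ.* a)
        l₄ = solve-∀

  -- Cofactors, Rankin weights and constants

  reduce : ∀ M k → 0 ℕ.< k → ∃ λ g → ∃ λ c → ∃ λ e → (M ≡ c ℕ.* g) × (k ≡ e ℕ.* g) × Coprime c e
  reduce M k k>0 = g , M / g , k / g , sym (m/n*n≡m (gcd[m,n]∣m M k)) , sym (m/n*n≡m (gcd[m,n]∣n M k)) , coprime-/gcd M k
    where
    g = gcd M k
    instance
      nz : ℕ.NonZero (gcd M k)
      nz = ℕ.≢-nonZero (λ e → ℕₚ.<⇒≢ k>0 (sym (gcd[m,n]≡0⇒n≡0 M e)))

  3/2 : ℚ
  3/2 = 1ℚ + ½

  3/2≥0 : 0ℚ ≤ 3/2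
  3/2≥0 = nonNegative⁻¹ 3/2

  -- Since `(3/2)^2 = 9/4` exceeds 2, multisets of size `2 * s` save a factor `2 ^ s`.
  pow-3/2 : ∀ s → ι (2 ℕ.^ s) ≤ pow 3/2 (2 ℕ.* s)
  pow-3/2 zero = ≤-reflexive ι1
  pow-3/2 (suc s) = begin
    ι (2 ℕ.* 2 ℕ.^ s) ≡⟨ trans (ι-* 2 (2 ℕ.^ s)) (cong (_* ι (2 ℕ.^ s)) ι2) ⟩
    2ℚ * ι (2 ℕ.^ s) ≤⟨ *-mono 2≥0 (pow≥0 (2 ℕ.* s) 3/2≥0) 2≤ (pow-3/2 s) ⟩
    3/2 * 3/2 * pow 3/2 (2 ℕ.* s) ≡⟨ *-assoc 3/2 3/2 (pow 3/2 (2 ℕ.* s)) ⟩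
    pow 3/2 (2 ℕ.+ 2 ℕ.* s) ≡⟨ cong (pow 3/2) (l s) ⟩
    pow 3/2 (2 ℕ.* suc s) ∎
    where
    2≤ : 2ℚ ≤ 3/2 * 3/2
    2≤ = ≤ᵇ⇒≤ _
    l : ∀ s → 2 ℕ.+ 2 ℕ.* s ≡ 2 ℕ.* suc s
    l = solve-∀

  -- Doubling at p > y pays for removing the divisors of d from the sieve.
  abstract
    φ : ℕ → ℕ → ℚ
    φ y p with p ℕₚ.≤? y
    ... | yes _ = 1ℚ
    ... | no _ = 2ℚ

    1≤2 : 1ℚ ≤ 2ℚ
    1≤2 = ≤ᵇ⇒≤ _

    φ≥1 : ∀ y p → 1ℚ ≤ φ y p
    φ≥1 y p with p ℕₚ.≤? y
    ... | yes _ = ≤-refl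
    ... | no _ = 1≤2

    φ-small : ∀ {y p} → p ℕ.≤ y → φ y p ≡ 1ℚ
    φ-small {y} {p} h with p ℕₚ.≤? y
    ... | yes _ = refl
    ... | no ¬h = contradiction h ¬h

    φ-large : ∀ {y p} → y ℕ.< p → φ y p ≡ 2ℚ
    φ-large {y} {p} h with p ℕₚ.≤? y
    ... | yes le = contradiction le (ℕₚ.<⇒≱ h)
    ... | no _ = refl

  -- Since the prime 2 may repeat, Rankin's parameter has to stay below 2, and only with `φ = 1`
  -- there; `3/2` leaves room. Above `y` the doubled weight turns it into `3 / p`, which explains
  -- the exponent `6 = 2 * 3` and the condition `6 ≤ y`. For `p ≤ y` already the square suffices, as
  -- `1 / p ≤ 1/2`.
  local-factor : ∀ {y p} → 6 ℕ.≤ y → 2 ℕ.≤ p →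
    (pow (1ℚ - inv p) 6 ≤ 1ℚ - 3/2 * (φ y p * inv p)) × Unit (3/2 * (φ y p * inv p))
  local-factor {y} {p} y≥6 p≥2 with p ℕₚ.≤? y
  ... | no p≰y = subst (pow (1ℚ - inv p) 6 ≤_) (cong (λ w → 1ℚ - w) (sym eq)) (pow≤1-frac 3 p p≥6 p>0) ,
        subst Unit (sym eq) (frac≥0 3 p , ≤-trans (x≤2x (frac≥0 3 p)) (2frac≤1 3 p p≥6 p>0))
    where
    y<p = ℕₚ.≰⇒> p≰y
    p≥6 = ℕₚ.≤-trans y≥6 (ℕₚ.<⇒≤ y<p)
    p>0 = ℕₚ.≤-<-trans ℕ.z≤n p≥2
    ι3 : ι 3 ≡ 2ℚ + 1ℚ
    ι3 = trans (ι-+ 2 1) (cong₂ _+_ ι2 ι1)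
    eq : 3/2 * (φ y p * inv p) ≡ frac 3 p
    eq = trans (cong (λ w → 3/2 * (w * inv p)) (φ-large y<p)) (trans (solve 1 (λ i → con 3/2 :* (con 2ℚ :* i) := con (2ℚ + 1ℚ) :* i) refl (inv p)) (cong (_* inv p) (sym ι3)))
  ... | yes p≤y = subst (λ w → pow (1ℚ - x) 6 ≤ 1ℚ - w) (sym eq) bound , subst Unit (sym eq) (*-≥0 3/2≥0 x≥0 , u≤)
    where
    x = inv p
    x≥0 = inv-nonneg p
    p>0 = ℕₚ.≤-<-trans ℕ.z≤n p≥2
    2x≤1 : 2ℚ * x ≤ 1ℚ
    2x≤1 = subst (λ w → 2ℚ * w ≤ 1ℚ) (trans (cong (_* x) ι1) (*-identityˡ x)) (2frac≤1 1 p p≥2 p>0)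
    eq : 3/2 * (φ y p * inv p) ≡ 3/2 * x
    eq = cong (3/2 *_) (trans (cong (_* x) (φ-small p≤y)) (*-identityˡ x))
    1-x≥0 : 0ℚ ≤ 1ℚ - x
    1-x≥0 = 1-≥0 (inv≤1 p)
    sq≥ : pow (1ℚ - x) 2 ≤ 1ℚ - 3/2 * x
    sq≥ = begin
      (1ℚ - x) * ((1ℚ - x) * 1ℚ) ≡⟨ solve 1 (λ x → (con 1ℚ :- x) :* ((con 1ℚ :- x) :* con 1ℚ) := (con 1ℚ :- con 3/2 :* x) :- con ½ :* (x :* (con 1ℚ :- con 2ℚ :* x))) refl x ⟩
      (1ℚ - 3/2 * x) - ½ * (x * (1ℚ - 2ℚ * x)) ≤⟨ -mono (≤-refl {1ℚ - 3/2 * x}) (*-≥0 (nonNegative⁻¹ ½) (*-≥0 x≥0 (1-≥0 2x≤1))) ⟩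
      (1ℚ - 3/2 * x) - 0ℚ ≡⟨ +-identityʳ (1ℚ - 3/2 * x) ⟩
      1ℚ - 3/2 * x ∎
    u≤ : 3/2 * x ≤ 1ℚ
    u≤ = from-sub≥0 (≤-trans (pow≥0 2 1-x≥0) sq≥)
    bound : pow (1ℚ - x) 6 ≤ 1ℚ - 3/2 * x
    bound = begin
      pow (1ℚ - x) 6 ≡⟨ solve 1 (λ a → a :* (a :* (a :* (a :* (a :* (a :* con 1ℚ))))) := (a :* (a :* con 1ℚ)) :* (a :* (a :* (a :* (a :* con 1ℚ))))) refl (1ℚ - x) ⟩
      pow (1ℚ - x) 2 * pow (1ℚ - x) 4 ≤⟨ *ˡ (pow≥0 2 1-x≥0) (pow≤1 4 1-x≥0 (1-≤1 x≥0)) ⟩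
      pow (1ℚ - x) 2 * 1ℚ ≡⟨ *-identityʳ (pow (1ℚ - x) 2) ⟩
      pow (1ℚ - x) 2 ≤⟨ sq≥ ⟩
      1ℚ - 3/2 * x ∎

  hsym≥0 : ∀ f → (∀ p → 0ℚ ≤ f p) → ∀ t L → 0ℚ ≤ hsym f t L
  hsym≥0 f h zero L = 0≤1
  hsym≥0 f h (suc t) [] = ≤-refl
  hsym≥0 f h (suc t) (p ∷ L) = +-≥0 (hsym≥0 f h (suc t) L) (*-≥0 (h p) (hsym≥0 f h t (p ∷ L)))

  hsym-bound : ∀ {y b} L s → 6 ℕ.≤ y → All (2 ℕ.≤_) L → 1ℚ ≤ ι b * θ L →
    ι (2 ℕ.^ s) * hsym (λ p → φ y p * inv p) (2 ℕ.* s) L ≤ ι (b ℕ.^ 6)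
  hsym-bound {y} {b} L s y≥6 p≥2 hθ = begin
    ι (2 ℕ.^ s) * h ≤⟨ *ʳ h≥0 (pow-3/2 s) ⟩
    pow 3/2 (2 ℕ.* s) * h ≡⟨ sym (*-identityʳ (pow 3/2 (2 ℕ.* s) * h)) ⟩
    pow 3/2 (2 ℕ.* s) * h * 1ℚ ≤⟨ *ˡ (*-≥0 (pow≥0 (2 ℕ.* s) 3/2≥0) h≥0) (≤-trans (powθ≥ b 6 L hθ) (*ˡ (ι≥0 (b ℕ.^ 6)) (powθ≤∏ 6 (λ p → 3/2 * f p) L (All.map (λ {p} q → proj₁ (local-factor {y} {p} y≥6 q)) p≥2)))) ⟩
    pow 3/2 (2 ℕ.* s) * h * (ι (b ℕ.^ 6) * G) ≡⟨ solve 4 (λ a b c d → a :* b :* (c :* d) := c :* (a :* b :* d)) refl (pow 3/2 (2 ℕ.* s)) h (ι (b ℕ.^ 6)) G ⟩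
    ι (b ℕ.^ 6) * (pow 3/2 (2 ℕ.* s) * h * G) ≤⟨ *ˡ (ι≥0 (b ℕ.^ 6)) (hsym-rankin f 3/2 3/2≥0 (2 ℕ.* s) L (All.map (λ {p} q → proj₂ (local-factor {y} {p} y≥6 q)) p≥2)) ⟩
    ι (b ℕ.^ 6) * 1ℚ ≡⟨ *-identityʳ (ι (b ℕ.^ 6)) ⟩
    ι (b ℕ.^ 6) ∎
    where
    f = λ p → φ y p * inv p
    h = hsym f (2 ℕ.* s) L
    G = ∏1- (map (λ p → 3/2 * f p) L)
    h≥0 : 0ℚ ≤ h
    h≥0 = hsym≥0 f (λ p → *-≥0 (≤-trans 0≤1 (φ≥1 y p)) (inv-nonneg p)) (2 ℕ.* s) L

  -- The terms are dominated by `1 / ((i + 1) * (i + 2))`, a difference of consecutive reciprocals.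
  -- The factor 64 makes the exceptional part small against the quarter of `V₀ * X` that the lower
  -- bound sieve guarantees.
  Σ-telescope : ∀ n (h : ℕ → ℚ) → (∀ i → ι (64 ℕ.* (suc i ℕ.* (2 ℕ.+ i))) * h i ≤ 1ℚ) → ι 64 * Σ< n h ≤ 1ℚ - inv (suc n)
  Σ-telescope zero h _ = ≤-reflexive (trans (*-zeroʳ (ι 64)) (sym (trans (cong (λ w → 1ℚ - w) (trans (sym (*-identityˡ (inv 1))) (trans (cong (_* inv 1) (sym ι1)) (ι*inv {1} (ℕ.s≤s ℕ.z≤n))))) refl)))
  Σ-telescope (suc n) h hyp = begin
    ι 64 * (Σ< n h + h n) ≡⟨ *-distribˡ-+ (ι 64) (Σ< n h) (h n) ⟩
    ι 64 * Σ< n h + ι 64 * h n ≤⟨ +-mono-≤ (Σ-telescope n h hyp) term ⟩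
    (1ℚ - inv (suc n)) + (inv (suc n) - inv (2 ℕ.+ n)) ≡⟨ solve 2 (λ a b → (con 1ℚ :- a) :+ (a :- b) := con 1ℚ :- b) refl (inv (suc n)) (inv (2 ℕ.+ n)) ⟩
    1ℚ - inv (2 ℕ.+ n) ∎
    where
    a = suc n
    b = 2 ℕ.+ n
    ab>0 : 0 ℕ.< a ℕ.* b
    ab>0 = ℕₚ.*-mono-< {0} {a} {0} {b} (ℕ.s≤s ℕ.z≤n) (ℕ.s≤s ℕ.z≤n)
    term : ι 64 * h n ≤ inv a - inv b
    term = cancelˡ (a ℕ.* b) ab>0 (begin
      ι (a ℕ.* b) * (ι 64 * h n) ≡⟨ trans (sym (*-assoc (ι (a ℕ.* b)) (ι 64) (h n))) (cong (_* h n) (trans (sym (ι-* (a ℕ.* b) 64)) (cong ι (ℕₚ.*-comm (a ℕ.* b) 64)))) ⟩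
      ι (64 ℕ.* (a ℕ.* b)) * h n ≤⟨ hyp n ⟩
      1ℚ ≡⟨ solve 1 (λ x → con 1ℚ := (con 1ℚ :+ x) :* con 1ℚ :- x :* con 1ℚ) refl (ι a) ⟩
      (1ℚ + ι a) * 1ℚ - ι a * 1ℚ ≡⟨ cong₂ _-_ (cong₂ _*_ (trans (cong (_+ ι a) (sym ι1)) (sym (ι-+ 1 a))) (sym (ι*inv {a} (ℕ.s≤s ℕ.z≤n)))) (cong (ι a *_) (sym (ι*inv {b} (ℕ.s≤s ℕ.z≤n)))) ⟩
      ι b * (ι a * inv a) - ι a * (ι b * inv b) ≡⟨ solve 4 (λ a i b j → b :* (a :* i) :- a :* (b :* j) := a :* b :* (i :- j)) refl (ι a) (inv a) (ι b) (inv b) ⟩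
      ι a * ι b * (inv a - inv b) ≡⟨ cong (_* (inv a - inv b)) (sym (ι-* a b)) ⟩
      ι (a ℕ.* b) * (inv a - inv b) ∎)

  Σ-swap : ∀ m n (f : ℕ → ℕ → ℚ) → Σ< m (λ i → Σ< n (f i)) ≡ Σ< n (λ j → Σ< m (λ i → f i j))
  Σ-swap zero n f = sym (Σ-0 n)
  Σ-swap (suc m) n f = trans (cong (_+ Σ< n (f m)) (Σ-swap m n f)) (sym (Σ-+ n _ _))

  Σ-pos : ∀ n f → 0ℚ < Σ< n f → ∃ λ m → (m ℕ.< n) × (0ℚ < f m)
  Σ-pos zero f h = ⊥-elim (<-irrefl refl h)
  Σ-pos (suc n) f h with 0ℚ <? f n
  ... | yes p = n , ℕₚ.≤-refl , p
  ... | no ¬p = let (m , l , p) = Σ-pos n f (<-≤-trans h (≤-trans (+-monoʳ-≤ (Σ< n f) (≮⇒≥ ¬p)) (≤-reflexive (+-identityʳ (Σ< n f))))) in m , ℕₚ.m<n⇒m<1+n l , p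

  Σ-term≤ : ∀ n f i → i ℕ.< n → (∀ i → 0ℚ ≤ f i) → f i ≤ Σ< n f
  Σ-term≤ (suc n) f i l h with ℕₚ.m<1+n⇒m<n∨m≡n l
  ... | inj₁ l′ = ≤-trans (Σ-term≤ n f i l′ h) (≤+ˡ (h n))
  ... | inj₂ refl = ≤+ʳ (go n)
    where
    go : ∀ n → 0ℚ ≤ Σ< n f
    go zero = ≤-refl
    go (suc n) = +-≥0 (go n) (h n)

  χ-yes : ∀ {P : Set} (d : Dec P) → P → χ d ≡ 1ℚ
  χ-yes (yes _) _ = refl
  χ-yes (no ¬p) p = contradiction p ¬p

  ∏1-zero : ∀ (g : ℕ → ℚ) {p L} → p ∈ L → g p ≡ 1ℚ → ∏1- (map g L) ≡ 0ℚ
  ∏1-zero g {p} {_ ∷ L} (here refl) eq = trans (cong (λ w → (1ℚ - w) * ∏1- (map g L)) eq) (*-zeroˡ (∏1- (map g L)))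
  ∏1-zero g {p} {q ∷ L} (there h) eq = trans (cong ((1ℚ - g q) *_) (∏1-zero g h eq)) (*-zeroʳ (1ℚ - g q))

  members≤product : ∀ {es} → All Prime es → All (ℕ._≤ product es) es
  members≤product [] = []
  members≤product {p ∷ es} (pr ∷ prs) =
    ℕₚ.≤-trans (ℕₚ.≤-reflexive (sym (ℕₚ.*-identityʳ p))) (ℕₚ.*-monoʳ-≤ p (product>0 prs)) ∷
    All.map (λ h → ℕₚ.≤-trans h (ℕₚ.≤-trans (ℕₚ.≤-reflexive (sym (ℕₚ.*-identityˡ (product es)))) (ℕₚ.*-monoˡ-≤ (product es) (prime>0 pr)))) (members≤product prs)

  m!≤m^m : ∀ {b} m → m ℕ.≤ b → m ! ℕ.≤ b ℕ.^ m
  m!≤m^m zero _ = ℕₚ.≤-refl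
  m!≤m^m (suc m) h = ℕₚ.*-mono-≤ h (m!≤m^m m (ℕₚ.≤-trans (ℕₚ.n≤1+n m) h))

  1≰0 : ¬ 1ℚ ≤ 0ℚ
  1≰0 h = <-irrefl refl (<-≤-trans (positive⁻¹ 1ℚ) h)

  prime≥2 : ∀ {p} → Prime p → 2 ℕ.≤ p
  prime≥2 {p} pr = ℕ.nonTrivial⇒n>1 p {{prime⇒nonTrivial pr}}

  -- As `g ∣ k` and `k ∣ y !`, one factor `y !` of `M` absorbs `g` and the other still divides `c`.
  -- So every prime `p ≤ y` divides `c`, and by coprimality it does not divide `e`.
  coprime-cofactor : ∀ {k g c e p} y → y ! ℕ.* y ! ≡ c ℕ.* g → k ≡ e ℕ.* g → 0 ℕ.< k → k ℕ.≤ y → Coprime c e →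
    Prime p → p ℕ.≤ y → ∀ m → ¬ p ∣ c ℕ.* m ℕ.+ e
  coprime-cofactor {k} {g} {c} {e} {p} y M≡ k≡ k>0 k≤y cop pr p≤y m p∣m = ¬prime[1] (subst Prime (cop (p∣c , p∣e)) pr)
    where
    gnz : ℕ.NonZero g
    gnz = ℕ.≢-nonZero (λ g0 → ℕₚ.<⇒≢ k>0 (sym (trans k≡ (trans (cong (e ℕ.*_) g0) (ℕₚ.*-zeroʳ e)))))
    l : ∀ Y q e g → Y ℕ.* (q ℕ.* (e ℕ.* g)) ≡ q ℕ.* e ℕ.* Y ℕ.* g
    l = solve-∀
    p∣c : p ∣ c
    p∣c = let (divides q eq) = ∣! k>0 k≤y in
      ∣-trans (∣! (prime>0 pr) p≤y) (divides (q ℕ.* e) (ℕₚ.*-cancelʳ-≡ c (q ℕ.* e ℕ.* y !) g {{gnz}}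
        (trans (sym M≡) (trans (cong (y ! ℕ.*_) (trans eq (cong (q ℕ.*_) k≡))) (l (y !) q e g)))))
    p∣e : p ∣ e
    p∣e = ∣m+n∣m⇒∣n p∣m (∣-trans p∣c (m∣m*n m))

  -- Abstract, because unfolding products by these numerals is prohibitively slow.
  abstract
    c₁ c₂ : ℕ
    c₁ = 514
    c₂ = 154

    -- Exponents of `D * (D * X) = D ^ c₁`: one `D` bounds the 2 from `n + k < 2 * n`, the other
    -- bounds `M`.
    c₁-spec : ∀ W → W ℕ.+ (W ℕ.+ 512 ℕ.* W) ≡ W ℕ.* c₁
    c₁-spec = solve-∀

    -- With `r = l + 1` the sixth power of the Mertens constant has exponent `72 * r`, and
    -- `64 * k ^ 2` adds `6 + 2 * r`. The total `74 * l + 80` is at most `154 * l` for `l ≥ 1`.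
    c₂-spec : ∀ {l} → 1 ℕ.≤ l → 6 ℕ.* (2 ℕ.* suc l) ℕ.* 6 ℕ.+ (6 ℕ.+ (suc l ℕ.+ suc l)) ℕ.≤ c₂ ℕ.* l
    c₂-spec {suc l} _ = ℕₚ.m+n≤o⇒m≤o _ {80 ℕ.* l} (ℕₚ.≤-reflexive (eq l))
      where
      eq : ∀ l → 6 ℕ.* (2 ℕ.* suc (suc l)) ℕ.* 6 ℕ.+ (6 ℕ.+ (suc (suc l) ℕ.+ suc (suc l))) ℕ.+ 80 ℕ.* l ≡ 154 ℕ.* suc l
      eq = solve-∀

    c₁c₂≥1 : 1 ℕ.≤ c₁ ℕ.* (2 ℕ.* c₂)
    c₁c₂≥1 = ℕ.s≤s ℕ.z≤n

  -- The 1 is for the prime factors of `g`, a divisor of `k`; the rest allows the cofactor `c₁`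
  -- blocks of `2 * c₂ * ⌊log₂ k ⌋` primes.
  C : ℕ
  C = 1 ℕ.+ c₁ ℕ.* (2 ℕ.* c₂)

  -- Choosing a survivor that is good for every shift

  module Main (j₀ : ℕ) where
    open Family j₀

    W : ℕ
    W = 4 ℕ.^ J

    W>0 : 0 ℕ.< W
    W>0 = ℕₚ.m^n>0 4 J

    D X : ℕ
    D = 2 ℕ.^ W
    X = 2 ℕ.^ (512 ℕ.* W)

    Bs : List Block
    Bs = fam R₀

    ad = fam-adm R₀ ℕₚ.≤-refl
    bg = fam-big R₀ ℕₚ.≤-refl
    tg = fam-tight R₀ ℕₚ.≤-refl

    V₀ : ℚ
    V₀ = full frac Bs

    V₀≥0 : 0ℚ ≤ V₀
    V₀≥0 = full≥0 frac (unit-frac bg)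

    err≤2^ : err Bs ℕ.≤ 2 ℕ.^ (257 ℕ.* W)
    err≤2^ = ℕₚ.≤-trans (ℕₚ.≤-trans (ℕₚ.≤-reflexive (sym (ℕₚ.*-identityʳ (err Bs)))) (ℕₚ.*-monoʳ-≤ (err Bs) (ℕₚ.m^n>0 2 (c ℕ.* 2 ℕ.^ (J ∸ R₀)))))
      (ℕₚ.≤-trans (fam-err R₀ ℕₚ.≤-refl) (ℕₚ.≤-reflexive (cong (2 ℕ.^_) (trans (ℕₚ.*-assoc 257 (2 ℕ.^ J) (2 ℕ.^ J)) (cong (257 ℕ.*_) (sym (4^≡ J)))))))

    density : 1ℚ ≤ ι (2 ℕ.^ (24 ℕ.* W)) * V₀
    density = ≤-trans (fam-density R₀ ℕₚ.≤-refl) (*ʳ V₀≥0 (ι-mono (ℕₚ.^-monoʳ-≤ 2 (ℕₚ.*-monoʳ-≤ 24 le))))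
      where
      le : 2 ℕ.^ R₀ ℕ.≤ W
      le = ℕₚ.≤-trans (ℕₚ.^-monoʳ-≤ 2 (ℕₚ.<⇒≤ R₀<J)) (ℕₚ.^-monoˡ-≤ J {2} {4} (ℕ.s≤s (ℕ.s≤s ℕ.z≤n)))

    err≤VX : ι (err Bs) * ι D ≤ V₀ * ι X
    err≤VX = begin
      ι (err Bs) * ι D ≡⟨ sym (ι-* (err Bs) D) ⟩
      ι (err Bs ℕ.* D) ≤⟨ ι-mono (ℕₚ.*-monoˡ-≤ D err≤2^) ⟩
      ι (2 ℕ.^ (257 ℕ.* W) ℕ.* D) ≡⟨ sym (*-identityʳ _) ⟩
      ι A * 1ℚ ≤⟨ *ˡ (ι≥0 A) density ⟩
      ι A * (ι B * V₀) ≡⟨ solve 3 (λ a b v → a :* (b :* v) := v :* (a :* b)) refl (ι A) (ι B) V₀ ⟩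
      V₀ * (ι A * ι B) ≡⟨ cong (V₀ *_) (sym (ι-* A B)) ⟩
      V₀ * ι (A ℕ.* B) ≤⟨ *ˡ V₀≥0 (ι-mono AB≤) ⟩
      V₀ * ι X ∎
      where
      A = 2 ℕ.^ (257 ℕ.* W) ℕ.* D
      B = 2 ℕ.^ (24 ℕ.* W)
      AB≤ : A ℕ.* B ℕ.≤ X
      AB≤ = ℕₚ.≤-trans (ℕₚ.≤-reflexive (trans (cong (ℕ._* B) (sym (ℕₚ.^-distribˡ-+-* 2 (257 ℕ.* W) W))) (sym (ℕₚ.^-distribˡ-+-* 2 (257 ℕ.* W ℕ.+ W) (24 ℕ.* W)))))
         (ℕₚ.^-monoʳ-≤ 2 (ℕₚ.≤-trans (ℕₚ.≤-reflexive (l W)) (ℕₚ.*-monoˡ-≤ W (ℕₚ.m≤m+n 282 230))))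
        where
        l : ∀ W → 257 ℕ.* W ℕ.+ W ℕ.+ 24 ℕ.* W ≡ 282 ℕ.* W
        l = solve-∀

    D≤X : D ℕ.≤ X
    D≤X = ℕₚ.^-monoʳ-≤ 2 (ℕₚ.m≤n*m W 512)

    VX≥1 : 1ℚ ≤ V₀ * ι X
    VX≥1 = ≤-trans density (≤-trans (≤-reflexive (*-comm (ι (2 ℕ.^ (24 ℕ.* W))) V₀)) (*ˡ V₀≥0 (ι-mono (ℕₚ.^-monoʳ-≤ 2 (ℕₚ.*-monoˡ-≤ W (ℕₚ.m≤m+n 24 488))))))

    primes>y : All (y ℕ.<_) (allPrimes Bs)
    primes>y = All.map (ℕₚ.≤-<-trans (y≤z ℕₚ.≤-refl)) (above R₀ ℕₚ.≤-refl)

    open Sifted M Bs ad bg tg (φ y) (φ≥1 y) (All.map (λ l → ≤-reflexive (sym (φ-large l))) primes>y) X D D≤X err≤VX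

    σ : ℕ → ℚ
    σ m = sift M Bs (suc m)

    σ≥0 : ∀ m → 0ℚ ≤ σ m
    σ≥0 m = full≥0 _ (unit-ev M (suc m) bg)

    VX≤4σ : V₀ * ι X ≤ 4ℚ * Σ< X σ
    VX≤4σ = begin
      V₀ * ι X ≡⟨ solve 1 (λ v → v := con 2ℚ :* v :- v) refl (V₀ * ι X) ⟩
      2ℚ * (V₀ * ι X) - V₀ * ι X ≤⟨ -mono (*ˡ 2≥0 lo) 4e≤ ⟩
      2ℚ * (2ℚ * (S + ι (err Bs))) - 4ℚ * ι (err Bs) ≡⟨ solve 2 (λ s e → con 2ℚ :* (con 2ℚ :* (s :+ e)) :- con 4ℚ :* e := con 4ℚ :* s) refl S (ι (err Bs)) ⟩
      4ℚ * S ≡⟨ cong (4ℚ *_) (Σ-cong X (λ m → cong (λ w → sift M Bs (suc w)) (ℕₚ.+-identityʳ m))) ⟩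
      4ℚ * Σ< X σ ∎
      where
      S = Σ< X (λ m → sift M Bs (1 ℕ.+ 1 ℕ.* m))
      nd : ∀ {L} → All Prime L → All (λ p → ¬ p ∣ 1) L
      nd = All.map (λ pr d → ¬prime[1] (subst Prime (∣1⇒≡1 d) pr))
      lo : V₀ * ι X ≤ 2ℚ * (S + ι (err Bs))
      lo = sieve-lower ad bg tg 1 1 X (nd (isPrime ad))
      4e≤ : 4ℚ * ι (err Bs) ≤ V₀ * ι X
      4e≤ = begin
        4ℚ * ι (err Bs) ≡⟨ cong (_* ι (err Bs)) (trans (sym (cong₂ _+_ ι2 ι2)) (sym (ι-+ 2 2))) ⟩
        -- `D ≥ 4`, so `err≤VX` leaves room for four times the error.
        ι 4 * ι (err Bs) ≤⟨ *ʳ (ι≥0 (err Bs)) (ι-mono {4} {D} (ℕₚ.^-monoʳ-≤ 2 {2} {W} (ℕₚ.≤-trans (ℕ.s≤s (ℕ.s≤s ℕ.z≤n)) (ℕₚ.^-monoʳ-≤ 4 {1} {J} (ℕₚ.m^n>0 4 (suc j₀)))))) ⟩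
        ι D * ι (err Bs) ≡⟨ *-comm (ι D) (ι (err Bs)) ⟩
        ι (err Bs) * ι D ≤⟨ err≤VX ⟩
        V₀ * ι X ∎

    -- The index i stands for the shift k = 2 + i.
    ℓ r s t : ℕ → ℕ
    ℓ i = ⌊log₂ 2 ℕ.+ i ⌋
    r i = suc (ℓ i)
    s i = c₂ ℕ.* ℓ i
    t i = 2 ℕ.* s i

    ℓ>0 : ∀ i → 1 ℕ.≤ ℓ i
    ℓ>0 i = ⌊log₂⌋-mono-≤ {2} {2 ℕ.+ i} (ℕ.s≤s (ℕ.s≤s ℕ.z≤n))

    k<2^r : ∀ i → 2 ℕ.+ i ℕ.< 2 ℕ.^ r i
    k<2^r i = n<2^log (2 ℕ.+ i)

    red : ∀ i → ∃ λ g → ∃ λ c → ∃ λ e → (M ≡ c ℕ.* g) × (2 ℕ.+ i ≡ e ℕ.* g) × Coprime c e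
    red i = reduce M (2 ℕ.+ i) (ℕ.s≤s ℕ.z≤n)

    gᵢ cᵢ eᵢ : ℕ → ℕ
    gᵢ i = proj₁ (red i)
    cᵢ i = proj₁ (proj₂ (red i))
    eᵢ i = proj₁ (proj₂ (proj₂ (red i)))
    M≡ : ∀ i → M ≡ cᵢ i ℕ.* gᵢ i
    M≡ i = proj₁ (proj₂ (proj₂ (proj₂ (red i))))
    k≡ : ∀ i → 2 ℕ.+ i ≡ eᵢ i ℕ.* gᵢ i
    k≡ i = proj₁ (proj₂ (proj₂ (proj₂ (proj₂ (red i)))))
    cop : ∀ i → Coprime (cᵢ i) (eᵢ i)
    cop i = proj₂ (proj₂ (proj₂ (proj₂ (proj₂ (red i)))))

    -- The possible prime factors p ≤ D of the cofactor of n + k: sifting excludes the small ones only while r i ≤ R₀.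
    data Candidates (i : ℕ) : List ℕ → Set where
      few : r i ℕ.≤ R₀ → Candidates i (range (z (suc (J ∸ r i))) (z (suc J)))
      all : R₀ ℕ.< r i → Candidates i (range 1 (z (suc J)))

    candidates : ∀ i → ∃ (Candidates i)
    candidates i with r i ℕₚ.≤? R₀
    ... | yes h = _ , few h
    ... | no h = _ , all (ℕₚ.≰⇒> h)

    L : ℕ → List ℕ
    L i = proj₁ (candidates i)

    L-prime : ∀ i → All Prime (L i)
    L-prime i = go (proj₂ (candidates i))
      where
      go : ∀ {L} → Candidates i L → All Prime L
      go (few _) = range-prime (z (suc (J ∸ r i))) (z (suc J))
      go (all _) = range-prime 1 (z (suc J))

    2j≤J : 2 ℕ.* j ℕ.≤ J
    2j≤J = ℕₚ.≤-trans (ℕₚ.*-monoʳ-≤ 2 {j} {2 ℕ.^ j} (ℕₚ.<⇒≤ (n<2^n j))) (ℕₚ.≤-trans (ℕₚ.*-monoˡ-≤ (2 ℕ.^ j) {2} {2 ℕ.^ j} (ℕₚ.^-monoʳ-≤ 2 {1} {j} (ℕ.s≤s ℕ.z≤n))) (ℕₚ.≤-reflexive (sym (4^≡ j))))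

    -- In the sieved case the candidates span `r i` quadrupling steps of the exponent. Otherwise
    -- `r i > J - j`, and `2 * j ≤ J` makes all `J + 1` steps at most `2 * r i`; that case fixes the
    -- exponent.
    L-mertens : ∀ i → 1ℚ ≤ ι (64 ℕ.^ (2 ℕ.* r i)) * θ (L i)
    L-mertens i = go (proj₂ (candidates i))
      where
      weaken : ∀ n (L : List ℕ) → n ℕ.≤ 2 ℕ.* r i → 1ℚ ≤ ι (64 ℕ.^ n) * θ L → 1ℚ ≤ ι (64 ℕ.^ (2 ℕ.* r i)) * θ L
      weaken n L h h′ = ≤-trans h′ (*ʳ (θ≥0 L) (ι-mono (ℕₚ.^-monoʳ-≤ 64 h)))
      go : ∀ {L} → Candidates i L → 1ℚ ≤ ι (64 ℕ.^ (2 ℕ.* r i)) * θ L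
      go (few h) = weaken (r i) (range (z (suc (J ∸ r i))) (z (suc J))) (ℕₚ.m≤n*m (r i) 2)
         (subst (λ w → 1ℚ ≤ ι (64 ℕ.^ r i) * θ (range (z (suc (J ∸ r i))) (z (suc w)))) (ℕₚ.m∸n+n≡m (ℕₚ.≤-trans h (ℕₚ.<⇒≤ R₀<J))) (mertens-range (J ∸ r i) (r i)))
      go (all h) = weaken (suc J) (range 1 (z (suc J))) le (mertens-all J)
        where
        le : suc J ℕ.≤ 2 ℕ.* r i
        le = ℕₚ.+-cancelʳ-≤ (2 ℕ.* j) (suc J) (2 ℕ.* r i) (ℕₚ.≤-trans (ℕₚ.+-monoʳ-≤ (suc J) 2j≤J)
          (ℕₚ.≤-trans (ℕₚ.≤-trans (ℕₚ.n≤1+n _) (ℕₚ.≤-reflexive e₁)) (ℕₚ.+-monoˡ-≤ (2 ℕ.* j) (ℕₚ.*-monoʳ-≤ 2 h))))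
          where
          l : ∀ a b → suc (suc ((a ℕ.+ b) ℕ.+ (a ℕ.+ b))) ≡ 2 ℕ.* suc a ℕ.+ 2 ℕ.* b
          l = solve-∀
          e₁ : suc (suc (J ℕ.+ J)) ≡ 2 ℕ.* suc R₀ ℕ.+ 2 ℕ.* j
          e₁ = trans (cong (λ w → suc (suc (w ℕ.+ w))) (sym (ℕₚ.m∸n+n≡m (ℕₚ.<⇒≤ j<J)))) (l R₀ j)

    h : ℕ → ℚ
    h i = hsym f (t i) (L i)

    y≥6 : 6 ℕ.≤ y
    y≥6 = ℕₚ.≤-trans (ℕₚ.m≤m+n 6 10) (z-mono {1} {j} (ℕ.s≤s ℕ.z≤n))

    h-bound : ∀ i → ι (64 ℕ.* (suc i ℕ.* (2 ℕ.+ i))) * h i ≤ 1ℚ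
    h-bound i = cancelˡ B B>0 (begin
      ι B * (ι Z * h i) ≡⟨ trans (sym (*-assoc (ι B) (ι Z) (h i))) (cong (_* h i) (sym (ι-* B Z))) ⟩
      ι (B ℕ.* Z) * h i ≤⟨ *ʳ h≥0 (ι-mono BZ≤) ⟩
      ι (2 ℕ.^ s i) * h i ≤⟨ hsym-bound {y} (L i) (s i) y≥6 (All.map prime≥2 (L-prime i)) (L-mertens i) ⟩
      ι B ≡⟨ sym (*-identityʳ (ι B)) ⟩
      ι B * 1ℚ ∎)
      where
      B = (64 ℕ.^ (2 ℕ.* r i)) ℕ.^ 6
      Z = 64 ℕ.* (suc i ℕ.* (2 ℕ.+ i))
      h≥0 : 0ℚ ≤ h i
      h≥0 = hsym≥0 f f≥0 (t i) (L i)
      B≡ : B ≡ 2 ℕ.^ (6 ℕ.* (2 ℕ.* r i) ℕ.* 6)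
      B≡ = trans (cong (ℕ._^ 6) (ℕₚ.^-*-assoc 2 6 (2 ℕ.* r i))) (ℕₚ.^-*-assoc 2 (6 ℕ.* (2 ℕ.* r i)) 6)
      B>0 : 0 ℕ.< B
      B>0 = subst (0 ℕ.<_) (sym B≡) (ℕₚ.m^n>0 2 (6 ℕ.* (2 ℕ.* r i) ℕ.* 6))
      Z≤ : Z ℕ.≤ 2 ℕ.^ (6 ℕ.+ (r i ℕ.+ r i))
      Z≤ = ℕₚ.≤-trans (ℕₚ.*-monoʳ-≤ 64 (ℕₚ.*-mono-≤ (ℕₚ.≤-trans (ℕₚ.n≤1+n (suc i)) (ℕₚ.<⇒≤ (k<2^r i))) (ℕₚ.<⇒≤ (k<2^r i))))
         (ℕₚ.≤-reflexive (sym (trans (ℕₚ.^-distribˡ-+-* 2 6 (r i ℕ.+ r i)) (cong (64 ℕ.*_) (ℕₚ.^-distribˡ-+-* 2 (r i) (r i))))))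
      BZ≤ : B ℕ.* Z ℕ.≤ 2 ℕ.^ s i
      BZ≤ = ℕₚ.≤-trans (ℕₚ.*-mono-≤ (ℕₚ.≤-reflexive B≡) Z≤) (ℕₚ.≤-trans (ℕₚ.≤-reflexive (sym (ℕₚ.^-distribˡ-+-* 2 (6 ℕ.* (2 ℕ.* r i) ℕ.* 6) (6 ℕ.+ (r i ℕ.+ r i))))) (ℕₚ.^-monoʳ-≤ 2 (c₂-spec (ℓ>0 i))))

    -- A bound for `n` that does not depend on the survivor; only shifts below `n` are treated by
    -- the averaging.
    N : ℕ
    N = M ℕ.* X

    -- A majorant for the event that the cofactor of shift `2 + i` has a divisor up to `D` made of
    -- exactly `t i` candidate primes.
    R : ℕ → ℕ → ℚ
    R i m = msum (λ ds → τ (cᵢ i) (eᵢ i) (cop i) m (product ds)) (t i) (L i) []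

    R≥0 : ∀ i m → 0ℚ ≤ R i m
    R≥0 i m = msum≥0 (λ ds → τ≥0 (cᵢ i) (eᵢ i) (cop i) m (product ds)) (t i) (L i) []

    Rtot : ℕ → ℚ
    Rtot m = Σ< N (λ i → R i m)

    bad : ℚ
    bad = Σ< X (λ m → σ m * Rtot m)

    bad≤ : ι 64 * bad ≤ 5ℚ * (V₀ * ι X)
    bad≤ = begin
      ι 64 * bad ≡⟨ cong (ι 64 *_) (trans (Σ-cong X (λ m → sym (Σ-*ˡ N (σ m) (λ i → R i m)))) (sym (Σ-swap N X (λ i m → σ m * R i m)))) ⟩
      ι 64 * Σ< N (λ i → Σ< X (λ m → σ m * R i m)) ≤⟨ *ˡ (ι≥0 64) (Σ-mono N (λ i _ → rough-sum (cᵢ i) (eᵢ i) (cop i) (t i) (L i) (L-prime i))) ⟩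
      ι 64 * Σ< N (λ i → 5ℚ * V₀ * ι X * h i) ≡⟨ cong (ι 64 *_) (Σ-*ˡ N (5ℚ * V₀ * ι X) h) ⟩
      ι 64 * (5ℚ * V₀ * ι X * Σ< N h) ≡⟨ solve 4 (λ a v x s → a :* (con 5ℚ :* v :* x :* s) := con 5ℚ :* (v :* x) :* (a :* s)) refl (ι 64) V₀ (ι X) (Σ< N h) ⟩
      5ℚ * (V₀ * ι X) * (ι 64 * Σ< N h) ≤⟨ *ˡ (*-≥0 (nonNegative⁻¹ 5ℚ) (≤-trans 0≤1 VX≥1)) (≤-trans (Σ-telescope N h h-bound) (1-≤1 (inv-nonneg (suc N)))) ⟩
      5ℚ * (V₀ * ι X) * 1ℚ ≡⟨ *-identityʳ (5ℚ * (V₀ * ι X)) ⟩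
      5ℚ * (V₀ * ι X) ∎

    -- A positive summand forces both `σ m > 0` and `Rtot m < 1`, so a single `m` survives the sieve
    -- and is exceptional for no shift.
    excess : ℚ
    excess = Σ< X (λ m → σ m + (- 1ℚ) * (σ m * Rtot m))

    excess≡ : excess ≡ Σ< X σ - bad
    excess≡ = trans (Σ-+ X σ (λ m → (- 1ℚ) * (σ m * Rtot m))) (trans (cong (Σ< X σ +_) (Σ-*ˡ X (- 1ℚ) (λ m → σ m * Rtot m)))
       (solve 2 (λ a b → a :+ (:- con 1ℚ) :* b := a :- b) refl (Σ< X σ) bad))

    64ℚ : ℚ
    64ℚ = 8ℚ * 8ℚ

    ι64 : ι 64 ≡ 64ℚ
    ι64 = trans (ι-* 8 8) (cong (λ w → w * w) (trans (ι-+ 4 4) (cong (λ w → w + w) (trans (ι-+ 2 2) (cong (λ w → w + w) ι2)))))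

    excess>0 : 0ℚ < excess
    excess>0 with 0ℚ <? excess
    ... | yes p = p
    ... | no ¬p = ⊥-elim (1≰0 (begin
      1ℚ ≤⟨ VX≥1 ⟩
      -- Survivors weigh at least `VX / 4` and exceptions at most `5 * VX / 64`; multiplied by 64
      -- this leaves `16 * VX - 5 * VX = 11 * VX`.
      VX ≤⟨ ≤+ˡ (*-≥0 (nonNegative⁻¹ (5ℚ + 5ℚ)) (≤-trans 0≤1 VX≥1)) ⟩
      VX + (5ℚ + 5ℚ) * VX ≡⟨ solve 1 (λ v → v :+ con (5ℚ + 5ℚ) :* v := con (8ℚ + 8ℚ) :* v :- con 5ℚ :* v) refl VX ⟩
      (8ℚ + 8ℚ) * VX - 5ℚ * VX ≤⟨ -mono (*ˡ (nonNegative⁻¹ (8ℚ + 8ℚ)) VX≤4σ) bad≤ ⟩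
      (8ℚ + 8ℚ) * (4ℚ * Σ< X σ) - ι 64 * bad ≡⟨ cong (λ w → (8ℚ + 8ℚ) * (4ℚ * Σ< X σ) - w * bad) ι64 ⟩
      (8ℚ + 8ℚ) * (4ℚ * Σ< X σ) - 64ℚ * bad ≡⟨ solve 2 (λ a b → con (8ℚ + 8ℚ) :* (con 4ℚ :* a) :- con 64ℚ :* b := con 64ℚ :* (a :- b)) refl (Σ< X σ) bad ⟩
      64ℚ * (Σ< X σ - bad) ≡⟨ cong (64ℚ *_) (sym excess≡) ⟩
      64ℚ * excess ≤⟨ *ˡ (nonNegative⁻¹ 64ℚ) (≮⇒≥ ¬p) ⟩
      64ℚ * 0ℚ ≡⟨ *-zeroʳ 64ℚ ⟩
      0ℚ ∎))
      where VX = V₀ * ι X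

    found : ∃ λ m → (m ℕ.< X) × (0ℚ < σ m + (- 1ℚ) * (σ m * Rtot m))
    found = Σ-pos X _ excess>0

    m₀ : ℕ
    m₀ = proj₁ found
    m₀<X : m₀ ℕ.< X
    m₀<X = proj₁ (proj₂ found)
    m₀-good : 0ℚ < σ m₀ + (- 1ℚ) * (σ m₀ * Rtot m₀)
    m₀-good = proj₂ (proj₂ found)

    σ≢0 : σ m₀ ≢ 0ℚ
    σ≢0 e = <-irrefl (sym (trans (cong (λ w → w + (- 1ℚ) * (w * Rtot m₀)) e) (solve 1 (λ r → con 0ℚ :+ (:- con 1ℚ) :* (con 0ℚ :* r) := con 0ℚ) refl (Rtot m₀)))) m₀-good

    ¬R≥1 : ∀ i → i ℕ.< N → ¬ 1ℚ ≤ R i m₀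
    ¬R≥1 i l h′ = <-irrefl refl (<-≤-trans m₀-good (begin
      σ m₀ + (- 1ℚ) * (σ m₀ * Rtot m₀) ≡⟨ solve 2 (λ a b → a :+ (:- con 1ℚ) :* (a :* b) := a :* con 1ℚ :- a :* b) refl (σ m₀) (Rtot m₀) ⟩
      σ m₀ * 1ℚ - σ m₀ * Rtot m₀ ≤⟨ -mono (*ˡ (σ≥0 m₀) (≤-trans h′ (Σ-term≤ N (λ i → R i m₀) i l (λ i → R≥0 i m₀)))) (≤-refl {σ m₀ * Rtot m₀}) ⟩
      σ m₀ * Rtot m₀ - σ m₀ * Rtot m₀ ≡⟨ +-inverseʳ (σ m₀ * Rtot m₀) ⟩
      0ℚ ∎))

    sift-zero : ∀ R n {ρ p k} → R ℕ.≤ R₀ → 1 ℕ.≤ ρ → ρ ℕ.≤ R → p ∈ primes (blk ρ) → k ℕ.< 2 ℕ.^ ρ → p ∣ M ℕ.* n ℕ.+ suc k → sift M (fam R) n ≡ 0ℚ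
    sift-zero zero n hR h₁ h₂ p∈ k< d = contradiction h₁ (ℕₚ.<⇒≱ (ℕ.s≤s h₂))
    sift-zero (suc R) n {ρ} {p} {k} hR h₁ h₂ p∈ k< d with ρ ℕₚ.≟ suc R
    ... | yes refl = trans (cong (_* sift M (fam R) n) (∏1-zero (λ p → ev M (2 ℕ.^ ρ) p n) p∈ (≤-antisym
           (ev≤1 M (2 ℕ.^ ρ) p n (2K≤p⇒K<p (2 ℕ.^ ρ) (proj₁ big) (proj₂ big))) (ev≥1 M (2 ℕ.^ ρ) p n k k< d)))) (*-zeroˡ (sift M (fam R) n))
      where big = All.lookup (blk-big hR) p∈
    ... | no ne = trans (cong (∏1- (vals (λ K p → ev M K p n) (blk (suc R))) *_) (sift-zero R n (ℕₚ.≤-trans (ℕₚ.n≤1+n R) hR) h₁ (ℕₚ.≤-pred (ℕₚ.≤∧≢⇒< h₂ ne)) p∈ k< d))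
           (*-zeroʳ (∏1- (vals (λ K p → ev M K p n) (blk (suc R)))))

    -- The blocks are adjacent, so walking up from the smallest primes meets the one containing `p`.
    -- That its index is at least `ρ` matters: its width then still covers every shift below
    -- `2 ^ ρ`.
    find-block : ∀ R {ρ p} → R ℕ.≤ R₀ → 1 ℕ.≤ ρ → ρ ℕ.≤ R → Prime p → z (J ∸ R) ℕ.< p → p ℕ.≤ z (suc (J ∸ ρ)) →
      ∃ λ ρ′ → (ρ ℕ.≤ ρ′) × (ρ′ ℕ.≤ R) × (p ∈ primes (blk ρ′))
    find-block zero hR h₁ h₂ pr l u = contradiction h₁ (ℕₚ.<⇒≱ (ℕ.s≤s h₂))
    find-block (suc R) {ρ} {p} hR h₁ h₂ pr l u with p ℕₚ.≤? z (suc (J ∸ suc R))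
    ... | yes le = suc R , h₂ , ℕₚ.≤-refl , range-∈ pr l le
    ... | no gt with ρ ℕₚ.≟ suc R
    ...   | yes refl = contradiction u gt
    ...   | no ne = let (ρ′ , a , b , c) = find-block R (ℕₚ.≤-trans (ℕₚ.n≤1+n R) hR) h₁ (ℕₚ.≤-pred (ℕₚ.≤∧≢⇒< h₂ ne)) pr (subst (λ w → z w ℕ.< p) (suc-∸ hR) (ℕₚ.≰⇒> gt)) u
                    in ρ′ , a , ℕₚ.m≤n⇒m≤1+n b , c

    n : ℕ
    n = M ℕ.* suc m₀

    mᵢ : ℕ → ℕ
    mᵢ i = cᵢ i ℕ.* suc m₀ ℕ.+ eᵢ i

    n+k≡ : ∀ i → n ℕ.+ (2 ℕ.+ i) ≡ gᵢ i ℕ.* mᵢ i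
    n+k≡ i = trans (cong₂ (λ a b → a ℕ.* suc m₀ ℕ.+ b) (M≡ i) (k≡ i)) (l (cᵢ i) (gᵢ i) (suc m₀) (eᵢ i))
      where
      l : ∀ c g m e → c ℕ.* g ℕ.* m ℕ.+ e ℕ.* g ≡ g ℕ.* (c ℕ.* m ℕ.+ e)
      l = solve-∀

    -- Primes up to `y` are excluded by the shape of `M`; larger ones lie in a block wide enough for
    -- the shift `2 + i`, and would make the sifted weight vanish.
    not-sifted-out : ∀ i {p} → r i ℕ.≤ R₀ → Prime p → p ∣ mᵢ i → ¬ p ℕ.≤ z (suc (J ∸ r i))
    not-sifted-out i {p} r≤ pr p∣m le = split (p ℕₚ.≤? y)
      where
      split : Dec (p ℕ.≤ y) → ⊥
      split (yes p≤y) = coprime-cofactor y (M≡ i) (k≡ i) (ℕ.s≤s ℕ.z≤n) k≤y (cop i) pr p≤y (suc m₀) p∣m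
        where
        k≤y : 2 ℕ.+ i ℕ.≤ y
        k≤y = ℕₚ.≤-trans (ℕₚ.<⇒≤ (k<2^r i)) (ℕₚ.≤-trans (ℕₚ.m≤n*m (2 ℕ.^ r i) 2) (2K≤y r≤))
      split (no p≰y) = finish (find-block R₀ ℕₚ.≤-refl (ℕ.s≤s ℕ.z≤n) r≤ pr below le)
        where
        below : z (J ∸ R₀) ℕ.< p
        below = subst (λ w → z w ℕ.< p) (sym (ℕₚ.m∸[m∸n]≡n (ℕₚ.<⇒≤ j<J))) (ℕₚ.≰⇒> p≰y)
        finish : (∃ λ ρ → (r i ℕ.≤ ρ) × (ρ ℕ.≤ R₀) × (p ∈ primes (blk ρ))) → ⊥
        -- The index `suc i` stands for the shift `2 + i`, because `ev` counts shifts from 1.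
        finish (ρ , a , b , p∈) = σ≢0 (sift-zero R₀ (suc m₀) {ρ} {p} {suc i} ℕₚ.≤-refl (ℕₚ.≤-trans (ℕ.s≤s ℕ.z≤n) a) b p∈
           (ℕₚ.<-≤-trans (ℕₚ.<-trans (ℕₚ.n<1+n (suc i)) (k<2^r i)) (ℕₚ.^-monoʳ-≤ 2 a)) (subst (p ∣_) (sym (n+k≡ i)) (∣n⇒∣m*n (gᵢ i) p∣m)))

    prime-candidate : ∀ i {p} → Prime p → p ∣ mᵢ i → p ℕ.≤ D → p ∈ L i
    prime-candidate i {p} pr p∣m p≤D = go (proj₂ (candidates i))
      where
      p≤z : p ℕ.≤ z (suc J)
      p≤z = ℕₚ.≤-trans p≤D (z-mono (ℕₚ.n≤1+n J))
      go : ∀ {L} → Candidates i L → p ∈ L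
      go (all _) = range-∈ {1} pr (prime≥2 pr) p≤z
      go (few r≤) = split (p ℕₚ.≤? z (suc (J ∸ r i)))
        where
        split : Dec (p ℕ.≤ z (suc (J ∸ r i))) → p ∈ range (z (suc (J ∸ r i))) (z (suc J))
        split (no gt) = range-∈ {z (suc (J ∸ r i))} pr (ℕₚ.≰⇒> gt) p≤z
        split (yes le) = ⊥-elim (not-sifted-out i r≤ pr p∣m le)

    -- `(y !)^2` is at most `y ^ (2 * y) = 2 ^ (2 * J * 2 ^ J)`, and `2 * J ≤ 2 ^ J` brings the
    -- exponent below `4 ^ J = W`.
    M≤D : M ℕ.≤ D
    M≤D = ℕₚ.≤-trans (ℕₚ.*-mono-≤ y!≤ y!≤) (ℕₚ.≤-trans (ℕₚ.≤-reflexive (sym (ℕₚ.^-distribˡ-+-* 2 (J ℕ.* y) (J ℕ.* y)))) (ℕₚ.^-monoʳ-≤ 2 le))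
      where
      y!≤ : y ! ℕ.≤ 2 ℕ.^ (J ℕ.* y)
      y!≤ = ℕₚ.≤-trans (m!≤m^m y ℕₚ.≤-refl) (ℕₚ.≤-reflexive (ℕₚ.^-*-assoc 2 J y))
      2J≤ : ∀ a → 0 ℕ.< a → 2 ℕ.* a ℕ.≤ 2 ℕ.^ a
      2J≤ (suc a) _ = ℕₚ.*-monoʳ-≤ 2 (n<2^n a)
      le : J ℕ.* y ℕ.+ J ℕ.* y ℕ.≤ W
      le = ℕₚ.≤-trans (ℕₚ.≤-reflexive (l J y)) (ℕₚ.≤-trans (ℕₚ.*-monoˡ-≤ y (2J≤ J (ℕₚ.m^n>0 4 j))) (ℕₚ.≤-reflexive (sym (4^≡ J))))
        where
        l : ∀ a b → a ℕ.* b ℕ.+ a ℕ.* b ≡ 2 ℕ.* a ℕ.* b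
        l = solve-∀

    n≤N : n ℕ.≤ N
    n≤N = ℕₚ.*-monoʳ-≤ M m₀<X

    y>0 : 0 ℕ.< y
    y>0 = ℕₚ.m^n>0 2 J

    y≤M : y ℕ.≤ M
    y≤M = ℕₚ.≤-trans (∣⇒≤ {{ℕ.>-nonZero (ℕₚ.1≤n! y)}} (∣! y>0 ℕₚ.≤-refl)) (ℕₚ.m≤m*n (y !) (y !) {{ℕ.>-nonZero (ℕₚ.1≤n! y)}})

    y≤n : y ℕ.≤ n
    y≤n = ℕₚ.≤-trans y≤M (ℕₚ.m≤m*n M (suc m₀))

    gm>0 : ∀ i → 0 ℕ.< gᵢ i ℕ.* mᵢ i
    gm>0 i = subst (0 ℕ.<_) (n+k≡ i) (ℕₚ.<-≤-trans (ℕ.s≤s ℕ.z≤n) (ℕₚ.m≤n+m (2 ℕ.+ i) n))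

    g>0 : ∀ i → ℕ.NonZero (gᵢ i)
    g>0 i = ℕ.≢-nonZero (λ e → ℕₚ.<⇒≢ (gm>0 i) (sym (cong (ℕ._* mᵢ i) e)))

    m>0 : ∀ i → ℕ.NonZero (mᵢ i)
    m>0 i = ℕ.≢-nonZero (λ e → ℕₚ.<⇒≢ (gm>0 i) (sym (trans (cong (gᵢ i ℕ.*_) e) (ℕₚ.*-zeroʳ (gᵢ i)))))

    m<D^ : ∀ i → 2 ℕ.+ i ℕ.< n → mᵢ i ℕ.< D ℕ.^ c₁
    m<D^ i k<n = ℕₚ.≤-<-trans (ℕₚ.m≤n*m (mᵢ i) (gᵢ i) {{g>0 i}}) (subst (ℕ._< D ℕ.^ c₁) (n+k≡ i) (ℕₚ.<-≤-trans (ℕₚ.+-monoʳ-< n k<n) nn≤))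
      where
      nn≤ : n ℕ.+ n ℕ.≤ D ℕ.^ c₁
      nn≤ = ℕₚ.≤-trans (ℕₚ.+-mono-≤ n≤N n≤N) (ℕₚ.≤-trans (ℕₚ.≤-reflexive (cong (N ℕ.+_) (sym (ℕₚ.+-identityʳ N)))) (ℕₚ.≤-trans (ℕₚ.*-mono-≤ {2} {D} {N} {D ℕ.* X} (ℕₚ.^-monoʳ-≤ 2 {1} {W} W>0) (ℕₚ.*-monoˡ-≤ X M≤D))
          (ℕₚ.≤-reflexive (trans (cong (D ℕ.*_) (sym (ℕₚ.^-distribˡ-+-* 2 W (512 ℕ.* W)))) (trans (sym (ℕₚ.^-distribˡ-+-* 2 W (W ℕ.+ 512 ℕ.* W))) (trans (cong (2 ℕ.^_) (c₁-spec W)) (sym (ℕₚ.^-*-assoc 2 W c₁))))))))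

    -- The cofactor is below `D ^ c₁`, so more than `c₁ * t i` primes would contain `t i` with
    -- product at most `D`. All of them are candidates, so `R i m₀` would be at least 1.
    cofactor-length : ∀ i {fs} → 2 ℕ.+ i ℕ.< n → All Prime fs → mᵢ i ≡ product fs → length fs ℕ.≤ c₁ ℕ.* t i
    cofactor-length i {fs} k<n prs eq = ℕₚ.≮⇒≥ (λ gt → ¬R≥1 i i<N (R≥1 (small-divisor {Prime} D (t i) c₁ fs prs (product>0 prs) (ℕₚ.<⇒≤ gt) (subst (ℕ._< D ℕ.^ c₁) eq (m<D^ i k<n)))))
      where
      i<N : i ℕ.< N
      i<N = ℕₚ.<-≤-trans (ℕₚ.<-trans (ℕₚ.<-trans (ℕₚ.n<1+n i) (ℕₚ.n<1+n (suc i))) k<n) n≤N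
      R≥1 : (∃ λ es → (length es ≡ t i) × All Prime es × (product es ∣ product fs) × (product es ℕ.≤ D)) → 1ℚ ≤ R i m₀
      R≥1 (es , len , prs′ , d , le) = msum≥1 (τ (cᵢ i) (eᵢ i) (cop i) m₀) (τ≥0 (cᵢ i) (eᵢ i) (cop i) m₀) (t i) (L i) es [] len mem
            (≤-reflexive (sym (trans (cong (τ (cᵢ i) (eᵢ i) (cop i) m₀) (ℕₚ.*-identityʳ (product es)))
              (cong₂ _*_ (χ-yes (product es ℕₚ.≤? D) le) (χ-yes (product es ∣? mᵢ i) (subst (product es ∣_) (sym eq) d))))))
        where
        go : ∀ {xs} → All Prime xs → All (ℕ._≤ product es) xs → All (_∣ product es) xs → All (_∈ L i) xs
        go [] [] [] = []
        go {x ∷ xs} (a ∷ as) (b ∷ bs) (c ∷ cs) = prime-candidate i a (subst (x ∣_) (sym eq) (∣-trans c d)) (ℕₚ.≤-trans b le) ∷ go as bs cs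
        mem : All (_∈ L i) es
        mem = go prs′ (members≤product prs′) (All.tabulate ∈⇒∣product)

    conclusion : ∀ k → 2 ℕ.≤ k → Ω (n ℕ.+ k) ℕ.≤ C ℕ.* ⌊log₂ k ⌋
    conclusion (suc zero) (ℕ.s≤s ())
    conclusion (suc (suc i)) _ = split (n ℕₚ.≤? 2 ℕ.+ i)
      where
      split : Dec (n ℕ.≤ 2 ℕ.+ i) → Ω (n ℕ.+ (2 ℕ.+ i)) ℕ.≤ C ℕ.* ℓ i
      -- Here `n + k ≤ 2 * k`, so there are at most `1 + ⌊log₂ k ⌋` prime factors, and `k ≥ 2`
      -- absorbs the 1.
      split (yes n≤k) = subst (λ w → Ω w ℕ.≤ C ℕ.* ℓ i) (sym (isFactorisation F)) (ℕₚ.≤-trans (Ω≤length (factorsPrime F))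
           (ℕₚ.≤-trans (length≤log {factors F} {2 ℕ.* k} (factorsPrime F) (ℕₚ.≤-trans (ℕₚ.≤-reflexive (sym (isFactorisation F))) (ℕₚ.≤-trans (ℕₚ.+-monoˡ-≤ k n≤k) (ℕₚ.≤-reflexive (cong (k ℕ.+_) (sym (ℕₚ.+-identityʳ k)))))))
             (ℕₚ.≤-trans (ℕₚ.≤-reflexive (⌊log₂[2*b]⌋≡1+⌊log₂b⌋ k)) (ℕₚ.≤-trans (ℕₚ.+-monoˡ-≤ (ℓ i) (ℓ>0 i)) (ℕₚ.≤-trans (ℕₚ.≤-reflexive (cong (ℓ i ℕ.+_) (sym (ℕₚ.+-identityʳ (ℓ i))))) (ℕₚ.*-monoˡ-≤ (ℓ i) {2} {C} (ℕ.s≤s c₁c₂≥1)))))))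
        where
        k = 2 ℕ.+ i
        F : PrimeFactorisation (n ℕ.+ k)
        F = factorise (n ℕ.+ k) {{ℕ.>-nonZero (ℕₚ.<-≤-trans (ℕ.s≤s ℕ.z≤n) (ℕₚ.m≤n+m k n))}}
      -- The factorisations of `g` and of the cofactor are concatenated; `g ≤ k` has at most
      -- `⌊log₂ k ⌋` prime factors.
      split (no n≰k) = subst (λ w → Ω w ℕ.≤ C ℕ.* ℓ i) (sym eq) (ℕₚ.≤-trans (Ω≤length (Allₚ.++⁺ (factorsPrime G) (factorsPrime H)))
           (ℕₚ.≤-trans (ℕₚ.≤-reflexive (length-++ (factors G))) (ℕₚ.≤-trans (ℕₚ.+-mono-≤ gl (cofactor-length i {factors H} (ℕₚ.≰⇒> n≰k) (factorsPrime H) (isFactorisation H))) (ℕₚ.≤-reflexive (l (ℓ i))))))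
        where
        G : PrimeFactorisation (gᵢ i)
        G = factorise (gᵢ i) {{g>0 i}}
        H : PrimeFactorisation (mᵢ i)
        H = factorise (mᵢ i) {{m>0 i}}
        eq : n ℕ.+ (2 ℕ.+ i) ≡ product (factors G ++ factors H)
        eq = trans (n+k≡ i) (trans (cong₂ ℕ._*_ (isFactorisation G) (isFactorisation H)) (sym (product-++ (factors G) (factors H))))
        gl : length (factors G) ℕ.≤ ℓ i
        gl = length≤log {factors G} {2 ℕ.+ i} (factorsPrime G) (ℕₚ.≤-trans (ℕₚ.≤-reflexive (sym (isFactorisation G))) (∣⇒≤ (divides (eᵢ i) (k≡ i))))
        l : ∀ x → x ℕ.+ c₁ ℕ.* (2 ℕ.* (c₂ ℕ.* x)) ≡ C ℕ.* x
        l x = l′ x c₁ c₂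
          where
          l′ : ∀ x a b → x ℕ.+ a ℕ.* (2 ℕ.* (b ℕ.* x)) ≡ (1 ℕ.+ a ℕ.* (2 ℕ.* b)) ℕ.* x
          l′ = solve-∀

-- Infinitely many n

open import Defs
open import Data.Nat using (ℕ; suc; s≤s; z≤n; _+_; _*_; _^_; _≤_; _<_)
open import Data.Nat.Logarithm using (⌊log₂_⌋)
open import Data.Nat.Properties using (≤-trans; <⇒≤; <-trans; <-≤-trans; n<1+n; m≤n+m)
open import Data.Product using (Σ; _×_; _,_)
open PrimeFactors using (ω≤Ω)
open Sieve using (C; n<2^n; z; module Family; module Main)

theorem1 : Σ ℕ (λ C → (0 < C) × ((N : ℕ) → Σ ℕ (λ n → (N < n) ×
    ((k : ℕ) → 2 ≤ k → (ω (n + k) ≤ Ω (n + k)) × (Ω (n + k) ≤ C * ⌊log₂ k ⌋)))))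
-- With `j₀ = N` the survivor is at least `y = z (suc N)`, which exceeds `N`.
theorem1 = C , s≤s z≤n , λ N → Main.n N , <-≤-trans (large N) (Main.y≤n N) ,
  λ k k≥2 → ω≤Ω (Main.n N + k) (<-≤-trans (s≤s z≤n) (≤-trans k≥2 (m≤n+m k (Main.n N)))) , Main.conclusion N k k≥2
  where
  large : ∀ N → N < z (suc N)
  large N = <-≤-trans (<-trans (n<1+n N) (Family.j<J N)) (<⇒≤ (n<2^n (4 ^ suc N)))
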